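{- Let $n\ge1$, $a_1,\ldots,a_n$ nonnegative integers, $\lambda=\sum a_i\omega_i$. For every symmetric $E\in\mathbf R_p$ one has $x(E)\in\varphi(P_\lambda)$ and $\varphi^{ -1}(x(E))$ is a vertex of $P_\lambda$. Moreover, there is a bijection $\Xi:E\mapsto w_C(E)$ from the set of symmetric $E\in\mathbf R_p$ onto the Weyl group $W$ of $\mathfrak{sp}_{2n}$ such that $T_{w_C(E)}=\varphi^{ -1}(x(E))$ for every symmetric $E\in\mathbf R_p$.
   Context: $\mathfrak{sp}_{2n}$ has simple roots $\alpha_1,\ldots,\alpha_n$ with $\alpha_n$ long, fundamental weights $\omega_i$; for $k>n$ set $\alpha_k=\alpha_{2n-k}$ and $\alpha_{i,j}=\alpha_i+\ldots+\alpha_{j-1}$. $U=\mathbb R^{n^2}$ has coordinates $x_{i,j}$, $1\le i<j\le 2n+1-i$. A type $C$ Dyck path is a sequence $d=((i_1,j_1),\ldots,(i_N,j_N))$ of such pairs with $j_1-i_1=1$, each $(i_{k+1},j_{k+1})$ equal to $(i_k+1,j_k)$ or $(i_k,j_k+1)$, and $j_N-i_N=1$ or $i_N+j_N=2n+1$; $S(x,d)=\sum_{(i,j)\in d}x_{i,j}$; $M(\lambda,d)=a_{i_1}+\ldots+a_{i_N}$ if $j_N-i_N=1$, else $a_{i_1}+\ldots+a_n$. $P_\lambda=\{x\in U:x\ge0,\ S(x,d)\le M(\lambda,d)\ \forall d\}$, $\Pi_\lambda=P_\lambda\cap\mathbb Z^{n^2}$. For $T\in\Pi_\lambda$ let $\mu_T=\lambda-\sum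 T_{i,j}\alpha_{i,j}$ (weight of the FFLV basis vector $v_T$); for each $w\in W$ there is a unique $T_w\in\Pi_\lambda$ with $\mu_{T_w}=w\lambda$. Let $U_A=\mathbb R^{n(2n-1)}$ with coordinates $x_{i,j}$, $1\le i<j\le 2n$, and $\varphi:U\to U_A$ the map with $\varphi(x)_{i,j}=x_{i,j}$ if $i+j<2n+1$, $2x_{i,j}$ if $i+j=2n+1$, $x_{2n+1-j,2n+1-i}$ if $i+j>2n+1$. Let $\bar\lambda$ be the $\mathfrak{sl}_{2n}$-weight with coordinates $(\bar a_1,\ldots,\bar a_{2n-1})=(a_1,\ldots,a_{n-1},2a_n,a_{n-1},\ldots,a_1)$. A type $A$ Dyck path is a sequence of pairs $1\le i_k<j_k\le 2n$ with the same step rule, starting and ending with $j-i=1$; $M(\bar\lambda,d)=\bar a_{i_1}+\ldots+\bar a_{i_N}$. Let $R$ be the set of segments $[i,j]$, integers $1\le i<j\le 2n$; $\mathbf R_p$ is the set of $E\subset R$ such that the intersection of any two segments of $E$ with nonempty intersection lies in $E$. $E$ is symmetric if $[2n+1-j,2n+1-i]\in E$ implies $[i,j]\in E$. For $i<j$ let $d^{i,j}=((i,i+1),\ldots,(i,j),(i+1,j),\ldots,(j-1,j))$; $x(E)\in U_A$ is the unique point with $x(E)_{i,j}=0$ for $[i,j]\notin E$ and $S(x(E),d^{i,j})=\bar a_i+\ldots+\bar a_{j-1}$ for $[i,j]\in E$.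
   Formalization: The spaces U and U_A are taken over the rationals instead of the reals: x(E) is a rational point, and "vertex of P_λ" means a point of P_λ that is not a proper convex combination, with rational coefficient, of two distinct rational points of P_λ. -}

module Defs where

open import Data.Bool using (Bool; true; false; if_then_else_)
open import Data.Nat as ℕ using (ℕ; zero; suc; _∸_; _<ᵇ_; _≡ᵇ_)
open import Data.Integer as ℤ using (ℤ; +_)
open import Data.Rational as ℚ using (ℚ; 0ℚ; 1ℚ)
open import Data.Fin using (Fin; toℕ)
open import Data.Fin.Permutation using (Permutation′; _⟨$⟩ʳ_; _⟨$⟩ˡ_)
open import Data.List using (List; []; _∷_; map; foldr; upTo; _++_; concatMap)
open import Data.List.Relation.Unary.All using (All)
open import Data.Product using (Σ; _×_; _,_; proj₁; proj₂)
open import Data.Sum using (_⊎_)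
open import Data.Unit using (⊤)
open import Relation.Binary.PropositionalEquality using (_≡_)

-- Generic helpers (all indices are 1-based natural numbers, as in the paper)

range : ℕ → ℕ → List ℕ
range a b = map (a ℕ.+_) (upTo (suc b ∸ a))

sumℕ : List ℕ → ℕ
sumℕ = foldr ℕ._+_ 0

sumℤ : List ℤ → ℤ
sumℤ = foldr ℤ._+_ (+ 0)

sumℚ : List ℚ → ℚ
sumℚ = foldr ℚ._+_ 0ℚ

ℤtoℚ : ℤ → ℚ
ℤtoℚ z = z ℚ./ 1

ℕtoℚ : ℕ → ℚ
ℕtoℚ k = ℤtoℚ (+ k)

-- Points of U = ℝ^{n²} (resp. U_A) are given by their coordinates x_{i,j};
-- values at index pairs that are not coordinates are irrelevant.
Pt : Set → Set
Pt A = ℕ → ℕ → A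

ValidC : ℕ → ℕ × ℕ → Set
ValidC n (i , j) = (1 ℕ.≤ i) × (i ℕ.< j) × (i ℕ.+ j ℕ.≤ 2 ℕ.* n ℕ.+ 1)

-- (i,j) is a coordinate of U_A (equivalently a segment [i,j] ∈ R):  1 ≤ i < j ≤ 2n
ValidA : ℕ → ℕ × ℕ → Set
ValidA n (i , j) = (1 ℕ.≤ i) × (i ℕ.< j) × (j ℕ.≤ 2 ℕ.* n)

coordsC : ℕ → List (ℕ × ℕ)
coordsC n = concatMap (λ i → map (λ j → (i , j)) (range (suc i) (2 ℕ.* n ℕ.+ 1 ∸ i))) (range 1 n)

-- Type C Dyck paths, represented as (first entry , remaining entries)

Step : ℕ × ℕ → ℕ × ℕ → Set
Step (i , j) (i' , j') = (i' ≡ suc i × j' ≡ j) ⊎ (i' ≡ i × j' ≡ suc j)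

Chain : ℕ × ℕ → List (ℕ × ℕ) → Set
Chain p [] = ⊤
Chain p (q ∷ qs) = Step p q × Chain q qs

lastE : ℕ × ℕ → List (ℕ × ℕ) → ℕ × ℕ
lastE p [] = p
lastE p (q ∷ qs) = lastE q qs

DyckC : ℕ → ℕ × ℕ → List (ℕ × ℕ) → Set
DyckC n p ps =
  (proj₂ p ≡ suc (proj₁ p)) ×
  All (ValidC n) (p ∷ ps) ×
  Chain p ps ×
  ((proj₂ (lastE p ps) ≡ suc (proj₁ (lastE p ps))) ⊎
   (proj₁ (lastE p ps) ℕ.+ proj₂ (lastE p ps) ≡ 2 ℕ.* n ℕ.+ 1))

S : Pt ℚ → List (ℕ × ℕ) → ℚ
S x d = sumℚ (map (λ { (i , j) → x i j }) d)

-- M(λ,d), λ = Σ a_i ω_i given by a : ℕ → ℕ (only a_1..a_n are used)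
MC : ℕ → (ℕ → ℕ) → ℕ × ℕ → List (ℕ × ℕ) → ℕ
MC n a p ps with lastE p ps
... | (iN , jN) =
  if jN ≡ᵇ suc iN
  then sumℕ (map a (range (proj₁ p) iN))
  else sumℕ (map a (range (proj₁ p) n))

InP : ℕ → (ℕ → ℕ) → Pt ℚ → Set
InP n a x =
  (∀ i j → ValidC n (i , j) → 0ℚ ℚ.≤ x i j) ×
  (∀ p ps → DyckC n p ps → S x (p ∷ ps) ℚ.≤ ℕtoℚ (MC n a p ps))

embed : Pt ℤ → Pt ℚ
embed T i j = ℤtoℚ (T i j)

InΠ : ℕ → (ℕ → ℕ) → Pt ℤ → Set
InΠ n a T = InP n a (embed T)

IsVertex : ℕ → (ℕ → ℕ) → Pt ℚ → Set
IsVertex n a y =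
  InP n a y ×
  (∀ (p q : Pt ℚ) (t : ℚ) → InP n a p → InP n a q → 0ℚ ℚ.< t → t ℚ.< 1ℚ →
    (∀ i j → ValidC n (i , j) → y i j ≡ t ℚ.* p i j ℚ.+ (1ℚ ℚ.- t) ℚ.* q i j) →
    ∀ i j → ValidC n (i , j) → p i j ≡ q i j)

φ : ℕ → Pt ℚ → Pt ℚ
φ n x i j =
  if i ℕ.+ j <ᵇ 2 ℕ.* n ℕ.+ 1 then x i j
  else if i ℕ.+ j ≡ᵇ 2 ℕ.* n ℕ.+ 1 then ℤtoℚ (+ 2) ℚ.* x i j
  else x (2 ℕ.* n ℕ.+ 1 ∸ j) (2 ℕ.* n ℕ.+ 1 ∸ i)

EqA : ℕ → Pt ℚ → Pt ℚ → Set
EqA n x y = ∀ i j → ValidA n (i , j) → x i j ≡ y i j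

-- a subset E ⊂ R, via its indicator on segments [i,j] (values off R irrelevant)
SegSet : Set
SegSet = ℕ → ℕ → Bool

_∈E_ : ℕ × ℕ → SegSet → Set
(i , j) ∈E E = E i j ≡ true

-- E ∈ R_p : for [i,j],[k,l] ∈ E with nonempty intersection
-- [max i k , min j l], that intersection is again a segment of E
-- (a one-point intersection is nonempty but is not a segment, hence not in E)
InRp : ℕ → SegSet → Set
InRp n E =
  ∀ i j k l → ValidA n (i , j) → ValidA n (k , l) →
    (i , j) ∈E E → (k , l) ∈E E →
    ℕ._⊔_ i k ℕ.≤ ℕ._⊓_ j l →
    (ℕ._⊔_ i k ℕ.< ℕ._⊓_ j l) × ((ℕ._⊔_ i k , ℕ._⊓_ j l) ∈E E)

Symmetric : ℕ → SegSet → Set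
Symmetric n E =
  ∀ i j → ValidA n (i , j) →
    (2 ℕ.* n ℕ.+ 1 ∸ j , 2 ℕ.* n ℕ.+ 1 ∸ i) ∈E E → (i , j) ∈E E

SymRp : ℕ → SegSet → Set
SymRp n E = InRp n E × Symmetric n E

SameSeg : ℕ → SegSet → SegSet → Set
SameSeg n E E' = ∀ i j → ValidA n (i , j) → E i j ≡ E' i j

abar : ℕ → (ℕ → ℕ) → ℕ → ℕ
abar n a k =
  if k <ᵇ n then a k
  else if k ≡ᵇ n then 2 ℕ.* a n
  else a (2 ℕ.* n ∸ k)

dij : ℕ → ℕ → List (ℕ × ℕ)
dij i j = map (λ k → (i , k)) (range (suc i) j) ++ map (λ k → (k , j)) (range (suc i) (j ∸ 1))

-- x is the point x(E) (the unique point of U_A with these properties)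
IsXE : ℕ → (ℕ → ℕ) → SegSet → Pt ℚ → Set
IsXE n a E x =
  ∀ i j → ValidA n (i , j) →
    (E i j ≡ false → x i j ≡ 0ℚ) ×
    (E i j ≡ true → S x (dij i j) ≡ ℕtoℚ (sumℕ (map (abar n a) (range i (j ∸ 1)))))

-- Weights of sp_{2n} in the ε-basis: a weight is (Fin n → ℤ), f ↦ coefficient
-- of ε_{toℕ f + 1}.  ω_i = ε_1+…+ε_i, α_i = ε_i − ε_{i+1} (i<n), α_n = 2ε_n.

Weight : ℕ → Set
Weight n = Fin n → ℤ

ind : ℕ → ℕ → ℤ
ind m k = if m ≡ᵇ k then + 1 else + 0

-- coefficient of ε_m in α_k for 1 ≤ k ≤ n
αs′ : ℕ → ℕ → ℕ → ℤ
αs′ n k m = if k <ᵇ n then ind m k ℤ.- ind m (suc k) else + 2 ℤ.* ind m n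

-- α_k with the convention α_k = α_{2n-k} for k > n
αs : ℕ → ℕ → ℕ → ℤ
αs n k m = if n <ᵇ k then αs′ n (2 ℕ.* n ∸ k) m else αs′ n k m

αij : ℕ → ℕ → ℕ → ℕ → ℤ
αij n i j m = sumℤ (map (λ k → αs n k m) (range i (j ∸ 1)))

-- λ = Σ a_i ω_i ; coefficient of ε_m is a_m + … + a_n
lam : (n : ℕ) → (ℕ → ℕ) → Weight n
lam n a f = + sumℕ (map a (range (suc (toℕ f)) n))

μ : (n : ℕ) → (ℕ → ℕ) → Pt ℤ → Weight n
μ n a T f =
  lam n a f ℤ.- sumℤ (map (λ { (i , j) → T i j ℤ.* αij n i j (suc (toℕ f)) }) (coordsC n))

-- The Weyl group W of sp_{2n}: signed permutations (π , s),
-- acting by w ε_k = (−1)^{s_k} ε_{π(k)}.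

W : ℕ → Set
W n = Permutation′ n × (Fin n → Bool)

EqW : (n : ℕ) → W n → W n → Set
EqW n (π , s) (π' , s') = ∀ f → (π ⟨$⟩ʳ f ≡ π' ⟨$⟩ʳ f) × (s f ≡ s' f)

applySign : Bool → ℤ → ℤ
applySign true z = ℤ.- z
applySign false z = z

act : (n : ℕ) → W n → Weight n → Weight n
act n (π , s) c f = applySign (s (π ⟨$⟩ˡ f)) (c (π ⟨$⟩ˡ f))

IsTw : (n : ℕ) → (ℕ → ℕ) → W n → Pt ℤ → Set
IsTw n a w T = InΠ n a T × (∀ f → μ n a T f ≡ act n w (lam n a) f)

{-# OPTIONS --safe #-}

-- Write m = 2n and ι k = m + 1 - k.  A set E of segments is read as a triangular network of
-- wires: rows and columns start with R i i = C i i = i, and the cell (i,j) receives R i (j-1)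
-- and C (i+1) j and passes them straight on, as R i j and C i j, unless [i,j] ∈ E, in which case
-- it exchanges them.  If E is closed under intersections then every cell receives its two values
-- in strictly increasing order, and each k moves on its row only or on its column only, so that the
-- outer boundary of the network is a permutation of {1,…,m}.  Sorting the two values in each cell
-- runs the network backwards, which recovers E; conversely every permutation arises, by peeling off
-- the last column, whose segments sit at certain left-to-right maxima.  Symmetric E correspond to
-- permutations commuting with ι, i.e. to signed permutations.
--
-- With Λ k = a_k + … + a_n the point T has the entries Λ (R i (j-1)) - Λ (R i j), which also equal
-- Λ (C i j) - Λ (C (i+1) j).  All sums along rows and columns telescope, which gives the weight,
-- the defining equations of x(E) and the tight Dyck paths; the sortedness of the cells bounds all
-- other Dyck paths.

module Submission where

open import Defs
open import Data.Bool using (Bool; true; false; if_then_else_; not; _xor_) renaming (T to True)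
open import Data.Bool.Properties using (T-≡; not-distribˡ-xor)
open import Data.Nat
open import Data.Nat.Properties
open import Data.Integer as ℤ using (ℤ; +_)
import Data.Integer.Properties as ℤₚ
open import Data.Integer.Tactic.RingSolver using (solve-∀)
open import Data.Rational as ℚ using (ℚ; 0ℚ; 1ℚ)
import Data.Rational.Properties as ℚₚ
open import Data.Rational.Unnormalised as ℚᵘ using (mkℚᵘ; *≡*; *≤*)
import Data.Rational.Unnormalised.Properties as ℚᵘₚ
import Algebra.Properties.Group ℚₚ.+-0-group as ℚ+
open import Algebra.Bundles using (CommutativeMonoid)
open import Algebra.Properties.CommutativeSemigroup (CommutativeMonoid.commutativeSemigroup ℚₚ.+-0-commutativeMonoid) using (interchange)
open import Data.Fin using (Fin; toℕ; fromℕ<; punchOut)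
open import Data.Fin.Properties as Finₚ using (toℕ<n; toℕ-injective; fromℕ<-injective; injective⇒≤; toℕ-fromℕ<; punchOut-injective; any?; all?)
open import Data.Fin.Permutation as Perm using (Permutation′; permutation; _⟨$⟩ʳ_; _⟨$⟩ˡ_; inverseˡ; inverseʳ)
open import Data.List using (List; []; _∷_; map; _++_; concatMap; applyUpTo)
open import Data.List.Properties using (map-upTo; map-++; map-cong; map-∘)
open import Data.List.Relation.Unary.All using (All; []; _∷_)
open import Data.Product using (Σ; ∃-syntax; _×_; _,_; proj₁; proj₂)
open import Data.Sum using (_⊎_; inj₁; inj₂)
open import Data.Empty using (⊥-elim)
open import Data.Unit using (tt)
open import Function.Bundles using (Equivalence)
open import Relation.Nullary using (¬_; yes; no; contradiction)
open import Relation.Nullary.Decidable using (_×-dec_)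
open import Relation.Binary.Definitions using (tri<; tri≈; tri>)
open import Relation.Binary.PropositionalEquality using (_≡_; refl; sym; trans; cong; cong₂; subst; subst₂; _≢_; module ≡-Reasoning)

-- The network of a set of segments

-- Wires carry indices k instead of the numbers Λ k: Λ is only weakly decreasing, so with some a_k =
-- 0 an exchange can leave no trace in T, while the indices always determine E. Hence `Ξ` does not
-- involve the a_k. Sortedness is not local, since a cell receives values from far away. Closure
-- replaces two overlapping segments by their intersection, whose window is shorter, so that an
-- induction on length works. Conversely, when the last column is put back, closure with the older
-- segments must be ensured; the condition `cut` is carried along for that. In type C the triangle
-- stops at the antidiagonal i + j = m + 1. Reflection pairs the value on a row with its complement
-- under `ι`, and sortedness makes it the smaller one, hence at most n, before the antidiagonal;
-- after it column values exceed n, where Λ vanishes. So hooks may be cut there. T is a vertex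
-- because each (i,j) has entry 0 or is the corner of a tight hook, and these equations determine
-- the entries one after the other.

window-ind : (P : ℕ → ℕ → Set) → (∀ i → P i i) →
  (∀ i j → i ≤ j → P i j → P (suc i) (suc j) → P i (suc j)) →
  ∀ {i j} → i ≤ j → P i j
window-ind P base step {i} {j} i≤j = subst (P i) (m∸n+n≡m i≤j) (go (j ∸ i) i)
  where
  go : ∀ k i → P i (k + i)
  go zero i = base i
  -- The two neighbours feeding a cell, on its left and below it, both have windows shorter by one,
  -- so the length alone drives the induction.
  go (suc k) i = step i (k + i) (m≤n+m i k) (go k i) (subst (P (suc i)) (+-suc k i) (go k (suc i)))

if-true : ∀ {A : Set} {b : Bool} {x y : A} → b ≡ true → (if b then x else y) ≡ x
if-true refl = refl

if-false : ∀ {A : Set} {b : Bool} {x y : A} → b ≡ false → (if b then x else y) ≡ y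
if-false refl = refl

-- The last argument is the length j - i of the window, which makes the mutual recursion structural;
-- `R` and `C` translate back to the right end.
rowW colW : SegSet → ℕ → ℕ → ℕ
rowW E i zero = i
rowW E i (suc k) = if E i (suc (k + i)) then colW E (suc i) k else rowW E i k
colW E i zero = i
colW E i (suc k) = if E i (suc (k + i)) then rowW E i k else colW E (suc i) k

R C : SegSet → ℕ → ℕ → ℕ
R E i j = rowW E i (j ∸ i)
C E i j = colW E i (j ∸ i)

module _ (E : SegSet) where

  R-refl : ∀ i → R E i i ≡ i
  R-refl i rewrite n∸n≡0 i = refl

  C-refl : ∀ i → C E i i ≡ i
  C-refl i rewrite n∸n≡0 i = refl

  R-step : ∀ {i j} → i ≤ j → R E i (suc j) ≡ (if E i (suc j) then C E (suc i) (suc j) else R E i j)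
  R-step {i} {j} i≤j rewrite +-∸-assoc 1 i≤j | m∸n+n≡m i≤j = refl

  C-step : ∀ {i j} → i ≤ j → C E i (suc j) ≡ (if E i (suc j) then R E i j else C E (suc i) (suc j))
  C-step {i} {j} i≤j rewrite +-∸-assoc 1 i≤j | m∸n+n≡m i≤j = refl

  R-in : ∀ {i j} → i ≤ j → E i (suc j) ≡ true → R E i (suc j) ≡ C E (suc i) (suc j)
  R-in i≤j e = trans (R-step i≤j) (if-true e)

  R-out : ∀ {i j} → i ≤ j → E i (suc j) ≡ false → R E i (suc j) ≡ R E i j
  R-out i≤j e = trans (R-step i≤j) (if-false e)

  C-in : ∀ {i j} → i ≤ j → E i (suc j) ≡ true → C E i (suc j) ≡ R E i j
  C-in i≤j e = trans (C-step i≤j) (if-true e)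

  C-out : ∀ {i j} → i ≤ j → E i (suc j) ≡ false → C E i (suc j) ≡ C E (suc i) (suc j)
  C-out i≤j e = trans (C-step i≤j) (if-false e)

  Bounds : ℕ → ℕ → Set
  Bounds i j = (i ≤ R E i j × R E i j ≤ j) × (i ≤ C E i j × C E i j ≤ j)

  bounds : ∀ {i j} → i ≤ j → Bounds i j
  bounds = window-ind Bounds
    (λ i → (≤-reflexive (sym (R-refl i)) , ≤-reflexive (R-refl i)) , (≤-reflexive (sym (C-refl i)) , ≤-reflexive (C-refl i)))
    step
    where
    step : ∀ i j → i ≤ j → Bounds i j → Bounds (suc i) (suc j) → Bounds i (suc j)
    step i j i≤j ((a , b) , _) (_ , (c , d)) with E i (suc j) in e
    ... | true rewrite R-in i≤j e | C-in i≤j e = (≤-trans (n≤1+n i) c , d) , (a , ≤-trans b (n≤1+n j))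
    ... | false rewrite R-out i≤j e | C-out i≤j e = (a , ≤-trans b (n≤1+n j)) , (≤-trans (n≤1+n i) c , d)

  R-lower : ∀ {i j} → i ≤ j → i ≤ R E i j
  R-lower i≤j = proj₁ (proj₁ (bounds i≤j))

  R-upper : ∀ {i j} → i ≤ j → R E i j ≤ j
  R-upper i≤j = proj₂ (proj₁ (bounds i≤j))

  C-lower : ∀ {i j} → i ≤ j → i ≤ C E i j
  C-lower i≤j = proj₁ (proj₂ (bounds i≤j))

  C-upper : ∀ {i j} → i ≤ j → C E i j ≤ j
  C-upper i≤j = proj₂ (proj₂ (bounds i≤j))

  -- Only a segment beginning at i can change the row of i; dually, only a segment ending at j can
  -- change the column of j (`C-moved`).
  R-moved : ∀ d i → R E i (d + i) ≡ i ⊎ ∃[ j ] (i < j × j ≤ d + i × E i j ≡ true)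
  R-moved zero i = inj₁ (R-refl i)
  R-moved (suc d) i with E i (suc (d + i)) in e
  ... | true = inj₂ (_ , s≤s (m≤n+m i d) , ≤-refl , e)
  ... | false with R-moved d i
  ...   | inj₁ r = inj₁ (trans (R-out (m≤n+m i d) e) r)
  ...   | inj₂ (j , p , q , s) = inj₂ (j , p , ≤-trans q (n≤1+n _) , s)

  C-moved : ∀ d i → C E i (d + i) ≡ d + i ⊎ ∃[ k ] (i ≤ k × k < d + i × E k (d + i) ≡ true)
  C-moved zero i = inj₁ (C-refl i)
  C-moved (suc d) i with E i (suc (d + i)) in e
  ... | true = inj₂ (i , ≤-refl , s≤s (m≤n+m i d) , e)
  ... | false with C-moved d (suc i)
  ...   | inj₁ r = inj₁ (trans (C-out (m≤n+m i d) e) (subst (λ j → C E (suc i) j ≡ j) (+-suc d i) r))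
  ...   | inj₂ (k , p , q , s) =
          inj₂ (k , ≤-trans (n≤1+n i) p , subst (k <_) (+-suc d i) q , subst (λ j → E k j ≡ true) (+-suc d i) s)

-- `InRp` for pairs ordered by both ends; a nested pair meets in one of its members anyway. The case
-- k = j is included, so no segment of E begins where another one ends.
Crossing : ℕ → SegSet → Set
Crossing m E = ∀ {i j k l} → 1 ≤ i → i ≤ k → k ≤ j → j ≤ l → l ≤ m → i < j → k < l →
  E i j ≡ true → E k l ≡ true → k < j × E k j ≡ true

module Network (m : ℕ) (E : SegSet) (cross : Crossing m E) where

  -- If both failed, one segment of E would begin at k and another would end there, and they would
  -- meet in a single point.
  unmoved : ∀ {k} → 1 ≤ k → k ≤ m → R E k m ≡ k ⊎ C E 1 k ≡ k
  unmoved {k} 1≤k k≤m with R-moved E (m ∸ k) k | C-moved E (k ∸ 1) 1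
  ... | inj₁ r | _ = inj₁ (subst (λ j → R E k j ≡ k) (m∸n+n≡m k≤m) r)
  ... | inj₂ _ | inj₁ c = inj₂ (subst (λ j → C E 1 j ≡ j) (m∸n+n≡m 1≤k) c)
  ... | inj₂ (l , k<l , l≤ , e) | inj₂ (h , 1≤h , h< , f) =
    ⊥-elim (<-irrefl refl (proj₁ (cross {h} {k} {k} {l} 1≤h (<⇒≤ h<k) ≤-refl (<⇒≤ k<l) l≤m h<k k<l
      (subst (λ j → E h j ≡ true) (m∸n+n≡m 1≤k) f) e)))
    where
    l≤m = subst (l ≤_) (m∸n+n≡m k≤m) l≤
    h<k = subst (h <_) (m∸n+n≡m 1≤k) h<

  SortedUpTo : ℕ → Set
  SortedUpTo N = ∀ {i j} → 1 ≤ i → i ≤ j → suc j ≤ m → j < i + N → R E i j < C E (suc i) (suc j)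

  R-mono-step : ∀ {i j} → i ≤ j → R E i j < C E (suc i) (suc j) → R E i j ≤ R E i (suc j)
  R-mono-step {i} {j} i≤j lt with E i (suc j) in e
  ... | true = ≤-trans (<⇒≤ lt) (≤-reflexive (sym (R-in E i≤j e)))
  ... | false = ≤-reflexive (sym (R-out E i≤j e))

  C-mono-step : ∀ {i j} → i ≤ j → R E i j < C E (suc i) (suc j) → C E i (suc j) ≤ C E (suc i) (suc j)
  C-mono-step {i} {j} i≤j lt with E i (suc j) in e
  ... | true = ≤-trans (≤-reflexive (C-in E i≤j e)) (<⇒≤ lt)
  ... | false = ≤-reflexive (C-out E i≤j e)

  module Bounded (N : ℕ) (sorted : SortedUpTo N) where

    R-mono′ : ∀ d {i j} → 1 ≤ i → i ≤ j → d + j ≤ m → d + j ≤ i + N → R E i j ≤ R E i (d + j)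
    R-mono′ zero _ _ _ _ = ≤-refl
    R-mono′ (suc d) {i} {j} 1≤i i≤j b c =
      ≤-trans (R-mono′ d 1≤i i≤j (<⇒≤ b) (<⇒≤ c))
              (R-mono-step i≤d+j (sorted 1≤i i≤d+j b c))
      where i≤d+j = ≤-trans i≤j (m≤n+m j d)

    R-mono : ∀ {i j j′} → 1 ≤ i → i ≤ j → j ≤ j′ → j′ ≤ m → j′ ≤ i + N → R E i j ≤ R E i j′
    R-mono {i} {j} {j′} 1≤i i≤j j≤j′ b c =
      subst (λ t → R E i j ≤ R E i t) eq
        (R-mono′ (j′ ∸ j) 1≤i i≤j (subst (_≤ m) (sym eq) b) (subst (_≤ i + N) (sym eq) c))
      where eq = m∸n+n≡m j≤j′

    C-mono′ : ∀ d {i j} → 1 ≤ i → d + i ≤ j → j ≤ m → j ≤ i + N → C E i j ≤ C E (d + i) j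
    C-mono′ zero _ _ _ _ = ≤-refl
    C-mono′ (suc d) {i} {suc j} 1≤i (s≤s d+i≤j) b c =
      ≤-trans (C-mono-step i≤j (sorted 1≤i i≤j b c))
        (subst (λ t → C E (suc i) (suc j) ≤ C E t (suc j)) (+-suc d i)
          (C-mono′ d {suc i} (s≤s z≤n) (≤-trans (≤-reflexive (+-suc d i)) (s≤s d+i≤j)) b (≤-trans c (n≤1+n _))))
      where i≤j = ≤-trans (m≤n+m i d) d+i≤j

    C-mono : ∀ {i i′ j} → 1 ≤ i → i ≤ i′ → i′ ≤ j → j ≤ m → j ≤ i + N → C E i j ≤ C E i′ j
    C-mono {i} {i′} {j} 1≤i i≤i′ i′≤j b c =
      subst (λ t → C E i j ≤ C E t j) eq
        (C-mono′ (i′ ∸ i) 1≤i (subst (_≤ j) (sym eq) i′≤j) b c)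
      where eq = m∸n+n≡m i≤i′

    -- Cells outside E are skipped, by shortening row i on the one side and by raising k on the
    -- other, until both windows are segments of E. If they are disjoint, the bounds separate the
    -- values. Otherwise their intersection lies in E and the comparison passes through its cell,
    -- whose window begins after i and is therefore short enough for `sorted`.
    R<C′ : ∀ a b {i k} → 1 ≤ i → i < k → a + i < b + k → b + k ≤ m → b + k ≤ suc (i + N) →
      R E i (a + i) < C E k (b + k)
    R<C′ zero b {i} {k} 1≤i i<k _ _ _ =
      <-≤-trans (subst (_< k) (sym (R-refl E i)) i<k) (C-lower E (m≤n+m k b))
    R<C′ (suc a) zero {i} {k} 1≤i i<k lt _ _ =
      ≤-<-trans (R-upper E (m≤n+m i (suc a))) (subst (suc a + i <_) (sym (C-refl E k)) lt)
    R<C′ (suc a) (suc b) {i} {k} 1≤i i<k lt le len with E i (suc (a + i)) in e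
    ... | false = subst (_< C E k (suc b + k)) (sym (R-out E (m≤n+m i a) e))
                    (R<C′ a (suc b) 1≤i i<k (<⇒≤ lt) le len)
    ... | true with E k (suc (b + k)) in f
    ...   | false = subst (R E i (suc a + i) <_)
                      (trans (cong (C E (suc k)) (+-suc b k)) (sym (C-out E (m≤n+m k b) f)))
                      (R<C′ (suc a) b 1≤i (m≤n⇒m≤1+n i<k)
                        (subst (suc a + i <_) (sym (+-suc b k)) lt)
                        (subst (_≤ m) (sym (+-suc b k)) le) (subst (_≤ suc (i + N)) (sym (+-suc b k)) len))
    ...   | true with k ≤? suc (a + i)
    ...     | no k≰ = ≤-<-trans (R-upper E (m≤n+m i (suc a))) (<-≤-trans (≰⇒> k≰) (C-lower E (m≤n+m k (suc b))))
    ...     | yes k≤ with cross 1≤i (<⇒≤ i<k) k≤ (<⇒≤ lt) le (s≤s (m≤n+m i a)) (s≤s (m≤n+m k b)) e f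
    ...       | s≤s k≤a+i , g = begin-strict
        R E i (suc a + i)        ≡⟨ R-in E (m≤n+m i a) e ⟩
        C E (suc i) (suc a + i)  ≤⟨ C-mono (s≤s z≤n) i<k k≤ (≤-trans (<⇒≤ lt) le) (≤-trans (<⇒≤ lt) len) ⟩
        C E k (suc a + i)        ≡⟨ C-in E k≤a+i g ⟩
        R E k (a + i)            <⟨ sorted 1≤k k≤a+i (≤-trans (<⇒≤ lt) le) (≤-trans (s≤s⁻¹ lt) (<⇒≤ bk)) ⟩
        C E (suc k) (suc a + i)  ≡⟨ R-in E k≤a+i g ⟨
        R E k (suc a + i)        ≤⟨ R-mono 1≤k k≤ (s≤s⁻¹ lt) (<⇒≤ le) (<⇒≤ bk) ⟩
        R E k (b + k)            ≡⟨ C-in E (m≤n+m k b) f ⟨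
        C E k (suc b + k)        ∎
      where
      open ≤-Reasoning
      1≤k = ≤-trans 1≤i (<⇒≤ i<k)
      bk : suc (b + k) ≤ k + N
      bk = ≤-trans len (+-monoˡ-≤ N i<k)

    R<C : ∀ {i j k l} → 1 ≤ i → i ≤ j → i < k → j < l → k ≤ l → l ≤ m → l ≤ suc (i + N) → R E i j < C E k l
    R<C {i} {j} {k} {l} 1≤i i≤j i<k j<l k≤l l≤m len
      with R<C′ (j ∸ i) (l ∸ k) {i} {k}
    ... | h rewrite m∸n+n≡m i≤j | m∸n+n≡m k≤l = h 1≤i i<k j<l l≤m len

  -- Under sortedness up to N, `R<C` already covers windows longer by one; its instance at the two
  -- inputs of a cell is sortedness up to N + 1.
  sortedUpTo : ∀ N → SortedUpTo N
  sortedUpTo zero {i} _ i≤j _ lt = ⊥-elim (<⇒≱ lt (≤-trans (≤-reflexive (+-identityʳ i)) i≤j))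
  sortedUpTo (suc N) {i} {j} 1≤i i≤j le lt =
    Bounded.R<C N (sortedUpTo N) 1≤i i≤j ≤-refl ≤-refl (s≤s i≤j) le (subst (suc j ≤_) (+-suc i N) lt)

  private module Full = Bounded m (sortedUpTo m)

  R<C : ∀ {i j k l} → 1 ≤ i → i ≤ j → i < k → j < l → k ≤ l → l ≤ m → R E i j < C E k l
  R<C {i} 1≤i i≤j i<k j<l k≤l l≤m = Full.R<C 1≤i i≤j i<k j<l k≤l l≤m (≤-trans l≤m (≤-trans (m≤n+m m i) (n≤1+n _)))

  sorted : ∀ {i j} → 1 ≤ i → i ≤ j → suc j ≤ m → R E i j < C E (suc i) (suc j)
  sorted 1≤i i≤j le = R<C 1≤i i≤j ≤-refl ≤-refl (s≤s i≤j) le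

  R-mono : ∀ {i j j′} → 1 ≤ i → i ≤ j → j ≤ j′ → j′ ≤ m → R E i j ≤ R E i j′
  R-mono {i} 1≤i i≤j j≤j′ b = Full.R-mono 1≤i i≤j j≤j′ b (≤-trans b (m≤n+m m i))

  C-mono : ∀ {i i′ j} → 1 ≤ i → i ≤ i′ → i′ ≤ j → j ≤ m → C E i j ≤ C E i′ j
  C-mono {i} 1≤i i≤i′ i′≤j b = Full.C-mono 1≤i i≤i′ i′≤j b (≤-trans b (m≤n+m m i))

-- Locality, reflection and reversal of the network

Agree : ℕ → SegSet → SegSet → Set
Agree m E F = ∀ {i j} → 1 ≤ i → i < j → j ≤ m → E i j ≡ F i j

network-cong : ∀ {m E F} → Agree m E F → ∀ {i j} → i ≤ j → 1 ≤ i → j ≤ m →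
  R E i j ≡ R F i j × C E i j ≡ C F i j
network-cong {m} {E} {F} agree = window-ind P base step
  where
  P : ℕ → ℕ → Set
  P i j = 1 ≤ i → j ≤ m → R E i j ≡ R F i j × C E i j ≡ C F i j
  base : ∀ i → P i i
  base i _ _ = trans (R-refl E i) (sym (R-refl F i)) , trans (C-refl E i) (sym (C-refl F i))
  step : ∀ i j → i ≤ j → P i j → P (suc i) (suc j) → P i (suc j)
  step i j i≤j f g 1≤i j≤m
    rewrite R-step E i≤j | R-step F i≤j | C-step E i≤j | C-step F i≤j
          | agree {i} {suc j} 1≤i (s≤s i≤j) j≤m
          | proj₁ (f 1≤i (<⇒≤ j≤m)) | proj₂ (g (s≤s z≤n) j≤m) = refl , refl

ι : ℕ → ℕ → ℕ
ι m k = m + 1 ∸ k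

ι-suc : ∀ {m k} → k ≤ m → suc (ι m (suc k)) ≡ ι m k
ι-suc {m} {k} k≤m rewrite +-comm m 1 = sym (+-∸-assoc 1 k≤m)

ι-pos : ∀ {m k} → k ≤ m → 1 ≤ ι m k
ι-pos {m} {k} k≤m = subst (1 ≤_) (ι-suc k≤m) (s≤s z≤n)

ι-≤ : ∀ {m k} → 1 ≤ k → ι m k ≤ m
ι-≤ {m} {k} 1≤k = ≤-trans (∸-monoʳ-≤ (m + 1) 1≤k) (≤-reflexive (m+n∸n≡m m 1))

ι-invol : ∀ {m k} → k ≤ m → ι m (ι m k) ≡ k
ι-invol {m} k≤m = m∸[m∸n]≡n (≤-trans k≤m (m≤m+n m 1))

ι-anti : ∀ {m k l} → k ≤ l → ι m l ≤ ι m k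
ι-anti {m} = ∸-monoʳ-≤ (m + 1)

ι-anti< : ∀ {m k l} → k < l → l ≤ m → ι m l < ι m k
ι-anti< {m} {k} {l} k<l l≤m = ∸-monoʳ-< k<l (≤-trans l≤m (m≤m+n m 1))

ι-sum : ∀ {m k} → k ≤ m → k + ι m k ≡ m + 1
ι-sum {m} {k} k≤m = m+[n∸m]≡n (≤-trans k≤m (m≤m+n m 1))

-- A cell and its mirror image exchange together, and reflection in the antidiagonal turns the left
-- input of a cell into the lower input of its image.
network-reflect : ∀ {m E F} → (∀ {i j} → 1 ≤ i → i < j → j ≤ m → F i j ≡ E (ι m j) (ι m i)) →
  ∀ {i j} → i ≤ j → 1 ≤ i → j ≤ m →
  R F i j ≡ ι m (C E (ι m j) (ι m i)) × C F i j ≡ ι m (R E (ι m j) (ι m i))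
network-reflect {m} {E} {F} refl-eq = window-ind P base step
  where
  P : ℕ → ℕ → Set
  P i j = 1 ≤ i → j ≤ m → R F i j ≡ ι m (C E (ι m j) (ι m i)) × C F i j ≡ ι m (R E (ι m j) (ι m i))
  base : ∀ i → P i i
  base i _ i≤m rewrite R-refl F i | C-refl F i | R-refl E (ι m i) | C-refl E (ι m i) | ι-invol i≤m = refl , refl
  step : ∀ i j → i ≤ j → P i j → P (suc i) (suc j) → P i (suc j)
  step i j i≤j f g 1≤i j<m
    with refl-eq 1≤i (s≤s i≤j) j<m | f 1≤i (<⇒≤ j<m) | g (s≤s z≤n) j<m
  ... | e | f₁ , _ | _ , g₂
    rewrite sym (ι-suc {m} {i} (≤-trans i≤j (<⇒≤ j<m))) | sym (ι-suc {m} {j} (<⇒≤ j<m))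
          | R-step F i≤j | C-step F i≤j | f₁ | g₂ | e
          | R-step E (ι-anti {m} (s≤s i≤j)) | C-step E (ι-anti {m} (s≤s i≤j))
    with E (ι m (suc j)) (suc (ι m (suc i)))
  ... | true = refl , refl
  ... | false = refl , refl

-- The outputs of a cell show whether it exchanged: its inputs are increasing, so its row leaves
-- with the larger value exactly if it did. Working inwards from the outer boundary recovers every
-- cell.
network-injective : ∀ {m E F} → Crossing m E → Crossing m F →
  (∀ {k} → 1 ≤ k → k ≤ m → R E k m ≡ R F k m) →
  (∀ {k} → 1 ≤ k → k ≤ m → C E 1 k ≡ C F 1 k) → Agree m E F
network-injective {m} {E} {F} crossE crossF eqR eqC {suc i} {suc j} 1≤i (s≤s i<j) j<m =
  proj₁ (cell i<j j<m (proj₁ q) (proj₂ q))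
  where
  cell : ∀ {i j} → suc i ≤ j → suc j ≤ m → R E (suc i) (suc j) ≡ R F (suc i) (suc j) →
    C E (suc i) (suc j) ≡ C F (suc i) (suc j) →
    E (suc i) (suc j) ≡ F (suc i) (suc j) × R E (suc i) j ≡ R F (suc i) j ×
    C E (suc (suc i)) (suc j) ≡ C F (suc (suc i)) (suc j)
  cell {i} {j} i≤j j<m r c
    with Network.sorted m E crossE (s≤s z≤n) i≤j j<m | Network.sorted m F crossF (s≤s z≤n) i≤j j<m
  ... | se | sf rewrite R-step E i≤j | R-step F i≤j | C-step E i≤j | C-step F i≤j
    with E (suc i) (suc j) | F (suc i) (suc j)
  ... | true | true = refl , c , r
  ... | false | false = refl , r , c
  ... | true | false rewrite r | c = ⊥-elim (<-asym se sf)
  ... | false | true rewrite r | c = ⊥-elim (<-asym se sf)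

  -- a counts the columns and b the rows between the window and the outer boundary of the network.
  window : ∀ a b {j} → a + j ≡ m → suc b ≤ j →
    R E (suc b) j ≡ R F (suc b) j × C E (suc b) j ≡ C F (suc b) j
  windowR : ∀ a b {j} → a + j ≡ m → suc b ≤ j → R E (suc b) j ≡ R F (suc b) j
  windowC : ∀ a b {j} → a + j ≡ m → suc b ≤ j → C E (suc b) j ≡ C F (suc b) j
  window a b eq b<j = windowR a b eq b<j , windowC a b eq b<j
  windowR zero b refl b<j = eqR (s≤s z≤n) b<j
  windowR (suc a) b {j} eq b<j with window a b {suc j} (trans (+-suc a j) eq) (m≤n⇒m≤1+n b<j)
  ... | r , c = proj₁ (proj₂ (cell b<j (subst (suc j ≤_) eq (s≤s (m≤n+m j a))) r c))
  windowC a zero {j} eq b<j = eqC b<j (subst (j ≤_) eq (m≤n+m j a))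
  windowC a (suc b) {suc j} eq (s≤s b<j) with window a b {suc j} eq (m≤n⇒m≤1+n b<j)
  ... | r , c = proj₂ (proj₂ (cell b<j (subst (suc j ≤_) eq (m≤n+m (suc j) a)) r c))

  q = window (m ∸ suc j) i (m∸n+n≡m j<m) (m≤n⇒m≤1+n i<j)

-- One of the two summands equals k when E is closed under intersections, so the other one is the value.
wire : ℕ → SegSet → ℕ → ℕ
wire m E k = R E k m + C E 1 k ∸ k

wire-R : ∀ {m E k} → C E 1 k ≡ k → wire m E k ≡ R E k m
wire-R {m} {E} {k} c rewrite c = m+n∸n≡m (R E k m) k

wire-C : ∀ {m E k} → R E k m ≡ k → wire m E k ≡ C E 1 k
wire-C {m} {E} {k} r rewrite r = m+n∸m≡n k (C E 1 k)

module _ {m : ℕ} {E : SegSet} (cross : Crossing m E) where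
  open Network m E cross

  -- One of the two boundary values is k itself, and by the bounds the row value is never below k
  -- and the column value never above it. Together with `wire⊓` this makes the whole boundary a
  -- function of `wire`.
  wire⊔ : ∀ {k} → 1 ≤ k → k ≤ m → R E k m ≡ wire m E k ⊔ k
  wire⊔ {k} 1≤k k≤m with unmoved 1≤k k≤m
  ... | inj₁ r rewrite wire-C {m} {E} {k} r = trans r (sym (m≤n⇒m⊔n≡n (C-upper E 1≤k)))
  ... | inj₂ c rewrite wire-R {m} {E} {k} c = sym (m≥n⇒m⊔n≡m (R-lower E k≤m))

  wire⊓ : ∀ {k} → 1 ≤ k → k ≤ m → C E 1 k ≡ wire m E k ⊓ k
  wire⊓ {k} 1≤k k≤m with unmoved 1≤k k≤m
  ... | inj₁ r rewrite wire-C {m} {E} {k} r = sym (m≤n⇒m⊓n≡m (C-upper E 1≤k))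
  ... | inj₂ c rewrite wire-R {m} {E} {k} c = trans c (sym (m≥n⇒m⊓n≡n (R-lower E k≤m)))

  wire-pos : ∀ {k} → 1 ≤ k → k ≤ m → 1 ≤ wire m E k
  wire-pos {k} 1≤k k≤m with unmoved 1≤k k≤m
  ... | inj₁ r rewrite wire-C {m} {E} {k} r = C-lower E 1≤k
  ... | inj₂ c rewrite wire-R {m} {E} {k} c = ≤-trans 1≤k (R-lower E k≤m)

  wire-≤ : ∀ {k} → 1 ≤ k → k ≤ m → wire m E k ≤ m
  wire-≤ {k} 1≤k k≤m with unmoved 1≤k k≤m
  ... | inj₁ r rewrite wire-C {m} {E} {k} r = ≤-trans (C-upper E 1≤k) k≤m
  ... | inj₂ c rewrite wire-R {m} {E} {k} c = R-upper E k≤m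

  -- A segment ending at i would meet [i,j] in the point i alone. It follows that the wire of i is
  -- read off its row.
  left-end : ∀ {i j} → 1 ≤ i → i < j → j ≤ m → E i j ≡ true → C E 1 i ≡ i
  left-end {i} {j} 1≤i i<j j≤m e with C-moved E (i ∸ 1) 1
  ... | inj₁ c = subst (λ t → C E 1 t ≡ t) (m∸n+n≡m 1≤i) c
  ... | inj₂ (h , 1≤h , h< , f) = ⊥-elim (<-irrefl refl (proj₁
          (cross 1≤h (<⇒≤ h<i) ≤-refl (<⇒≤ i<j) j≤m h<i i<j (subst (λ t → E h t ≡ true) (m∸n+n≡m 1≤i) f) e)))
    where h<i = subst (h <_) (m∸n+n≡m 1≤i) h<

  -- Position of the value v once the cells (i,j+1),…,(j,j+1) of column j+1 have been passed.
  Located : ℕ → ℕ → ℕ → Set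
  Located j i v =
    (∃[ k ] (1 ≤ k × k < i × wire j E k ≡ v)) ⊎
    (∃[ k ] (i ≤ k × k ≤ j × wire (suc j) E k ≡ v)) ⊎
    (C E i (suc j) ≡ v)

  located-step : ∀ {j i v} → suc j ≤ m → 1 ≤ i → i ≤ j → Located j (suc i) v → Located j i v
  located-step {j} {i} {v} j<m 1≤i i≤j (inj₁ (k , 1≤k , s≤s k≤i , eq)) with k ≟ i
  ... | no k≢i = inj₁ (k , 1≤k , ≤∧≢⇒< k≤i k≢i , eq)
  ... | yes refl with E k (suc j) in e
  ...   | true = inj₂ (inj₂ (trans (C-in E i≤j e) (trans (sym (wire-R {j} {E} (left-end 1≤i (s≤s i≤j) j<m e))) eq)))
  ...   | false = inj₂ (inj₁ (k , ≤-refl , i≤j , trans (cong (λ t → t + C E 1 k ∸ k) (R-out E i≤j e)) eq))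
  located-step {j} {i} {v} j<m 1≤i i≤j (inj₂ (inj₁ (k , i<k , k≤j , eq))) = inj₂ (inj₁ (k , <⇒≤ i<k , k≤j , eq))
  located-step {j} {i} {v} j<m 1≤i i≤j (inj₂ (inj₂ eq)) with E i (suc j) in e
  ... | true = inj₂ (inj₁ (i , ≤-refl , i≤j ,
                 trans (wire-R {suc j} {E} (left-end 1≤i (s≤s i≤j) j<m e)) (trans (R-in E i≤j e) eq)))
  ... | false = inj₂ (inj₂ (trans (C-out E i≤j e) eq))

  located : ∀ {j v} → suc j ≤ m → ∀ i → suc i ≤ suc j → Located j (suc j) v → Located j (suc j ∸ i) v
  located j<m zero _ l = l
  located {j} {v} j<m (suc i) (s≤s i<j) l =
    located-step j<m (m<n⇒0<n∸m i<j) (m∸n≤m j i)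
      (subst (λ t → Located j t v) (+-∸-assoc 1 (<⇒≤ i<j)) (located j<m i (s≤s (<⇒≤ i<j)) l))

  -- Induction on the number of columns: a value already present is followed through the new column
  -- from the bottom up, where it may pass between the column and a row; the new value starts at the
  -- bottom of the column.
  wire-surjective : ∀ j → j ≤ m → ∀ {v} → 1 ≤ v → v ≤ j → ∃[ k ] (1 ≤ k × k ≤ j × wire j E k ≡ v)
  wire-surjective zero _ 1≤v v≤0 = ⊥-elim (<⇒≱ 1≤v v≤0)
  wire-surjective (suc j) j<m {v} 1≤v v≤j = finish (subst (λ t → Located j t v) (m+n∸n≡m 1 j) (located j<m j ≤-refl start))
    where
    start : Located j (suc j) v
    start with v ≟ suc j
    ... | yes refl = inj₂ (inj₂ (C-refl E v))
    ... | no v≢ with wire-surjective j (<⇒≤ j<m) 1≤v (s≤s⁻¹ (≤∧≢⇒< v≤j v≢))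
    ...   | k , 1≤k , k≤j , eq = inj₁ (k , 1≤k , s≤s k≤j , eq)
    finish : Located j 1 v → ∃[ k ] (1 ≤ k × k ≤ suc j × wire (suc j) E k ≡ v)
    finish (inj₁ (k , 1≤k , k<1 , _)) = ⊥-elim (<⇒≱ k<1 1≤k)
    finish (inj₂ (inj₁ (k , 1≤k , k≤j , eq))) = k , 1≤k , m≤n⇒m≤1+n k≤j , eq
    finish (inj₂ (inj₂ eq)) = suc j , s≤s z≤n , ≤-refl , trans (wire-C {suc j} {E} (R-refl E (suc j))) eq

-- Every permutation is the boundary of a network

≡ᵇ-refl : ∀ k → (k ≡ᵇ k) ≡ true
≡ᵇ-refl k = Equivalence.to T-≡ (≡⇒≡ᵇ k k refl)

≢⇒≡ᵇ : ∀ {k l} → k ≢ l → (k ≡ᵇ l) ≡ false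
≢⇒≡ᵇ {k} {l} k≢l with k ≡ᵇ l in e
... | false = refl
... | true = ⊥-elim (k≢l (≡ᵇ⇒≡ k l (subst True (sym e) tt)))

<ᵇ-true : ∀ {k l} → (k <ᵇ l) ≡ true → k < l
<ᵇ-true {k} {l} e = <ᵇ⇒< k l (subst True (sym e) tt)

<⇒<ᵇ-true : ∀ {k l} → k < l → (k <ᵇ l) ≡ true
<⇒<ᵇ-true k<l = Equivalence.to T-≡ (<⇒<ᵇ k<l)

<ᵇ-false : ∀ {k l} → (k <ᵇ l) ≡ false → l ≤ k
<ᵇ-false {k} {l} e = ≮⇒≥ λ k<l → contradiction (trans (sym (<⇒<ᵇ-true k<l)) e) λ ()

≥⇒<ᵇ-false : ∀ {k l} → l ≤ k → (k <ᵇ l) ≡ false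
≥⇒<ᵇ-false {k} {l} l≤k with k <ᵇ l in e
... | false = refl
... | true = ⊥-elim (<⇒≱ (<ᵇ-true e) l≤k)

pigeonhole-≤ : ∀ {N B} (f : ℕ → ℕ) → (∀ {k} → k < N → 1 ≤ f k × f k ≤ B) →
  (∀ {k l} → k < N → l < N → f k ≡ f l → k ≡ l) → N ≤ B
pigeonhole-≤ {N} {B} f range inj = injective⇒≤ {f = g} g-inj
  where
  bound : ∀ {k} → k < N → f k ∸ 1 < B
  bound {k} k<N with f k | range k<N
  ... | suc _ | _ , b = b
  g : Fin N → Fin B
  g x = fromℕ< (bound (toℕ<n x))
  g-inj : ∀ {x y} → g x ≡ g y → x ≡ y
  g-inj {x} {y} eq = toℕ-injective (inj (toℕ<n x) (toℕ<n y)
    (∸-cancelʳ-≡ (proj₁ (range (toℕ<n x))) (proj₁ (range (toℕ<n y))) (fromℕ<-injective _ _ (bound (toℕ<n x)) (bound (toℕ<n y)) eq)))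

record IsPerm (m : ℕ) (σ : ℕ → ℕ) : Set where
  field
    pos : ∀ {k} → 1 ≤ k → k ≤ m → 1 ≤ σ k
    le  : ∀ {k} → 1 ≤ k → k ≤ m → σ k ≤ m
    inj : ∀ {k l} → 1 ≤ k → k ≤ m → 1 ≤ l → l ≤ m → σ k ≡ σ l → k ≡ l

-- Read from the top, the last column starts with v = σ (m+1). Undoing a sorted cell sends its
-- larger output further down, so below row i the column carries max (v, σ 1, ..., σ i).
runMax : ℕ → (ℕ → ℕ) → ℕ → ℕ
runMax v σ zero = v
runMax v σ (suc i) = runMax v σ i ⊔ σ (suc i)

-- The smaller output goes back along row i. This is the permutation left on the boundary after the
-- last column has been removed.
bump : ℕ → (ℕ → ℕ) → ℕ → ℕ
bump v σ i = runMax v σ (i ∸ 1) ⊓ σ i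

-- A cell of the last column has exchanged exactly when its row leaves it with the larger value.
segments : ℕ → (ℕ → ℕ) → SegSet
segments zero σ i j = false
segments (suc m) σ i j =
  if j ≡ᵇ suc m then runMax (σ (suc m)) σ (i ∸ 1) <ᵇ σ i else segments m (bump (σ (suc m)) σ) i j

runMax-base : ∀ v σ i → v ≤ runMax v σ i
runMax-base v σ zero = ≤-refl
runMax-base v σ (suc i) = ≤-trans (runMax-base v σ i) (m≤m⊔n _ _)

runMax-≥ : ∀ v σ {k i} → 1 ≤ k → k ≤ i → σ k ≤ runMax v σ i
runMax-≥ v σ {k} {zero} 1≤k k≤i = ⊥-elim (<⇒≱ 1≤k k≤i)
runMax-≥ v σ {k} {suc i} 1≤k k≤i with k ≟ suc i
... | yes refl = m≤n⊔m (runMax v σ i) _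
... | no k≢ = ≤-trans (runMax-≥ v σ 1≤k (s≤s⁻¹ (≤∧≢⇒< k≤i k≢))) (m≤m⊔n _ _)

runMax-mono : ∀ v σ {k i} → k ≤ i → runMax v σ k ≤ runMax v σ i
runMax-mono v σ {k} {zero} z≤n = ≤-refl
runMax-mono v σ {k} {suc i} k≤i with k ≟ suc i
... | yes refl = ≤-refl
... | no k≢ = ≤-trans (runMax-mono v σ (s≤s⁻¹ (≤∧≢⇒< k≤i k≢))) (m≤m⊔n _ _)

runMax-attained : ∀ v σ i → runMax v σ i ≡ v ⊎ ∃[ k ] (1 ≤ k × k ≤ i × runMax v σ i ≡ σ k)
runMax-attained v σ zero = inj₁ refl
runMax-attained v σ (suc i) with ⊔-sel (runMax v σ i) (σ (suc i))
... | inj₂ eq = inj₂ (suc i , s≤s z≤n , ≤-refl , eq)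
... | inj₁ eq with runMax-attained v σ i
...   | inj₁ eq′ = inj₁ (trans eq eq′)
...   | inj₂ (k , a , b , eq′) = inj₂ (k , a , m≤n⇒m≤1+n b , trans eq eq′)

LeftToRightMax : (ℕ → ℕ) → ℕ → Set
LeftToRightMax σ i = ∀ {h} → 1 ≤ h → h < i → σ h < σ i

-- `rows` and `cols` prescribe the boundary in the form of `wire⊔` and `wire⊓`. `cut` strengthens
-- the induction: a segment of the next column begins at a left-to-right maximum i of the peeled
-- permutation, and its intersection with an older segment [k,l], k < i, is [i,l].
record Realises (m : ℕ) (σ : ℕ → ℕ) (E : SegSet) : Set where
  field
    crossing : Crossing m E
    rows  : ∀ {k} → 1 ≤ k → k ≤ m → R E k m ≡ σ k ⊔ k
    cols  : ∀ {k} → 1 ≤ k → k ≤ m → C E 1 k ≡ σ k ⊓ k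
    right : ∀ {k l} → 1 ≤ k → k < l → l ≤ m → E k l ≡ true → σ l < l
    cut   : ∀ {i k l} → LeftToRightMax σ i → 1 ≤ k → k < i → i ≤ l → l ≤ m → E k l ≡ true → i < l × E i l ≡ true

module ColumnStep (m : ℕ) (σ : ℕ → ℕ) (perm : IsPerm (suc m) σ) where
  open IsPerm perm

  v = σ (suc m)
  σ′ = bump v σ
  E = segments (suc m) σ
  E′ = segments m σ′

  distinct : ∀ {i} → i < m → runMax v σ i ≢ σ (suc i)
  distinct {i} i<m eq with runMax-attained v σ i
  ... | inj₁ eq′ = <-irrefl (sym (inj (s≤s z≤n) ≤-refl (s≤s z≤n) (m≤n⇒m≤1+n i<m) (trans (sym eq′) eq))) (s≤s i<m)
  ... | inj₂ (k , 1≤k , k≤i , eq′) =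
    <-irrefl (inj 1≤k (≤-trans k≤i (≤-trans (<⇒≤ i<m) (n≤1+n m))) (s≤s z≤n) (m≤n⇒m≤1+n i<m) (trans (sym eq′) eq)) (s≤s k≤i)

  -- The numbers v, σ 1, ..., σ i are i + 1 distinct positive integers, so their maximum is at least
  -- i + 1. `place` lists their positions m+1, 1, ..., i.
  runMax-large : ∀ {i} → i ≤ m → suc i ≤ runMax v σ i
  runMax-large {i} i≤m = pigeonhole-≤ f f-range f-inj
    where
    place : ℕ → ℕ
    place zero = suc m
    place (suc k) = suc k
    f : ℕ → ℕ
    f k = σ (place k)
    place-pos : ∀ k → 1 ≤ place k
    place-pos zero = s≤s z≤n
    place-pos (suc k) = s≤s z≤n
    place-≤ : ∀ {k} → k < suc i → place k ≤ suc m
    place-≤ {zero} _ = ≤-refl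
    place-≤ {suc k} (s≤s k<i) = ≤-trans k<i (m≤n⇒m≤1+n i≤m)
    f-range : ∀ {k} → k < suc i → 1 ≤ f k × f k ≤ runMax v σ i
    f-range {k} lt = pos (place-pos k) (place-≤ lt) , upper k lt
      where
      upper : ∀ k → k < suc i → f k ≤ runMax v σ i
      upper zero _ = runMax-base v σ i
      upper (suc k) (s≤s lt) = runMax-≥ v σ (s≤s z≤n) lt
    place-inj : ∀ k l → k < suc i → l < suc i → place k ≡ place l → k ≡ l
    place-inj zero zero _ _ _ = refl
    place-inj zero (suc l) _ (s≤s l<i) eq = ⊥-elim (<⇒≢ (s≤s (≤-trans l<i i≤m)) (sym eq))
    place-inj (suc k) zero (s≤s k<i) _ eq = ⊥-elim (<⇒≢ (s≤s (≤-trans k<i i≤m)) eq)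
    place-inj (suc k) (suc l) _ _ eq = eq
    f-inj : ∀ {k l} → k < suc i → l < suc i → f k ≡ f l → k ≡ l
    f-inj {k} {l} a b eq = place-inj k l a b (inj (place-pos k) (place-≤ a) (place-pos l) (place-≤ b) eq)

  runMax-≤ : ∀ {i} → i ≤ m → runMax v σ i ≤ suc m
  runMax-≤ {i} i≤m with runMax-attained v σ i
  ... | inj₁ eq = subst (_≤ suc m) (sym eq) (le (s≤s z≤n) ≤-refl)
  ... | inj₂ (k , 1≤k , k≤i , eq) = subst (_≤ suc m) (sym eq) (le 1≤k (≤-trans k≤i (m≤n⇒m≤1+n i≤m)))

  bump-< : ∀ {i} → i < m → σ′ (suc i) < runMax v σ (suc i)
  bump-< {i} i<m with <-cmp (runMax v σ i) (σ (suc i))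
  ... | tri< a _ _ = ≤-<-trans (m⊓n≤m _ _) (<-≤-trans a (m≤n⊔m (runMax v σ i) _))
  ... | tri≈ _ b _ = ⊥-elim (distinct i<m b)
  ... | tri> _ _ c = ≤-<-trans (m⊓n≤n (runMax v σ i) _) (<-≤-trans c (m≤m⊔n _ _))

  bump-before : ∀ {h i} → 1 ≤ h → h ≤ i → i < m → σ′ h < runMax v σ i
  bump-before {suc h} {i} _ h<i i<m = <-≤-trans (bump-< (≤-trans h<i (<⇒≤ i<m))) (runMax-mono v σ h<i)

  -- The bumped value at i is one of v, σ 1, ..., σ i, all taken by σ at positions other than k.
  bump-new : ∀ {i k} → 1 ≤ i → i < k → k ≤ m → σ′ i ≢ σ k
  bump-new {suc i} {k} _ i<k k≤m eq with ⊓-sel (runMax v σ i) (σ (suc i))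
  ... | inj₂ eq′ = <-irrefl (inj (s≤s z≤n) (≤-trans (<⇒≤ i<k) (m≤n⇒m≤1+n k≤m)) (≤-trans (s≤s z≤n) i<k) (m≤n⇒m≤1+n k≤m)
                    (trans (sym eq′) eq)) i<k
  ... | inj₁ eq′ with runMax-attained v σ i
  ...   | inj₁ eq″ = <-irrefl (inj (≤-trans (s≤s z≤n) i<k) (m≤n⇒m≤1+n k≤m) (s≤s z≤n) ≤-refl
                      (trans (sym eq) (trans eq′ eq″))) (s≤s k≤m)
  ...   | inj₂ (h , 1≤h , h≤i , eq″) =
          <-irrefl (inj 1≤h (≤-trans (<⇒≤ h<k) (m≤n⇒m≤1+n k≤m)) (≤-trans (s≤s z≤n) i<k) (m≤n⇒m≤1+n k≤m)
                      (trans (sym eq″) (trans (sym eq′) eq))) h<k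
    where h<k = <-trans (s≤s h≤i) i<k

  bump-apart : ∀ {i k} → 1 ≤ i → i < k → k ≤ m → σ′ i ≢ σ′ k
  bump-apart {i} {suc k} 1≤i i<k k≤m eq with ⊓-sel (runMax v σ k) (σ (suc k))
  ... | inj₁ eq′ = <-irrefl (trans eq eq′) (bump-before 1≤i (s≤s⁻¹ i<k) k≤m)
  ... | inj₂ eq′ = bump-new 1≤i i<k k≤m (trans eq eq′)

  perm′ : IsPerm m σ′
  perm′ = record { pos = pos′ ; le = le′ ; inj = inj′ }
    where
    pos′ : ∀ {k} → 1 ≤ k → k ≤ m → 1 ≤ σ′ k
    pos′ {suc k} 1≤k k≤m = ⊓-glb (≤-trans (s≤s z≤n) (runMax-large (<⇒≤ k≤m))) (pos 1≤k (m≤n⇒m≤1+n k≤m))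
    le′ : ∀ {k} → 1 ≤ k → k ≤ m → σ′ k ≤ m
    le′ {suc k} 1≤k k≤m = s≤s⁻¹ (<-≤-trans (bump-< k≤m) (runMax-≤ k≤m))
    inj′ : ∀ {k l} → 1 ≤ k → k ≤ m → 1 ≤ l → l ≤ m → σ′ k ≡ σ′ l → k ≡ l
    inj′ {k} {l} 1≤k k≤m 1≤l l≤m eq with <-cmp k l
    ... | tri< a _ _ = ⊥-elim (bump-apart 1≤k a l≤m eq)
    ... | tri≈ _ b _ = b
    ... | tri> _ _ c = ⊥-elim (bump-apart 1≤l c k≤m (sym eq))

  agree : Agree m E E′
  agree {i} {j} _ _ j≤m rewrite ≢⇒≡ᵇ {j} {suc m} (<⇒≢ (s≤s j≤m)) = refl

  column : ∀ i → E (suc i) (suc m) ≡ (runMax v σ i <ᵇ σ (suc i))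
  column i rewrite ≡ᵇ-refl m = refl

  column-true : ∀ {i} → E (suc i) (suc m) ≡ true → runMax v σ i < σ (suc i)
  column-true {i} e = <ᵇ-true (trans (sym (column i)) e)

  column-false : ∀ {i} → E (suc i) (suc m) ≡ false → σ (suc i) ≤ runMax v σ i
  column-false {i} e = <ᵇ-false (trans (sym (column i)) e)

  module _ (real : Realises m σ′ E′) where
    open Realises real renaming (crossing to crossing′; rows to rows′; cols to cols′; right to right′; cut to cut′)

    -- At a segment of the last column the bumped value equals the running maximum, which exceeds
    -- every earlier bumped value.
    column-ltrMax : ∀ {i} → i < m → E (suc i) (suc m) ≡ true → LeftToRightMax σ′ (suc i)
    column-ltrMax {i} i<m e 1≤h h<i =
      <-≤-trans (bump-before 1≤h (s≤s⁻¹ h<i) i<m) (≤-reflexive (sym (m≤n⇒m⊓n≡m (<⇒≤ (column-true e)))))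

    bump-ltrMax : ∀ {i} → i < m → LeftToRightMax σ (suc i) → LeftToRightMax σ′ (suc i)
    bump-ltrMax {i} i<m max {h} 1≤h h<i =
      ⊓-glb (bump-before 1≤h (s≤s⁻¹ h<i) i<m) (≤-<-trans (m⊓n≤n (runMax v σ (h ∸ 1)) (σ h)) (max 1≤h h<i))

    crossing″ : Crossing (suc m) E
    crossing″ {i} {j} {suc k} {l} 1≤i i≤k k≤j j≤l l≤m i<j k<l e f with l ≟ suc m
    ... | no l≢ = proj₁ r , trans (agree (s≤s z≤n) (proj₁ r) j≤m) (proj₂ r)
      where
      l≤m′ = s≤s⁻¹ (≤∧≢⇒< l≤m l≢)
      j≤m = ≤-trans j≤l l≤m′
      r = crossing′ 1≤i i≤k k≤j j≤l l≤m′ i<j k<l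
            (trans (sym (agree 1≤i i<j j≤m)) e) (trans (sym (agree (s≤s z≤n) k<l l≤m′)) f)
    ... | yes refl with j ≟ suc m
    ...   | yes refl = k<l , f
    ...   | no j≢ with i ≟ suc k
    ...     | yes refl = i<j , e
    ...     | no i≢ = proj₁ r , trans (agree (s≤s z≤n) (proj₁ r) j≤m) (proj₂ r)
      where
      j≤m = s≤s⁻¹ (≤∧≢⇒< j≤l j≢)
      -- The first segment is older, the second belongs to the last column; the left end of the
      -- second is a left-to-right maximum of the bumped permutation, so `cut` applies to the first.
      r = cut′ (column-ltrMax (≤-trans k≤j j≤m) f) 1≤i (≤∧≢⇒< i≤k i≢) k≤j j≤m (trans (sym (agree 1≤i i<j j≤m)) e)
    crossing″ {k = zero} 1≤i i≤0 _ _ _ _ _ _ _ = ⊥-elim (<⇒≱ 1≤i i≤0)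

    right″ : ∀ {k l} → 1 ≤ k → k < l → l ≤ suc m → E k l ≡ true → σ l < l
    right″ {suc k} {suc l} 1≤k k<l l≤m e with suc l ≟ suc m
    ... | yes refl = ≤-<-trans (runMax-base v σ k) (<-≤-trans (column-true e) (le 1≤k (<⇒≤ k<l)))
    ... | no l≢ with right′ 1≤k k<l l≤m′ (trans (sym (agree 1≤k k<l l≤m′)) e)
      where l≤m′ = s≤s⁻¹ (≤∧≢⇒< l≤m l≢)
    ...   | lt with E (suc l) (suc m) in f
    -- A segment of the last column beginning at the right end l would make the bumped value at l a
    -- running maximum, which is at least l.
    ...     | true = ⊥-elim (<⇒≱ (subst (_< suc l) (m≤n⇒m⊓n≡m (<⇒≤ (column-true f))) lt) (runMax-large (s≤s⁻¹ l≤m)))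
    ...     | false = subst (_< suc l) (m≥n⇒m⊓n≡n (column-false f)) lt

    cut″ : ∀ {i k l} → LeftToRightMax σ i → 1 ≤ k → k < i → i ≤ l → l ≤ suc m → E k l ≡ true → i < l × E i l ≡ true
    cut″ {suc i} {suc k} {l} max 1≤k k<i i≤l l≤m e with l ≟ suc m
    ... | no l≢ = proj₁ r , trans (agree (s≤s z≤n) (proj₁ r) l≤m′) (proj₂ r)
      where
      l≤m′ = s≤s⁻¹ (≤∧≢⇒< l≤m l≢)
      r = cut′ (bump-ltrMax (≤-trans i≤l l≤m′) max) 1≤k k<i i≤l l≤m′ (trans (sym (agree 1≤k (<-≤-trans k<i i≤l) l≤m′)) e)
    ... | yes refl with suc i ≟ suc m
    -- At the last position the value of σ is v, which lies below σ at the left end of the segment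
    -- and so cannot be a left-to-right maximum.
    ...   | yes refl = ⊥-elim (<-asym (max 1≤k k<i) (≤-<-trans (runMax-base v σ k) (column-true e)))
    ...   | no i≢ = ≤∧≢⇒< i≤l i≢ , trans (column i) (<⇒<ᵇ-true below)
      where
      -- The value of σ at the maximum exceeds all earlier ones by assumption, and v because v
      -- already lies below σ at the left end of the given segment.
      below : runMax v σ i < σ (suc i)
      below with runMax-attained v σ i
      ... | inj₁ eq = subst (_< σ (suc i)) (sym eq) (≤-<-trans (runMax-base v σ k) (<-trans (column-true e) (max 1≤k k<i)))
      ... | inj₂ (h , 1≤h , h≤i , eq) = subst (_< σ (suc i)) (sym eq) (max 1≤h (s≤s h≤i))

    R-restrict : ∀ {i j} → i ≤ j → 1 ≤ i → j ≤ m → R E i j ≡ R E′ i j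
    R-restrict i≤j 1≤i j≤m = proj₁ (network-cong agree i≤j 1≤i j≤m)

    C-restrict : ∀ {i j} → i ≤ j → 1 ≤ i → j ≤ m → C E i j ≡ C E′ i j
    C-restrict i≤j 1≤i j≤m = proj₂ (network-cong agree i≤j 1≤i j≤m)

    -- From the bottom up: at a segment the column receives the value of the peeled row, which is
    -- the running maximum; elsewhere the new value of σ does not raise the running maximum.
    C-column : ∀ d {i} → d + i ≡ m → C E (suc i) (suc m) ≡ runMax v σ i
    C-column zero refl = trans (C-refl E (suc m)) (≤-antisym (runMax-large ≤-refl) (runMax-≤ ≤-refl))
    C-column (suc d) {i} eq with E (suc i) (suc m) in e
    ... | true = trans (C-in E i<m e) (trans (R-restrict i<m (s≤s z≤n) ≤-refl) (trans (rows′ (s≤s z≤n) i<m)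
                   (trans (cong (_⊔ suc i) (m≤n⇒m⊓n≡m (<⇒≤ (column-true e)))) (m≥n⇒m⊔n≡m (runMax-large (<⇒≤ i<m))))))
      where i<m = subst (suc i ≤_) eq (s≤s (m≤n+m i d))
    ... | false = trans (C-out E i<m e) (trans (C-column d (trans (+-suc d i) eq)) (m≥n⇒m⊔n≡m (column-false e)))
      where i<m = subst (suc i ≤_) eq (s≤s (m≤n+m i d))

    rows″ : ∀ {k} → 1 ≤ k → k ≤ suc m → R E k (suc m) ≡ σ k ⊔ k
    rows″ {suc i} 1≤k k≤m with suc i ≟ suc m
    ... | yes refl = trans (R-refl E (suc m)) (sym (m≤n⇒m⊔n≡n (le 1≤k k≤m)))
    ... | no i≢ with E (suc i) (suc m) in e
    ...   | true = trans (R-in E i<m e) (trans (C-column (m ∸ suc i) (m∸n+n≡m i<m))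
                     (trans (m≤n⇒m⊔n≡n (<⇒≤ (column-true e)))
                       (sym (m≥n⇒m⊔n≡m (≤-trans (runMax-large (<⇒≤ i<m)) (<⇒≤ (column-true e)))))))
      where i<m = s≤s⁻¹ (≤∧≢⇒< k≤m i≢)
    ...   | false = trans (R-out E i<m e) (trans (R-restrict i<m (s≤s z≤n) ≤-refl) (trans (rows′ (s≤s z≤n) i<m)
                      (cong (_⊔ suc i) (m≥n⇒m⊓n≡n (column-false e)))))
      where i<m = s≤s⁻¹ (≤∧≢⇒< k≤m i≢)

    cols″ : ∀ {k} → 1 ≤ k → k ≤ suc m → C E 1 k ≡ σ k ⊓ k
    cols″ {suc i} 1≤k k≤m with suc i ≟ suc m
    ... | yes refl = trans (C-column m (+-identityʳ m)) (sym (m≤n⇒m⊓n≡m (le 1≤k k≤m)))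
    ... | no i≢ = trans (C-restrict 1≤k ≤-refl i<m) (trans (cols′ 1≤k i<m) same)
      where
      i<m = s≤s⁻¹ (≤∧≢⇒< k≤m i≢)
      same : σ′ (suc i) ⊓ suc i ≡ σ (suc i) ⊓ suc i
      same with E (suc i) (suc m) in e
      ... | true = trans (cong (_⊓ suc i) (m≤n⇒m⊓n≡m (<⇒≤ (column-true e)))) (trans (m≥n⇒m⊓n≡n (runMax-large (<⇒≤ i<m)))
                     (sym (m≥n⇒m⊓n≡n (≤-trans (runMax-large (<⇒≤ i<m)) (<⇒≤ (column-true e))))))
      ... | false = cong (_⊓ suc i) (m≥n⇒m⊓n≡n (column-false e))

    realises : Realises (suc m) σ E
    realises = record { crossing = crossing″ ; rows = rows″ ; cols = cols″ ; right = right″ ; cut = cut″ }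

segments-realises : ∀ m σ → IsPerm m σ → Realises m σ (segments m σ)
segments-realises zero σ perm = record
  { crossing = λ _ _ _ _ _ _ _ ()
  ; rows = λ 1≤k k≤0 → ⊥-elim (<⇒≱ 1≤k k≤0)
  ; cols = λ 1≤k k≤0 → ⊥-elim (<⇒≱ 1≤k k≤0)
  ; right = λ _ _ _ ()
  ; cut = λ _ _ _ _ _ () }
segments-realises (suc m) σ perm = realises (segments-realises m σ′ perm′)
  where open ColumnStep m σ perm

-- Signed permutations

injective⇒surjective : ∀ {n} (h : Fin n → Fin n) → (∀ {x y} → h x ≡ h y → x ≡ y) → ∀ y → ∃[ x ] h x ≡ y
injective⇒surjective {suc n} h inj y with any? (λ x → h x Finₚ.≟ y)
... | yes p = p
... | no ¬p = ⊥-elim (1+n≰n (injective⇒≤ {f = λ x → punchOut (y≢ x)} λ {x} {x′} eq → inj (punchOut-injective (y≢ x) (y≢ x′) eq)))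
  where
  y≢ : ∀ x → y ≢ h x
  y≢ x eq = ¬p (x , sym eq)

preimage : ∀ {n} → (Fin n → Fin n) → Fin n → Fin n
preimage g y with any? (λ x → g x Finₚ.≟ y)
... | yes (x , _) = x
... | no _ = y

preimage-spec : ∀ {n} (g : Fin n → Fin n) → (∀ y → ∃[ x ] g x ≡ y) → ∀ y → g (preimage g y) ≡ y
preimage-spec g surj y with any? (λ x → g x Finₚ.≟ y)
... | yes (_ , eq) = eq
... | no ¬p = ⊥-elim (¬p (surj y))

-- The permutation whose inverse is g; junk (the identity) if g is not bijective.
withInverse : ∀ {n} → (Fin n → Fin n) → Permutation′ n
withInverse g with all? (λ y → preimage g (g y) Finₚ.≟ y) ×-dec all? (λ y → g (preimage g y) Finₚ.≟ y)
... | yes (p , q) = permutation (preimage g) g p q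
... | no _ = Perm.id

-- A right inverse of g is injective, hence onto since `Fin n` is finite, and therefore also a left
-- inverse; so the test in `withInverse` succeeds.
withInverse-spec : ∀ {n} (g : Fin n → Fin n) → (∀ y → ∃[ x ] g x ≡ y) → ∀ x → withInverse g ⟨$⟩ˡ x ≡ g x
withInverse-spec {n} g surj x
  with all? (λ y → preimage g (g y) Finₚ.≟ y) ×-dec all? (λ y → g (preimage g y) Finₚ.≟ y)
... | yes _ = refl
... | no ¬p = ⊥-elim (¬p (left , preimage-spec g surj))
  where
  inj : ∀ {x y} → preimage g x ≡ preimage g y → x ≡ y
  inj eq = trans (sym (preimage-spec g surj _)) (trans (cong g eq) (preimage-spec g surj _))
  left : ∀ y → preimage g (g y) ≡ y
  left y with injective⇒surjective (preimage g) inj y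
  ... | z , refl = cong (preimage g) (preimage-spec g surj z)

-- `act` reads a signed permutation through the inverse of π, so comparisons are made there.
EqW-fromInverse : ∀ {n} (w w′ : W n) →
  (∀ f → proj₁ w ⟨$⟩ˡ f ≡ proj₁ w′ ⟨$⟩ˡ f) →
  (∀ f → proj₂ w (proj₁ w ⟨$⟩ˡ f) ≡ proj₂ w′ (proj₁ w′ ⟨$⟩ˡ f)) → EqW n w w′
EqW-fromInverse (π , s) (π′ , s′) eq sgn x = perm , sign
  where
  perm : π ⟨$⟩ʳ x ≡ π′ ⟨$⟩ʳ x
  perm = trans (sym (inverseʳ π′)) (cong (π′ ⟨$⟩ʳ_) (trans (sym (eq (π ⟨$⟩ʳ x))) (inverseˡ π)))
  sign : s x ≡ s′ x
  sign = trans (cong s (sym (inverseˡ π))) (trans (sgn (π ⟨$⟩ʳ x)) (cong s′ (trans (sym (eq (π ⟨$⟩ʳ x))) (inverseˡ π))))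

EqW-toInverse : ∀ {n} (w w′ : W n) → EqW n w w′ → ∀ f → proj₁ w ⟨$⟩ˡ f ≡ proj₁ w′ ⟨$⟩ˡ f
EqW-toInverse (π , _) (π′ , _) eq f =
  trans (sym (inverseˡ π′)) (cong (π′ ⟨$⟩ˡ_) (trans (sym (proj₁ (eq (π ⟨$⟩ˡ f)))) (inverseʳ π)))

-- Closure under intersections and under reflection

InRp⇒Crossing : ∀ {n E} → InRp n E → Crossing (2 * n) E
InRp⇒Crossing {n} {E} rp {i} {j} {k} {l} 1≤i i≤k k≤j j≤l l≤m i<j k<l e f
  with rp i j k l (1≤i , i<j , ≤-trans j≤l l≤m) (≤-trans 1≤i i≤k , k<l , l≤m) e f
... | h rewrite m≤n⇒m⊔n≡n i≤k | m≤n⇒m⊓n≡m j≤l = h k≤j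

Crossing⇒InRp : ∀ {n E} → Crossing (2 * n) E → InRp n E
Crossing⇒InRp {n} {E} cross i j k l (1≤i , i<j , j≤m) (1≤k , k<l , l≤m) e f meet
  with ≤-total i k | ≤-total j l
... | inj₁ i≤k | inj₁ j≤l rewrite m≤n⇒m⊔n≡n i≤k | m≤n⇒m⊓n≡m j≤l = cross 1≤i i≤k meet j≤l l≤m i<j k<l e f
... | inj₁ i≤k | inj₂ l≤j rewrite m≤n⇒m⊔n≡n i≤k | m≥n⇒m⊓n≡n l≤j = k<l , f
... | inj₂ k≤i | inj₁ j≤l rewrite m≥n⇒m⊔n≡m k≤i | m≤n⇒m⊓n≡m j≤l = i<j , e
... | inj₂ k≤i | inj₂ l≤j rewrite m≥n⇒m⊔n≡m k≤i | m≥n⇒m⊓n≡n l≤j = cross 1≤k k≤i meet l≤j j≤m k<l i<j f e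

reflect : ℕ → SegSet → SegSet
reflect m E i j = E (ι m j) (ι m i)

Crossing-reflect : ∀ {m E} → Crossing m E → Crossing m (reflect m E)
Crossing-reflect {m} {E} cross {i} {j} {k} {l} 1≤i i≤k k≤j j≤l l≤m i<j k<l e f =
  subst₂ _<_ (ι-invol (≤-trans k≤j j≤m)) (ι-invol j≤m) (ι-anti< (proj₁ r) (ι-≤ (≤-trans 1≤i i≤k))) , proj₂ r
  where
  j≤m = ≤-trans j≤l l≤m
  r = cross (ι-pos l≤m) (ι-anti {m} j≤l) (ι-anti {m} k≤j) (ι-anti {m} i≤k) (ι-≤ 1≤i)
        (ι-anti< k<l l≤m) (ι-anti< i<j j≤m) f e

-- The one-sided implication becomes an equality because reflection is an involution.
Symmetric⇒Agree : ∀ {n E} → Symmetric n E → Agree (2 * n) E (reflect (2 * n) E)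
Symmetric⇒Agree {n} {E} sym-E {i} {j} 1≤i i<j j≤m with E i j in e | E (ι (2 * n) j) (ι (2 * n) i) in f
... | true | true = refl
... | false | false = refl
... | false | true = trans (sym e) (sym-E i j (1≤i , i<j , j≤m) f)
... | true | false = trans (sym (sym-E _ _ (ι-pos j≤m , ι-anti< i<j j≤m , ι-≤ 1≤i)
        (subst₂ (λ a b → E a b ≡ true) (sym (ι-invol (≤-trans (<⇒≤ i<j) j≤m))) (sym (ι-invol j≤m)) e))) f

-- The numbers 1, ..., 2n as signed indices, and the map to the Weyl group

module Folding (n : ℕ) (f₀ : Fin n) where

  m : ℕ
  m = 2 * n

  n≤m : n ≤ m
  n≤m = m≤m+n n (n + 0)

  suc-n : n + suc n ≡ m + 1
  suc-n = trans (+-suc n n) (trans (cong suc (cong (λ t → n + t) (sym (+-identityʳ n)))) (+-comm 1 m))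

  ι-suc-n : ι m (suc n) ≡ n
  ι-suc-n = trans (cong (_∸ suc n) (sym suc-n)) (m+n∸n≡m n (suc n))

  ι-n : ι m n ≡ suc n
  ι-n = trans (cong (_∸ n) (sym suc-n)) (m+n∸m≡n n (suc n))

  ι-low : ∀ {v} → n < v → ι m v ≤ n
  ι-low n<v = ≤-trans (ι-anti {m} n<v) (≤-reflexive ι-suc-n)

  ι-high : ∀ {v} → v ≤ n → n < ι m v
  ι-high v≤n = ≤-trans (≤-reflexive (sym ι-n)) (ι-anti {m} v≤n)

  neg : ℕ → Bool
  neg v = n <ᵇ v

  -- `f₀` is a default value for arguments outside 1, ..., n.
  finOf : ℕ → Fin n
  finOf k with k ∸ 1 <? n
  ... | yes p = fromℕ< p
  ... | no _ = f₀

  finOf-spec : ∀ {k} → 1 ≤ k → k ≤ n → suc (toℕ (finOf k)) ≡ k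
  finOf-spec {suc k} _ k<n with k <? n
  ... | yes p = cong suc (toℕ-fromℕ< p)
  ... | no ¬p = ⊥-elim (¬p k<n)

  fold : ℕ → Fin n
  fold v = finOf (if neg v then ι m v else v)

  -- A number k ≤ n stands for ε_k and `ι m k` for -ε_k; `neg` and `fold` return the sign and the
  -- index.
  enc : Bool → Fin n → ℕ
  enc b f = if b then ι m (suc (toℕ f)) else suc (toℕ f)

  enc-pos : ∀ b f → 1 ≤ enc b f
  enc-pos false f = s≤s z≤n
  enc-pos true f = ι-pos (≤-trans (toℕ<n f) n≤m)

  enc-≤ : ∀ b f → enc b f ≤ m
  enc-≤ false f = ≤-trans (toℕ<n f) n≤m
  enc-≤ true f = ι-≤ (s≤s z≤n)

  neg-enc : ∀ b f → neg (enc b f) ≡ b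
  neg-enc false f = ≥⇒<ᵇ-false (toℕ<n f)
  neg-enc true f = <⇒<ᵇ-true (ι-high (toℕ<n f))

  finOf-suc : ∀ f → finOf (suc (toℕ f)) ≡ f
  finOf-suc f = toℕ-injective (suc-injective (finOf-spec (s≤s z≤n) (toℕ<n f)))

  fold-enc : ∀ b f → fold (enc b f) ≡ f
  fold-enc b f rewrite neg-enc b f with b
  ... | false = finOf-suc f
  ... | true = trans (cong finOf (ι-invol (≤-trans (toℕ<n f) n≤m))) (finOf-suc f)

  enc-fold : ∀ {v} → 1 ≤ v → v ≤ m → enc (neg v) (fold v) ≡ v
  enc-fold {v} 1≤v v≤m with n <ᵇ v in e
  ... | false = finOf-spec 1≤v (<ᵇ-false e)
  ... | true = trans (cong (ι m) (finOf-spec (ι-pos v≤m) (ι-low {v} (<ᵇ-true {n} {v} e)))) (ι-invol v≤m)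

  ι-enc : ∀ b f → ι m (enc b f) ≡ enc (not b) f
  ι-enc false f = refl
  ι-enc true f = ι-invol (≤-trans (toℕ<n f) n≤m)

  fold-ι : ∀ {v} → 1 ≤ v → v ≤ m → fold (ι m v) ≡ fold v
  fold-ι {v} 1≤v v≤m = trans (cong fold (trans (cong (ι m) (sym (enc-fold 1≤v v≤m))) (ι-enc (neg v) (fold v))))
    (fold-enc (not (neg v)) (fold v))

  neg-ι : ∀ {v} → 1 ≤ v → v ≤ m → neg (ι m v) ≡ not (neg v)
  neg-ι {v} 1≤v v≤m = trans (cong neg (trans (cong (ι m) (sym (enc-fold 1≤v v≤m))) (ι-enc (neg v) (fold v))))
    (neg-enc (not (neg v)) (fold v))

  fold-neg-injective : ∀ {v v′} → 1 ≤ v → v ≤ m → 1 ≤ v′ → v′ ≤ m → fold v ≡ fold v′ → neg v ≡ neg v′ → v ≡ v′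
  fold-neg-injective a b c d eq eq′ = trans (sym (enc-fold a b)) (trans (cong₂ enc eq′ eq) (enc-fold c d))

  foldedWire : SegSet → Fin n → Fin n
  foldedWire E f = fold (wire m E (suc (toℕ f)))

  -- `SegSet` imposes no closure, so `withInverse` has to supply a value even when the folded wire
  -- is not bijective. The folded wire is the inverse of the permutation because `act` evaluates a
  -- weight at `π ⟨$⟩ˡ f`; accordingly the sign at x is read at position π x.
  Ξ : SegSet → W n
  Ξ E = withInverse (foldedWire E) , λ x → neg (wire m E (suc (toℕ (withInverse (foldedWire E) ⟨$⟩ʳ x))))

  Fin-pos : ∀ (f : Fin n) → 1 ≤ suc (toℕ f)
  Fin-pos f = s≤s z≤n

  Fin-≤ : ∀ (f : Fin n) → suc (toℕ f) ≤ m
  Fin-≤ f = ≤-trans (toℕ<n f) n≤m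

  module Sym (E : SegSet) (symRp : SymRp n E) where

    cross : Crossing m E
    cross = InRp⇒Crossing {n} {E} (proj₁ symRp)

    agree : Agree m E (reflect m E)
    agree = Symmetric⇒Agree {n} {E} (proj₂ symRp)

    R-ι : ∀ {i j} → i ≤ j → 1 ≤ i → j ≤ m → R E i j ≡ ι m (C E (ι m j) (ι m i))
    R-ι i≤j 1≤i j≤m = proj₁ (network-reflect {m} {E} {E} agree i≤j 1≤i j≤m)

    C-ι : ∀ {i j} → i ≤ j → 1 ≤ i → j ≤ m → C E i j ≡ ι m (R E (ι m j) (ι m i))
    C-ι i≤j 1≤i j≤m = proj₂ (network-reflect {m} {E} {E} agree i≤j 1≤i j≤m)

    ι-m : ι m m ≡ 1
    ι-m = m+n∸m≡n m 1

    ι-1 : ι m 1 ≡ m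
    ι-1 = m+n∸n≡m m 1

    R-boundary : ∀ {k} → 1 ≤ k → k ≤ m → R E (ι m k) m ≡ ι m (C E 1 k)
    R-boundary {k} 1≤k k≤m = trans (R-ι (ι-≤ 1≤k) (ι-pos k≤m) ≤-refl)
      (cong (ι m) (cong₂ (C E) ι-m (ι-invol k≤m)))

    C-boundary : ∀ {k} → 1 ≤ k → k ≤ m → C E 1 (ι m k) ≡ ι m (R E k m)
    C-boundary {k} 1≤k k≤m = trans (C-ι (ι-pos k≤m) ≤-refl (ι-≤ 1≤k))
      (cong (ι m) (cong₂ (R E) (ι-invol k≤m) ι-1))

    -- Reflection exchanges the two sides: if k is unmoved on its row, then `ι m k` is unmoved on
    -- its column, and conversely.
    wire-ι : ∀ {k} → 1 ≤ k → k ≤ m → wire m E (ι m k) ≡ ι m (wire m E k)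
    wire-ι {k} 1≤k k≤m with Network.unmoved m E cross 1≤k k≤m
    ... | inj₁ r = trans (wire-R {m} {E} (trans (C-boundary 1≤k k≤m) (cong (ι m) r)))
                     (trans (R-boundary 1≤k k≤m) (cong (ι m) (sym (wire-C {m} {E} r))))
    ... | inj₂ c = trans (wire-C {m} {E} (trans (R-boundary 1≤k k≤m) (cong (ι m) c)))
                     (trans (C-boundary 1≤k k≤m) (cong (ι m) (sym (wire-R {m} {E} c))))

    foldedWire-enc : ∀ b f → foldedWire E f ≡ fold (wire m E (enc b f))
    foldedWire-enc false f = refl
    foldedWire-enc true f = sym (trans (cong fold (wire-ι (Fin-pos f) (Fin-≤ f)))
      (fold-ι (wire-pos cross (Fin-pos f) (Fin-≤ f)) (wire-≤ cross (Fin-pos f) (Fin-≤ f))))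

    -- The number encoding y is the value of some wire, possibly at a position beyond n; folding
    -- that position changes the value at most by a sign, since wires commute with `ι`.
    foldedWire-surjective : ∀ y → ∃[ x ] foldedWire E x ≡ y
    foldedWire-surjective y with wire-surjective cross m ≤-refl (enc-pos false y) (enc-≤ false y)
    ... | k , 1≤k , k≤m , eq = fold k , trans folded (trans (cong fold eq) (fold-enc false y))
      where
      folded : foldedWire E (fold k) ≡ fold (wire m E k)
      folded = trans (foldedWire-enc (neg k) (fold k)) (cong (λ t → fold (wire m E t)) (enc-fold 1≤k k≤m))

    Ξ-perm : ∀ f → proj₁ (Ξ E) ⟨$⟩ˡ f ≡ foldedWire E f
    Ξ-perm = withInverse-spec (foldedWire E) foldedWire-surjective

    Ξ-sign : ∀ f → proj₂ (Ξ E) (proj₁ (Ξ E) ⟨$⟩ˡ f) ≡ neg (wire m E (suc (toℕ f)))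
    Ξ-sign f = cong (λ t → neg (wire m E (suc (toℕ t)))) (inverseʳ (proj₁ (Ξ E)) {f})

  Ξ-cong : ∀ E E′ → SymRp n E → SymRp n E′ → SameSeg n E E′ → EqW n (Ξ E) (Ξ E′)
  Ξ-cong E E′ sE sE′ same = EqW-fromInverse (Ξ E) (Ξ E′)
    (λ f → trans (Sym.Ξ-perm E sE f) (trans (cong fold (wires f)) (sym (Sym.Ξ-perm E′ sE′ f))))
    (λ f → trans (Sym.Ξ-sign E sE f) (trans (cong neg (wires f)) (sym (Sym.Ξ-sign E′ sE′ f))))
    where
    agree : Agree m E E′
    agree 1≤i i<j j≤m = same _ _ (1≤i , i<j , j≤m)
    wires : ∀ f → wire m E (suc (toℕ f)) ≡ wire m E′ (suc (toℕ f))
    wires f = cong₂ (λ a b → a + b ∸ suc (toℕ f))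
      (proj₁ (network-cong agree (Fin-≤ f) (Fin-pos f) ≤-refl))
      (proj₂ (network-cong agree (Fin-pos f) ≤-refl (Fin-≤ f)))

  -- `Ξ` gives index and sign of the wires at 1, ..., n, and symmetry gives those beyond n; these
  -- fix the boundary and thereby E.
  Ξ-injective : ∀ E E′ → SymRp n E → SymRp n E′ → EqW n (Ξ E) (Ξ E′) → SameSeg n E E′
  Ξ-injective E E′ sE sE′ eq i j (1≤i , i<j , j≤m) =
    network-injective crossE crossE′
      (λ {k} 1≤k k≤m → trans (wire⊔ crossE 1≤k k≤m) (trans (cong (_⊔ k) (wires 1≤k k≤m)) (sym (wire⊔ crossE′ 1≤k k≤m))))
      (λ {k} 1≤k k≤m → trans (wire⊓ crossE 1≤k k≤m) (trans (cong (_⊓ k) (wires 1≤k k≤m)) (sym (wire⊓ crossE′ 1≤k k≤m))))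
      1≤i i<j j≤m
    where
    crossE = Sym.cross E sE
    crossE′ = Sym.cross E′ sE′
    wires-low : ∀ f → wire m E (suc (toℕ f)) ≡ wire m E′ (suc (toℕ f))
    wires-low f = fold-neg-injective
      (wire-pos crossE (Fin-pos f) (Fin-≤ f)) (wire-≤ crossE (Fin-pos f) (Fin-≤ f))
      (wire-pos crossE′ (Fin-pos f) (Fin-≤ f)) (wire-≤ crossE′ (Fin-pos f) (Fin-≤ f))
      (trans (sym (Sym.Ξ-perm E sE f)) (trans inv (Sym.Ξ-perm E′ sE′ f)))
      (trans (sym (Sym.Ξ-sign E sE f)) (trans (proj₂ (eq _)) (trans (cong (proj₂ (Ξ E′)) inv) (Sym.Ξ-sign E′ sE′ f))))
      where inv = EqW-toInverse (Ξ E) (Ξ E′) eq f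
    wires-enc : ∀ b f → wire m E (enc b f) ≡ wire m E′ (enc b f)
    wires-enc false f = wires-low f
    wires-enc true f = trans (Sym.wire-ι E sE (Fin-pos f) (Fin-≤ f))
      (trans (cong (ι m) (wires-low f)) (sym (Sym.wire-ι E′ sE′ (Fin-pos f) (Fin-≤ f))))
    wires : ∀ {k} → 1 ≤ k → k ≤ m → wire m E k ≡ wire m E′ k
    wires {k} 1≤k k≤m = subst (λ t → wire m E t ≡ wire m E′ t) (enc-fold 1≤k k≤m) (wires-enc (neg k) (fold k))

  module Onto (π : Permutation′ n) (s : Fin n → Bool) where

    image : ℕ → Fin n
    image k = π ⟨$⟩ˡ fold k

    -- The inverse of the Weyl group element, written as a permutation of 1, ..., 2n commuting with
    -- `ι`; the inverse, because wires encode inverses.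
    σ : ℕ → ℕ
    σ k = enc (neg k xor s (image k)) (image k)

    xor-cancelʳ : ∀ {a b} c → (a xor c) ≡ (b xor c) → a ≡ b
    xor-cancelʳ {false} {false} c _ = refl
    xor-cancelʳ {true} {true} c _ = refl
    xor-cancelʳ {false} {true} true ()
    xor-cancelʳ {false} {true} false ()
    xor-cancelʳ {true} {false} true ()
    xor-cancelʳ {true} {false} false ()

    perm : IsPerm m σ
    perm = record { pos = λ {k} _ _ → enc-pos (neg k xor s (image k)) (image k) ; le = λ {k} _ _ → enc-≤ (neg k xor s (image k)) (image k) ; inj = inj }
      where
      inj : ∀ {k l} → 1 ≤ k → k ≤ m → 1 ≤ l → l ≤ m → σ k ≡ σ l → k ≡ l
      inj {k} {l} a b c d eq = fold-neg-injective a b c d folds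
          (xor-cancelʳ (s (image k)) (trans negs (cong (λ t → neg l xor s t) (sym images))))
        where
        images : image k ≡ image l
        images = trans (sym (fold-enc (neg k xor s (image k)) (image k))) (trans (cong fold eq) (fold-enc (neg l xor s (image l)) (image l)))
        folds : fold k ≡ fold l
        folds = trans (sym (inverseʳ π)) (trans (cong (π ⟨$⟩ʳ_) images) (inverseʳ π))
        negs : (neg k xor s (image k)) ≡ (neg l xor s (image l))
        negs = trans (sym (neg-enc (neg k xor s (image k)) (image k))) (trans (cong neg eq) (neg-enc (neg l xor s (image l)) (image l)))

    σ-ι : ∀ {k} → 1 ≤ k → k ≤ m → σ (ι m k) ≡ ι m (σ k)
    σ-ι {k} 1≤k k≤m rewrite fold-ι 1≤k k≤m | neg-ι 1≤k k≤m
      = trans (cong (λ b → enc b (image k)) (sym (not-distribˡ-xor (neg k) (s (image k)))))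
          (sym (ι-enc (neg k xor s (image k)) (image k)))

    E : SegSet
    E = segments m σ

    open Realises (segments-realises m σ perm)

    -- Both sets have the same boundary, as σ commutes with `ι` and `ι` interchanges maxima and
    -- minima, and the boundary determines a closed set.
    reflected : Agree m E (reflect m E)
    reflected = network-injective crossing (Crossing-reflect crossing)
      (λ {k} 1≤k k≤m → trans (rows 1≤k k≤m) (sym (trans (proj₁ (network-reflect {m} {E} (λ _ _ _ → refl) k≤m 1≤k ≤-refl))
        (trans (cong (λ t → ι m (C E t (ι m k))) (m+n∸m≡n m 1)) (trans (cong (ι m) (cols (ι-pos k≤m) (ι-≤ 1≤k)))
          (trans (∸-distribˡ-⊓-⊔ (m + 1) (σ (ι m k)) (ι m k)) (cong₂ _⊔_ (ισι 1≤k k≤m) (ι-invol k≤m))))))))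
      (λ {k} 1≤k k≤m → trans (cols 1≤k k≤m) (sym (trans (proj₂ (network-reflect {m} {E} (λ _ _ _ → refl) 1≤k ≤-refl k≤m))
        (trans (cong (λ t → ι m (R E (ι m k) t)) (m+n∸n≡m m 1)) (trans (cong (ι m) (rows (ι-pos k≤m) (ι-≤ 1≤k)))
          (trans (∸-distribˡ-⊔-⊓ (m + 1) (σ (ι m k)) (ι m k)) (cong₂ _⊓_ (ισι 1≤k k≤m) (ι-invol k≤m))))))))
      where
      ισι : ∀ {k} → 1 ≤ k → k ≤ m → ι m (σ (ι m k)) ≡ σ k
      ισι {k} 1≤k k≤m = trans (cong (ι m) (σ-ι 1≤k k≤m)) (ι-invol (IsPerm.le perm 1≤k k≤m))

    symRp : SymRp n E
    symRp = Crossing⇒InRp {n} {E} crossing , λ i j (1≤i , i<j , j≤m) e → trans (reflected 1≤i i<j j≤m) e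

    wire≡σ : ∀ {k} → 1 ≤ k → k ≤ m → wire m E k ≡ σ k
    wire≡σ {k} 1≤k k≤m = trans (cong₂ (λ a b → a + b ∸ k) (rows 1≤k k≤m) (cols 1≤k k≤m)) (lemma (σ k) k)
      where
      lemma : ∀ a b → (a ⊔ b) + (a ⊓ b) ∸ b ≡ a
      lemma a b with ≤-total a b
      ... | inj₁ a≤b rewrite m≤n⇒m⊔n≡n a≤b | m≤n⇒m⊓n≡m a≤b = m+n∸m≡n b a
      ... | inj₂ b≤a rewrite m≥n⇒m⊔n≡m b≤a | m≥n⇒m⊓n≡n b≤a = m+n∸n≡m a b

    σ-low : ∀ f → σ (suc (toℕ f)) ≡ enc (s (π ⟨$⟩ˡ f)) (π ⟨$⟩ˡ f)
    σ-low f rewrite fold-enc false f | neg-enc false f = refl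

    Ξ≡ : EqW n (Ξ E) (π , s)
    Ξ≡ = EqW-fromInverse (Ξ E) (π , s)
      (λ f → trans (Sym.Ξ-perm E symRp f) (trans (cong fold (wires f)) (fold-enc (s (π ⟨$⟩ˡ f)) (π ⟨$⟩ˡ f))))
      (λ f → trans (Sym.Ξ-sign E symRp f) (trans (cong neg (wires f)) (neg-enc (s (π ⟨$⟩ˡ f)) (π ⟨$⟩ˡ f))))
      where
      wires : ∀ f → wire m E (suc (toℕ f)) ≡ enc (s (π ⟨$⟩ˡ f)) (π ⟨$⟩ˡ f)
      wires f = trans (wire≡σ (Fin-pos f) (Fin-≤ f)) (σ-low f)

  Ξ-surjective : ∀ w → Σ SegSet λ E → SymRp n E × EqW n (Ξ E) w
  Ξ-surjective (π , s) = Onto.E π s , Onto.symRp π s , Onto.Ξ≡ π s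

-- Sums, hooks and convex combinations

+-interchange : ∀ w x y z → (w ℤ.+ x) ℤ.+ (y ℤ.+ z) ≡ (w ℤ.+ y) ℤ.+ (x ℤ.+ z)
+-interchange = solve-∀

sub-trans : ∀ x y z → (x ℤ.- y) ℤ.+ (y ℤ.- z) ≡ x ℤ.- z
sub-trans = solve-∀

neg-sub-neg : ∀ x y → ℤ.- x ℤ.- ℤ.- y ≡ y ℤ.- x
neg-sub-neg = solve-∀

add-sub : ∀ x y → x ℤ.+ y ℤ.- y ≡ x
add-sub = solve-∀

two-* : ∀ x → + 2 ℤ.* x ≡ x ℤ.+ x
two-* = solve-∀

sub-sub : ∀ x y z → x ℤ.- (y ℤ.- z) ≡ x ℤ.+ (ℤ.- y ℤ.+ z)
sub-sub = solve-∀

sub-add : ∀ x y → x ℤ.- y ℤ.+ y ≡ x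
sub-add = solve-∀

*-distrib-root : ∀ x u v w → x ℤ.* (u ℤ.+ (ℤ.- v ℤ.+ w)) ≡ x ℤ.* u ℤ.+ (ℤ.- (x ℤ.* v) ℤ.+ x ℤ.* w)
*-distrib-root = solve-∀

weight-regroup : ∀ l x c y → l ℤ.- ((l ℤ.- x) ℤ.+ (ℤ.- (c ℤ.- l) ℤ.+ y)) ≡ (x ℤ.- y) ℤ.+ (c ℤ.- l)
weight-regroup = solve-∀

add-sub-cancel : ∀ x y → x ℤ.+ (y ℤ.- x) ≡ y
add-sub-cancel = solve-∀

rng : ℕ → ℕ → List ℕ
rng a zero = []
rng a (suc k) = a ∷ rng (suc a) k

range≡rng : ∀ a b → range a b ≡ rng a (suc b ∸ a)
range≡rng a b = trans (map-upTo (λ i → a + i) (suc b ∸ a)) (go (suc b ∸ a) (λ i → a + i) a (λ _ → refl))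
  where
  go : ∀ k (f : ℕ → ℕ) a → (∀ i → f i ≡ a + i) → applyUpTo f k ≡ rng a k
  go zero f a eq = refl
  go (suc k) f a eq = cong₂ _∷_ (trans (eq 0) (+-identityʳ a))
    (go k (λ i → f (suc i)) (suc a) (λ i → trans (eq (suc i)) (+-suc a i)))

range-cons : ∀ {a b} → a ≤ b → range a b ≡ a ∷ range (suc a) b
range-cons {a} {b} a≤b = trans (range≡rng a b) (trans (cong (rng a) (+-∸-assoc 1 a≤b)) (cong (a ∷_) (sym (range≡rng (suc a) b))))

range-empty : ∀ {a b} → b < a → range a b ≡ []
range-empty {a} {b} b<a = trans (range≡rng a b) (cong (rng a) (m≤n⇒m∸n≡0 b<a))

Σℤ : ℕ → ℕ → (ℕ → ℤ) → ℤ
Σℤ a k f = sumℤ (map f (rng a k))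

Σ-cong : ∀ {f g} a k → (∀ {i} → a ≤ i → i < a + k → f i ≡ g i) → Σℤ a k f ≡ Σℤ a k g
Σ-cong a zero eq = refl
Σ-cong a (suc k) eq = cong₂ ℤ._+_ (eq ≤-refl (subst (a <_) (sym (+-suc a k)) (s≤s (m≤m+n a k))))
  (Σ-cong (suc a) k (λ {i} a<i lt → eq (<⇒≤ a<i) (subst (i <_) (sym (+-suc a k)) lt)))

Σ-+ : ∀ a k f g → Σℤ a k (λ i → f i ℤ.+ g i) ≡ Σℤ a k f ℤ.+ Σℤ a k g
Σ-+ a zero f g = refl
Σ-+ a (suc k) f g rewrite Σ-+ (suc a) k f g = +-interchange (f a) (g a) (Σℤ (suc a) k f) (Σℤ (suc a) k g)

Σ-neg : ∀ a k f → Σℤ a k (λ i → ℤ.- f i) ≡ ℤ.- Σℤ a k f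
Σ-neg a zero f = refl
Σ-neg a (suc k) f rewrite Σ-neg (suc a) k f = sym (ℤₚ.neg-distrib-+ (f a) (Σℤ (suc a) k f))

Σ-*ʳ : ∀ a k f c → Σℤ a k (λ i → f i ℤ.* c) ≡ Σℤ a k f ℤ.* c
Σ-*ʳ a zero f c = refl
Σ-*ʳ a (suc k) f c rewrite Σ-*ʳ (suc a) k f c = sym (ℤₚ.*-distribʳ-+ c (f a) (Σℤ (suc a) k f))

Σ-zero : ∀ {f} a k → (∀ {i} → a ≤ i → i < a + k → f i ≡ + 0) → Σℤ a k f ≡ + 0
Σ-zero a zero eq = refl
Σ-zero a (suc k) eq rewrite eq {a} ≤-refl (subst (a <_) (sym (+-suc a k)) (s≤s (m≤m+n a k)))
  = trans (ℤₚ.+-identityˡ _) (Σ-zero (suc a) k (λ {i} a<i lt → eq (<⇒≤ a<i) (subst (i <_) (sym (+-suc a k)) lt)))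

Σ-split : ∀ a k l f → Σℤ a (k + l) f ≡ Σℤ a k f ℤ.+ Σℤ (k + a) l f
Σ-split a zero l f = sym (ℤₚ.+-identityˡ _)
Σ-split a (suc k) l f rewrite Σ-split (suc a) k l f | +-suc k a = sym (ℤₚ.+-assoc (f a) _ _)

Σ-truncate : ∀ {f g} a {k l} → k ≤ l → (∀ {i} → a ≤ i → i < a + k → f i ≡ g i) →
  (∀ {i} → a + k ≤ i → i < a + l → f i ≡ + 0) → Σℤ a l f ≡ Σℤ a k g
Σ-truncate {f} {g} a {k} {l} k≤l eq vanish = begin
  Σℤ a l f                                 ≡⟨ cong (λ t → Σℤ a t f) (sym (m+[n∸m]≡n k≤l)) ⟩
  Σℤ a (k + (l ∸ k)) f                     ≡⟨ Σ-split a k (l ∸ k) f ⟩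
  Σℤ a k f ℤ.+ Σℤ (k + a) (l ∸ k) f        ≡⟨ cong₂ ℤ._+_ (Σ-cong a k eq) (Σ-zero (k + a) (l ∸ k) tail) ⟩
  Σℤ a k g ℤ.+ + 0                         ≡⟨ ℤₚ.+-identityʳ _ ⟩
  Σℤ a k g                                 ∎
  where
  open ≡-Reasoning
  tail : ∀ {i} → k + a ≤ i → i < k + a + (l ∸ k) → f i ≡ + 0
  tail {i} p q = vanish (subst (_≤ i) (+-comm k a) p)
    (subst (i <_) (trans (cong (_+ (l ∸ k)) (+-comm k a)) (trans (+-assoc a k (l ∸ k)) (cong (λ t → a + t) (m+[n∸m]≡n k≤l)))) q)

Σ-telescope : ∀ {f} (g : ℕ → ℤ) a k → (∀ {i} → a ≤ i → i < a + k → f i ≡ g i ℤ.- g (suc i)) →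
  Σℤ a k f ≡ g a ℤ.- g (a + k)
Σ-telescope g a zero eq rewrite +-identityʳ a = sym (ℤₚ.+-inverseʳ (g a))
Σ-telescope {f} g a (suc k) eq = begin
  f a ℤ.+ Σℤ (suc a) k f
    ≡⟨ cong₂ ℤ._+_ (eq ≤-refl (subst (a <_) (sym (+-suc a k)) (s≤s (m≤m+n a k))))
         (Σ-telescope g (suc a) k (λ {i} a<i lt → eq (<⇒≤ a<i) (subst (i <_) (sym (+-suc a k)) lt))) ⟩
  (g a ℤ.- g (suc a)) ℤ.+ (g (suc a) ℤ.- g (suc a + k)) ≡⟨ sub-trans (g a) (g (suc a)) (g (suc a + k)) ⟩
  g a ℤ.- g (suc a + k) ≡⟨ cong (λ t → g a ℤ.- g t) (sym (+-suc a k)) ⟩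
  g a ℤ.- g (a + suc k) ∎
  where
  open ≡-Reasoning

ind-refl : ∀ r → ind r r ≡ + 1
ind-refl r = if-true (≡ᵇ-refl r)

ind-≢ : ∀ {r k} → r ≢ k → ind r k ≡ + 0
ind-≢ r≢k = if-false (≢⇒≡ᵇ r≢k)

Σ-ind-out : ∀ a k (f : ℕ → ℤ) {r} → (r < a) ⊎ (a + k ≤ r) → Σℤ a k (λ i → f i ℤ.* ind r i) ≡ + 0
Σ-ind-out a k f {r} out = Σ-zero a k (λ {i} a≤i i< → trans (cong (f i ℤ.*_) (ind-≢ (r≢ a≤i i< out))) (ℤₚ.*-zeroʳ (f i)))
  where
  r≢ : ∀ {i} → a ≤ i → i < a + k → (r < a) ⊎ (a + k ≤ r) → r ≢ i
  r≢ a≤i i< (inj₁ r<a) refl = <⇒≱ r<a a≤i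
  r≢ a≤i i< (inj₂ le) refl = <⇒≱ i< le

Σ-ind-in : ∀ a k (f : ℕ → ℤ) {r} → a ≤ r → r < a + k → Σℤ a k (λ i → f i ℤ.* ind r i) ≡ f r
Σ-ind-in a zero f {r} a≤r r< = ⊥-elim (<⇒≱ r< (≤-trans (≤-reflexive (+-identityʳ a)) a≤r))
Σ-ind-in a (suc k) f {r} a≤r r< with a ≟ r
... | yes refl = trans (cong₂ ℤ._+_ (trans (cong (f a ℤ.*_) (ind-refl a)) (ℤₚ.*-identityʳ (f a)))
                   (Σ-ind-out (suc a) k f (inj₁ ≤-refl))) (ℤₚ.+-identityʳ (f a))
... | no a≢r = trans (cong₂ ℤ._+_ (trans (cong (f a ℤ.*_) (ind-≢ (λ eq → a≢r (sym eq)))) (ℤₚ.*-zeroʳ (f a)))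
                   (Σ-ind-in (suc a) k f (≤∧≢⇒< a≤r a≢r) (subst (r <_) (+-suc a k) r<))) (ℤₚ.+-identityˡ (f r))

sumℤ-++ : ∀ xs ys → sumℤ (xs ++ ys) ≡ sumℤ xs ℤ.+ sumℤ ys
sumℤ-++ [] ys = sym (ℤₚ.+-identityˡ _)
sumℤ-++ (x ∷ xs) ys rewrite sumℤ-++ xs ys = sym (ℤₚ.+-assoc x _ _)

sum-concatMap : ∀ (F : ℕ × ℕ → ℤ) (g : ℕ → List (ℕ × ℕ)) xs →
  sumℤ (map F (concatMap g xs)) ≡ sumℤ (map (λ i → sumℤ (map F (g i))) xs)
sum-concatMap F g [] = refl
sum-concatMap F g (x ∷ xs) = begin
  sumℤ (map F (g x ++ concatMap g xs))                  ≡⟨ cong sumℤ (map-++ F (g x) _) ⟩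
  sumℤ (map F (g x) ++ map F (concatMap g xs))          ≡⟨ sumℤ-++ (map F (g x)) _ ⟩
  sumℤ (map F (g x)) ℤ.+ sumℤ (map F (concatMap g xs))  ≡⟨ cong (λ t → sumℤ (map F (g x)) ℤ.+ t) (sum-concatMap F g xs) ⟩
  sumℤ (map F (g x)) ℤ.+ sumℤ (map (λ i → sumℤ (map F (g i))) xs) ∎
  where
  open ≡-Reasoning

sum-coordsC : ∀ n (F : ℕ × ℕ → ℤ) →
  sumℤ (map F (coordsC n)) ≡ Σℤ 1 n (λ i → Σℤ (suc i) (2 * n + 1 ∸ i ∸ i) (λ j → F (i , j)))
sum-coordsC n F = begin
  sumℤ (map F (coordsC n)) ≡⟨ sum-concatMap F _ (range 1 n) ⟩
  sumℤ (map (λ i → sumℤ (map F (map (λ j → (i , j)) (range (suc i) (2 * n + 1 ∸ i))))) (range 1 n))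
    ≡⟨ cong sumℤ (map-cong (λ i → cong sumℤ (trans (sym (map-∘ _)) (cong (map (λ j → F (i , j))) (range≡rng (suc i) _)))) (range 1 n)) ⟩
  sumℤ (map (λ i → Σℤ (suc i) (2 * n + 1 ∸ i ∸ i) (λ j → F (i , j))) (range 1 n))
    ≡⟨ cong (λ l → sumℤ (map (λ i → Σℤ (suc i) (2 * n + 1 ∸ i ∸ i) (λ j → F (i , j))) l)) (range≡rng 1 n) ⟩
  Σℤ 1 n (λ i → Σℤ (suc i) (2 * n + 1 ∸ i ∸ i) (λ j → F (i , j))) ∎
  where
  open ≡-Reasoning

-- Integer path sums inside the rationals, and convex combinations

ℤtoℚ-+ : ∀ x y → ℤtoℚ (x ℤ.+ y) ≡ ℤtoℚ x ℚ.+ ℤtoℚ y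
ℤtoℚ-+ x y = ℚₚ.toℚᵘ-injective (begin-equality
  ℚ.toℚᵘ (ℤtoℚ (x ℤ.+ y))                   ≃⟨ ℚₚ.toℚᵘ-fromℚᵘ (mkℚᵘ (x ℤ.+ y) 0) ⟩
  mkℚᵘ (x ℤ.+ y) 0                          ≃⟨ *≡* (cong (ℤ._* + 1) (cong₂ ℤ._+_ (sym (ℤₚ.*-identityʳ x)) (sym (ℤₚ.*-identityʳ y)))) ⟩
  mkℚᵘ x 0 ℚᵘ.+ mkℚᵘ y 0                    ≃⟨ ℚᵘₚ.+-cong (ℚᵘₚ.≃-sym (ℚₚ.toℚᵘ-fromℚᵘ (mkℚᵘ x 0))) (ℚᵘₚ.≃-sym (ℚₚ.toℚᵘ-fromℚᵘ (mkℚᵘ y 0))) ⟩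
  ℚ.toℚᵘ (ℤtoℚ x) ℚᵘ.+ ℚ.toℚᵘ (ℤtoℚ y)      ≃⟨ ℚᵘₚ.≃-sym (ℚₚ.toℚᵘ-homo-+ (ℤtoℚ x) (ℤtoℚ y)) ⟩
  ℚ.toℚᵘ (ℤtoℚ x ℚ.+ ℤtoℚ y)                ∎)
  where open ℚᵘₚ.≤-Reasoning

ℤtoℚ-mono : ∀ {x y} → x ℤ.≤ y → ℤtoℚ x ℚ.≤ ℤtoℚ y
ℤtoℚ-mono {x} {y} x≤y = ℚₚ.toℚᵘ-cancel-≤ (begin
  ℚ.toℚᵘ (ℤtoℚ x)  ≃⟨ ℚₚ.toℚᵘ-fromℚᵘ (mkℚᵘ x 0) ⟩
  mkℚᵘ x 0         ≤⟨ *≤* (ℤₚ.*-monoʳ-≤-nonNeg (+ 1) x≤y) ⟩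
  mkℚᵘ y 0         ≃⟨ ℚᵘₚ.≃-sym (ℚₚ.toℚᵘ-fromℚᵘ (mkℚᵘ y 0)) ⟩
  ℚ.toℚᵘ (ℤtoℚ y)  ∎)
  where open ℚᵘₚ.≤-Reasoning

ℤtoℚ-double : ∀ x → ℤtoℚ (+ 2) ℚ.* ℤtoℚ x ≡ ℤtoℚ (x ℤ.+ x)
ℤtoℚ-double x = begin
  ℤtoℚ (+ 2) ℚ.* ℤtoℚ x                 ≡⟨⟩
  (1ℚ ℚ.+ 1ℚ) ℚ.* ℤtoℚ x                ≡⟨ ℚₚ.*-distribʳ-+ (ℤtoℚ x) 1ℚ 1ℚ ⟩
  1ℚ ℚ.* ℤtoℚ x ℚ.+ 1ℚ ℚ.* ℤtoℚ x       ≡⟨ cong₂ ℚ._+_ (ℚₚ.*-identityˡ (ℤtoℚ x)) (ℚₚ.*-identityˡ (ℤtoℚ x)) ⟩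
  ℤtoℚ x ℚ.+ ℤtoℚ x                     ≡⟨ sym (ℤtoℚ-+ x x) ⟩
  ℤtoℚ (x ℤ.+ x)                        ∎
  where open ≡-Reasoning

sumT : Pt ℤ → List (ℕ × ℕ) → ℤ
sumT T [] = + 0
sumT T ((i , j) ∷ d) = T i j ℤ.+ sumT T d

S-embed : ∀ T d → S (embed T) d ≡ ℤtoℚ (sumT T d)
S-embed T [] = refl
S-embed T ((i , j) ∷ d) = trans (cong (ℤtoℚ (T i j) ℚ.+_) (S-embed T d)) (sym (ℤtoℚ-+ (T i j) (sumT T d)))

S-cong : ∀ {P : ℕ × ℕ → Set} {x y} → (∀ i j → P (i , j) → x i j ≡ y i j) → ∀ {d} → All P d → S x d ≡ S y d
S-cong eq [] = refl
S-cong eq (_∷_ {i , j} p ps) = cong₂ ℚ._+_ (eq i j p) (S-cong eq ps)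

convex-max : ∀ {u v M t s} → u ℚ.≤ M → v ℚ.≤ M → 0ℚ ℚ.< t → 0ℚ ℚ.≤ s → t ℚ.+ s ≡ 1ℚ →
  M ≡ t ℚ.* u ℚ.+ s ℚ.* v → u ≡ M
convex-max {u} {v} {M} {t} {s} u≤M v≤M 0<t 0≤s t+s eq with u ℚₚ.<? M
... | no u≮M = ℚₚ.≤-antisym u≤M (ℚₚ.≮⇒≥ u≮M)
... | yes u<M = ⊥-elim (ℚₚ.<-irrefl (sym eq) (begin-strict
    t ℚ.* u ℚ.+ s ℚ.* v  <⟨ ℚₚ.+-mono-<-≤ (ℚₚ.*-monoʳ-<-pos t {{ℚ.positive 0<t}} u<M) (ℚₚ.*-monoˡ-≤-nonNeg s {{ℚ.nonNegative 0≤s}} v≤M) ⟩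
    t ℚ.* M ℚ.+ s ℚ.* M  ≡⟨ sym (ℚₚ.*-distribʳ-+ M t s) ⟩
    (t ℚ.+ s) ℚ.* M      ≡⟨ cong (ℚ._* M) t+s ⟩
    1ℚ ℚ.* M             ≡⟨ ℚₚ.*-identityˡ M ⟩
    M                    ∎))
  where open ℚₚ.≤-Reasoning

convex-zero : ∀ {u v t s} → 0ℚ ℚ.≤ u → 0ℚ ℚ.≤ v → 0ℚ ℚ.< t → 0ℚ ℚ.≤ s → t ℚ.+ s ≡ 1ℚ →
  0ℚ ≡ t ℚ.* u ℚ.+ s ℚ.* v → u ≡ 0ℚ
convex-zero {u} {v} {t} {s} 0≤u 0≤v 0<t 0≤s t+s eq =
  ℚₚ.neg-injective (convex-max (ℚₚ.neg-antimono-≤ 0≤u) (ℚₚ.neg-antimono-≤ 0≤v) 0<t 0≤s t+s (begin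
    0ℚ                                ≡⟨ cong ℚ.-_ eq ⟩
    ℚ.- (t ℚ.* u ℚ.+ s ℚ.* v)         ≡⟨ ℚₚ.neg-distrib-+ (t ℚ.* u) (s ℚ.* v) ⟩
    ℚ.- (t ℚ.* u) ℚ.+ ℚ.- (s ℚ.* v)   ≡⟨ cong₂ ℚ._+_ (ℚₚ.neg-distribʳ-* t u) (ℚₚ.neg-distribʳ-* s v) ⟩
    t ℚ.* ℚ.- u ℚ.+ s ℚ.* ℚ.- v       ∎))
  where open ≡-Reasoning

S-convex : ∀ {P : ℕ × ℕ → Set} {x p q : Pt ℚ} {t s : ℚ} → (∀ i j → P (i , j) → x i j ≡ t ℚ.* p i j ℚ.+ s ℚ.* q i j) →
  ∀ {d} → All P d → S x d ≡ t ℚ.* S p d ℚ.+ s ℚ.* S q d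
S-convex {t = t} {s} eq [] = sym (trans (cong₂ ℚ._+_ (ℚₚ.*-zeroʳ t) (ℚₚ.*-zeroʳ s)) (ℚₚ.+-identityˡ 0ℚ))
S-convex {x = x} {p} {q} {t} {s} eq (_∷_ {i , j} {d} h hs) = begin
  x i j ℚ.+ S x d
    ≡⟨ cong₂ ℚ._+_ (eq i j h) (S-convex {x = x} {p} {q} {t} {s} eq hs) ⟩
  (t ℚ.* p i j ℚ.+ s ℚ.* q i j) ℚ.+ (t ℚ.* S p d ℚ.+ s ℚ.* S q d)
    ≡⟨ interchange (t ℚ.* p i j) (s ℚ.* q i j) (t ℚ.* S p d) (s ℚ.* S q d) ⟩
  (t ℚ.* p i j ℚ.+ t ℚ.* S p d) ℚ.+ (s ℚ.* q i j ℚ.+ s ℚ.* S q d)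
    ≡⟨ cong₂ ℚ._+_ (sym (ℚₚ.*-distribˡ-+ t (p i j) (S p d))) (sym (ℚₚ.*-distribˡ-+ s (q i j) (S q d))) ⟩
  t ℚ.* (p i j ℚ.+ S p d) ℚ.+ s ℚ.* (q i j ℚ.+ S q d) ∎
  where
  open ≡-Reasoning

-- Hook-shaped paths

rowP : ℕ → ℕ → ℕ → List (ℕ × ℕ) → List (ℕ × ℕ)
rowP i a zero d = d
rowP i a (suc k) d = (i , a) ∷ rowP i (suc a) k d

colP : ℕ → ℕ → ℕ → List (ℕ × ℕ)
colP a j zero = []
colP a j (suc k) = (a , j) ∷ colP (suc a) j k

-- The length k of the column part is left free: j - 1 - i gives `dij`, while type C paths may have
-- to stop earlier, at the antidiagonal.
hook : ℕ → ℕ → ℕ → List (ℕ × ℕ)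
hook i j k = rowP i (suc i) (j ∸ i) (colP (suc i) j k)

dij≡hook : ∀ i j → dij i j ≡ hook i j (j ∸ 1 ∸ i)
dij≡hook i j = begin
  dij i j
    ≡⟨ cong₂ _++_ (cong (map (λ k → (i , k))) (range≡rng (suc i) j)) (cong (map (λ k → (k , j))) (range≡rng (suc i) (j ∸ 1))) ⟩
  map (λ k → (i , k)) (rng (suc i) (j ∸ i)) ++ map (λ k → (k , j)) (rng (suc i) (j ∸ 1 ∸ i))
    ≡⟨ cong (map (λ k → (i , k)) (rng (suc i) (j ∸ i)) ++_) (col (suc i) (j ∸ 1 ∸ i)) ⟩
  map (λ k → (i , k)) (rng (suc i) (j ∸ i)) ++ colP (suc i) j (j ∸ 1 ∸ i)
    ≡⟨ row (suc i) (j ∸ i) _ ⟩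
  hook i j (j ∸ 1 ∸ i) ∎
  where
  open ≡-Reasoning
  row : ∀ a k d → map (λ k → (i , k)) (rng a k) ++ d ≡ rowP i a k d
  row a zero d = refl
  row a (suc k) d = cong ((i , a) ∷_) (row (suc a) k d)
  col : ∀ a k → map (λ k → (k , j)) (rng a k) ≡ colP a j k
  col a zero = refl
  col a (suc k) = cong ((a , j) ∷_) (col (suc a) k)

rowP-All : ∀ {P : ℕ × ℕ → Set} {i a k d} → (∀ {b} → a ≤ b → b < a + k → P (i , b)) → All P d → All P (rowP i a k d)
rowP-All {k = zero} f hs = hs
rowP-All {i = i} {a} {suc k} f hs = f ≤-refl (subst (a <_) (sym (+-suc a k)) (s≤s (m≤m+n a k))) ∷
  rowP-All (λ {b} a<b b< → f (<⇒≤ a<b) (subst (b <_) (sym (+-suc a k)) b<)) hs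

colP-All : ∀ {P : ℕ × ℕ → Set} {a j k} → (∀ {b} → a ≤ b → b < a + k → P (b , j)) → All P (colP a j k)
colP-All {k = zero} f = []
colP-All {a = a} {k = suc k} f = f ≤-refl (subst (a <_) (sym (+-suc a k)) (s≤s (m≤m+n a k))) ∷
  colP-All (λ {b} a<b b< → f (<⇒≤ a<b) (subst (b <_) (sym (+-suc a k)) b<))

hook-All : ∀ {P : ℕ × ℕ → Set} {i j k} → i < j → (∀ {b} → i < b → b ≤ j → P (i , b)) →
  (∀ {b} → i < b → b ≤ i + k → P (b , j)) → All P (hook i j k)
hook-All {i = i} {j} i<j f g = rowP-All (λ {b} i<b b< → f i<b (s≤s⁻¹ (subst (b <_) (cong suc (m+[n∸m]≡n (<⇒≤ i<j))) b<)))
  (colP-All (λ i<b b< → g i<b (s≤s⁻¹ b<)))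

-- The corner occurs once in its hook, so when all other entries agree, equal sums leave a single
-- equation for it.
hook-corner : ∀ {x y : Pt ℚ} {i j k} → i < j →
  (∀ {b} → i < b → b < j → x i b ≡ y i b) → (∀ {b} → i < b → b ≤ i + k → x b j ≡ y b j) →
  S x (hook i j k) ≡ S y (hook i j k) → x i j ≡ y i j
hook-corner {x} {y} {i} {j} {k} i<j f g eq = row (j ∸ suc i) (suc i) (m∸n+n≡m i<j) ≤-refl
    (subst (λ l → S x (rowP i (suc i) l (colP (suc i) j k)) ≡ S y (rowP i (suc i) l (colP (suc i) j k))) (sym len) eq)
  where
  len : suc (j ∸ suc i) ≡ j ∸ i
  len = sym (+-∸-assoc 1 i<j)
  tail : S x (colP (suc i) j k) ≡ S y (colP (suc i) j k)
  tail = S-cong {P = λ (b , c) → x b c ≡ y b c} (λ _ _ h → h) (colP-All (λ i<b b< → g i<b (s≤s⁻¹ b<)))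
  row : ∀ l a → l + a ≡ j → i < a →
    S x (rowP i a (suc l) (colP (suc i) j k)) ≡ S y (rowP i a (suc l) (colP (suc i) j k)) → x i j ≡ y i j
  row zero a refl i<a e = ℚ+.∙-cancelʳ (S x (colP (suc i) j k)) (x i a) (y i a) (trans e (cong (y i a ℚ.+_) (sym tail)))
  row (suc l) a l+a≡j i<a e = row l (suc a) (trans (+-suc l a) l+a≡j) (m≤n⇒m≤1+n i<a)
    (ℚ+.∙-cancelˡ (x i a) _ _ (trans e (cong (ℚ._+ S y (rowP i (suc a) (suc l) (colP (suc i) j k)))
      (sym (f i<a (subst (suc a ≤_) l+a≡j (s≤s (m≤n+m a l))))))))

-- Weights and roots

+-sumℕ : ∀ (f : ℕ → ℕ) xs → + sumℕ (map f xs) ≡ sumℤ (map (λ k → + f k) xs)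
+-sumℕ f [] = refl
+-sumℕ f (x ∷ xs) = trans (ℤₚ.pos-+ (f x) (sumℕ (map f xs))) (cong (λ t → + f x ℤ.+ t) (+-sumℕ f xs))

module Weights (n : ℕ) (f₀ : Fin n) (a : ℕ → ℕ) where
  open Folding n f₀

  -- The coefficient of ε_k in λ; beyond n the range is empty and the value 0.
  Λ : ℕ → ℕ
  Λ k = sumℕ (map a (range k n))

  Λ-step : ∀ {k} → k ≤ n → Λ k ≡ a k + Λ (suc k)
  Λ-step k≤n = cong (λ l → sumℕ (map a l)) (range-cons k≤n)

  Λ-high : ∀ {k} → n < k → Λ k ≡ 0
  Λ-high n<k = cong (λ l → sumℕ (map a l)) (range-empty n<k)

  Λ-suc : ∀ k → Λ (suc k) ≤ Λ k
  Λ-suc k with k ≤? n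
  ... | yes k≤n = subst (Λ (suc k) ≤_) (sym (Λ-step k≤n)) (m≤n+m (Λ (suc k)) (a k))
  ... | no k≰n = subst (_≤ Λ k) (sym (Λ-high (m≤n⇒m≤1+n (≰⇒> k≰n)))) z≤n

  Λ-anti : ∀ {k l} → k ≤ l → Λ l ≤ Λ k
  Λ-anti {k} {l} k≤l = subst (λ t → Λ t ≤ Λ k) (m∸n+n≡m k≤l) (go (l ∸ k))
    where
    go : ∀ d → Λ (d + k) ≤ Λ k
    go zero = ≤-refl
    go (suc d) = ≤-trans (Λ-suc (d + k)) (go d)

  Λ-range : ∀ d {s t} → d + s ≡ suc t → t ≤ n → sumℕ (map a (range s t)) + Λ (suc t) ≡ Λ s
  Λ-range zero {s} {t} refl t≤n = cong (λ l → sumℕ (map a l) + Λ (suc t)) (range-empty {suc t} {t} ≤-refl)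
  Λ-range (suc d) {s} {t} eq t≤n = begin
    sumℕ (map a (range s t)) + Λ (suc t)              ≡⟨ cong (λ l → sumℕ (map a l) + Λ (suc t)) (range-cons s≤t) ⟩
    a s + sumℕ (map a (range (suc s) t)) + Λ (suc t)  ≡⟨ +-assoc (a s) _ _ ⟩
    a s + (sumℕ (map a (range (suc s) t)) + Λ (suc t)) ≡⟨ cong (λ x → a s + x) (Λ-range d (trans (+-suc d s) eq) t≤n) ⟩
    a s + Λ (suc s)                                   ≡⟨ sym (Λ-step (≤-trans s≤t t≤n)) ⟩
    Λ s                                               ∎
    where
    open ≡-Reasoning
    s≤t : s ≤ t
    s≤t = subst (s ≤_) (suc-injective eq) (m≤n+m s d)

  -- Continuation from 1, ..., n to 1, ..., 2n by the rule ε_(ι k) = -ε_k, for functions vanishing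
  -- beyond n. Applied to Λ it produces the weight with coordinates `abar`, applied to `ind r` the
  -- roots.
  odd : (ℕ → ℤ) → ℕ → ℤ
  odd h k = h k ℤ.- h (ι m k)

  module Odd (h : ℕ → ℤ) (vanish : ∀ {k} → n < k → h k ≡ + 0) where

    odd-low : ∀ {k} → k ≤ n → odd h k ≡ h k
    odd-low {k} k≤n = trans (cong (λ t → h k ℤ.- t) (vanish (ι-high k≤n))) (ℤₚ.+-identityʳ (h k))

    odd-high : ∀ {k} → n < k → odd h k ≡ ℤ.- h (ι m k)
    odd-high {k} n<k = trans (cong (λ t → t ℤ.- h (ι m k)) (vanish n<k)) (ℤₚ.+-identityˡ _)

    diff-low : ∀ {k} → k < n → odd h k ℤ.- odd h (suc k) ≡ h k ℤ.- h (suc k)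
    diff-low k<n = cong₂ ℤ._-_ (odd-low (<⇒≤ k<n)) (odd-low k<n)

    diff-mid : odd h n ℤ.- odd h (suc n) ≡ h n ℤ.+ h n
    diff-mid = cong₂ ℤ._+_ (odd-low ≤-refl)
      (trans (cong ℤ.-_ (odd-high ≤-refl)) (trans (ℤₚ.neg-involutive _) (cong h ι-suc-n)))

    diff-high : ∀ {k} → n < k → k < m → odd h k ℤ.- odd h (suc k) ≡ h (m ∸ k) ℤ.- h (suc (m ∸ k))
    diff-high {k} n<k k<m = begin
      odd h k ℤ.- odd h (suc k)                    ≡⟨ cong₂ ℤ._-_ (odd-high n<k) (odd-high (m≤n⇒m≤1+n n<k)) ⟩
      ℤ.- h (ι m k) ℤ.- ℤ.- h (ι m (suc k))        ≡⟨ neg-sub-neg (h (ι m k)) (h (ι m (suc k))) ⟩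
      h (ι m (suc k)) ℤ.- h (ι m k)                ≡⟨ cong (λ t → h (ι m (suc k)) ℤ.- h t) (sym (ι-suc (<⇒≤ k<m))) ⟩
      h (ι m (suc k)) ℤ.- h (suc (ι m (suc k)))    ≡⟨ cong (λ t → h t ℤ.- h (suc t)) (cong (_∸ suc k) (+-comm m 1)) ⟩
      h (m ∸ k) ℤ.- h (suc (m ∸ k))                ∎
      where
      open ≡-Reasoning

  m∸k<n : ∀ {k} → n < k → k < m → m ∸ k < n
  m∸k<n {k} n<k k<m = subst₂ _<_ (cong (_∸ suc k) (+-comm m 1)) ι-suc-n (ι-anti< {m} (s≤s n<k) k<m)

  Λℤ : ℕ → ℤ
  Λℤ k = + Λ k

  Λℤ-vanish : ∀ {k} → n < k → Λℤ k ≡ + 0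
  Λℤ-vanish n<k = cong +_ (Λ-high n<k)

  open Odd Λℤ Λℤ-vanish

  Λℤ-diff : ∀ {k} → k ≤ n → Λℤ k ℤ.- Λℤ (suc k) ≡ + a k
  Λℤ-diff {k} k≤n = trans (cong (ℤ._- Λℤ (suc k)) (trans (cong +_ (Λ-step k≤n)) (ℤₚ.pos-+ (a k) (Λ (suc k)))))
    (add-sub (+ a k) (Λℤ (suc k)))

  -- In the middle Λ n is followed by -Λ n, which accounts for the coordinate 2 a_n.
  abar-diff : ∀ {k} → k < m → + abar n a k ≡ odd Λℤ k ℤ.- odd Λℤ (suc k)
  abar-diff {k} k<m with <-cmp k n
  ... | tri< k<n _ _ = trans (cong +_ (if-true (<⇒<ᵇ-true k<n))) (sym (trans (diff-low k<n) (Λℤ-diff (<⇒≤ k<n))))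
  ... | tri≈ _ refl _ = trans (cong +_ (trans (if-false (≥⇒<ᵇ-false {k} ≤-refl)) (if-true (≡ᵇ-refl k))))
    (trans (ℤₚ.pos-+ (a k) (a k + 0)) (trans (cong₂ ℤ._+_ same (trans (cong +_ (+-identityʳ (a k))) same)) (sym diff-mid)))
    where
    same : + a k ≡ Λℤ k
    same = cong +_ (sym (trans (Λ-step ≤-refl) (trans (cong (λ t → a k + t) (Λ-high ≤-refl)) (+-identityʳ (a k)))))
  ... | tri> _ _ n<k = trans (cong +_ (trans (if-false (≥⇒<ᵇ-false (<⇒≤ n<k))) (if-false (≢⇒≡ᵇ (>⇒≢ n<k)))))
    (sym (trans (diff-high n<k k<m) (Λℤ-diff (<⇒≤ (m∸k<n n<k k<m)))))

  abar-sum : ∀ {i j} → i ≤ j → j < m →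
    + sumℕ (map (abar n a) (range i j)) ≡ odd Λℤ i ℤ.- odd Λℤ (suc j)
  abar-sum {i} {j} i≤j j<m = begin
    + sumℕ (map (abar n a) (range i j))                ≡⟨ +-sumℕ (abar n a) (range i j) ⟩
    sumℤ (map (λ k → + abar n a k) (range i j))        ≡⟨ cong (λ l → sumℤ (map (λ k → + abar n a k) l)) (range≡rng i j) ⟩
    Σℤ i (suc j ∸ i) (λ k → + abar n a k)
      ≡⟨ Σ-telescope (odd Λℤ) i (suc j ∸ i) (λ {k} _ k< → abar-diff (<-≤-trans (subst (k <_) end k<) j<m)) ⟩
    odd Λℤ i ℤ.- odd Λℤ (i + (suc j ∸ i))              ≡⟨ cong (λ t → odd Λℤ i ℤ.- odd Λℤ t) end ⟩
    odd Λℤ i ℤ.- odd Λℤ (suc j)                        ∎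
    where
    open ≡-Reasoning
    end : i + (suc j ∸ i) ≡ suc j
    end = m+[n∸m]≡n (m≤n⇒m≤1+n i≤j)

  module Roots {r : ℕ} (r≤n : r ≤ n) where
    private module I = Odd (ind r) (λ n<k → ind-≢ (<⇒≢ (≤-<-trans r≤n n<k)))

    -- With ε_(ι k) = -ε_k every α_k becomes ε_k - ε_(k+1), the long root 2 ε_n being the middle
    -- step.
    αs-diff : ∀ {k} → k < m → αs n k r ≡ odd (ind r) k ℤ.- odd (ind r) (suc k)
    αs-diff {k} k<m with <-cmp k n
    ... | tri< k<n _ _ = trans (if-false (≥⇒<ᵇ-false (<⇒≤ k<n))) (trans (if-true (<⇒<ᵇ-true k<n)) (sym (I.diff-low k<n)))
    ... | tri≈ _ refl _ = trans (if-false (≥⇒<ᵇ-false {k} ≤-refl)) (trans (if-false (≥⇒<ᵇ-false {k} ≤-refl))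
      (trans (two-* (ind r k)) (sym I.diff-mid)))
    ... | tri> _ _ n<k = trans (if-true (<⇒<ᵇ-true n<k)) (trans (if-true (<⇒<ᵇ-true (m∸k<n n<k k<m))) (sym (I.diff-high n<k k<m)))

    αij-odd : ∀ {i j} → i < j → j ≤ m → αij n i j r ≡ odd (ind r) i ℤ.- odd (ind r) j
    αij-odd {i} {suc j} (s≤s i≤j) j<m = begin
      αij n i (suc j) r                            ≡⟨ cong (λ l → sumℤ (map (λ k → αs n k r) l)) (range≡rng i j) ⟩
      Σℤ i (suc j ∸ i) (λ k → αs n k r)
        ≡⟨ Σ-telescope (odd (ind r)) i (suc j ∸ i) (λ {k} _ k< → αs-diff (<-≤-trans (subst (k <_) end k<) j<m)) ⟩
      odd (ind r) i ℤ.- odd (ind r) (i + (suc j ∸ i)) ≡⟨ cong (λ t → odd (ind r) i ℤ.- odd (ind r) t) end ⟩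
      odd (ind r) i ℤ.- odd (ind r) (suc j)        ∎
      where
      open ≡-Reasoning
      end : i + (suc j ∸ i) ≡ suc j
      end = m+[n∸m]≡n (m≤n⇒m≤1+n i≤j)

    ind-ι : ∀ {j} → j ≤ m → ind r (ι m j) ≡ ind (ι m r) j
    ind-ι {j} j≤m with r ≟ ι m j
    ... | yes refl = trans (ind-refl (ι m j)) (sym (trans (cong (λ t → ind t j) (ι-invol j≤m)) (ind-refl j)))
    ... | no r≢ = trans (ind-≢ r≢) (sym (ind-≢ {ι m r} {j} (λ eq → r≢ (trans (sym (ι-invol (≤-trans r≤n n≤m))) (cong (ι m) eq)))))

    αij-ind : ∀ {i j} → i ≤ n → i < j → j ≤ m → αij n i j r ≡ ind r i ℤ.+ (ℤ.- ind r j ℤ.+ ind (ι m r) j)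
    αij-ind {i} {j} i≤n i<j j≤m = begin
      αij n i j r                                        ≡⟨ αij-odd i<j j≤m ⟩
      odd (ind r) i ℤ.- odd (ind r) j                    ≡⟨ cong₂ ℤ._-_ (I.odd-low i≤n) (cong (λ t → ind r j ℤ.- t) (ind-ι j≤m)) ⟩
      ind r i ℤ.- (ind r j ℤ.- ind (ι m r) j)            ≡⟨ sub-sub (ind r i) (ind r j) (ind (ι m r) j) ⟩
      ind r i ℤ.+ (ℤ.- ind r j ℤ.+ ind (ι m r) j)        ∎
      where
      open ≡-Reasoning

  signed-Λ : ∀ b f → applySign b (Λℤ (suc (toℕ f))) ≡ odd Λℤ (enc b f)
  signed-Λ false f = sym (odd-low (toℕ<n f))
  signed-Λ true f = sym (trans (odd-high (ι-high (toℕ<n f))) (cong (λ t → ℤ.- Λℤ t) (ι-invol (Fin-≤ f))))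

-- The point T

sumT-rowP : ∀ T i a k d → sumT T (rowP i a k d) ≡ Σℤ a k (T i) ℤ.+ sumT T d
sumT-rowP T i a zero d = sym (ℤₚ.+-identityˡ _)
sumT-rowP T i a (suc k) d = trans (cong (λ t → T i a ℤ.+ t) (sumT-rowP T i (suc a) k d)) (sym (ℤₚ.+-assoc (T i a) _ _))

sumT-colP : ∀ T a j k → sumT T (colP a j k) ≡ Σℤ a k (λ b → T b j)
sumT-colP T a j zero = refl
sumT-colP T a j (suc k) = cong (λ t → T a j ℤ.+ t) (sumT-colP T (suc a) j k)

Chain-colP : ∀ i j k → Chain (i , j) (colP (suc i) j k)
Chain-colP i j zero = tt
Chain-colP i j (suc k) = inj₁ (refl , refl) , Chain-colP (suc i) j k

Chain-rowP : ∀ i j k {d} → Chain (i , k + j) d → Chain (i , j) (rowP i (suc j) k d)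
Chain-rowP i j zero c = c
Chain-rowP i j (suc k) {d} c = inj₂ (refl , refl) , Chain-rowP i (suc j) k (subst (λ t → Chain (i , t) d) (sym (+-suc k j)) c)

lastE-colP : ∀ i j k → lastE (i , j) (colP (suc i) j k) ≡ (k + i , j)
lastE-colP i j zero = refl
lastE-colP i j (suc k) = trans (lastE-colP (suc i) j k) (cong (_, j) (+-suc k i))

lastE-rowP : ∀ i j k d → lastE (i , j) (rowP i (suc j) k d) ≡ lastE (i , k + j) d
lastE-rowP i j zero d = refl
lastE-rowP i j (suc k) d = trans (lastE-rowP i (suc j) k d) (cong (λ t → lastE (i , t) d) (+-suc k j))

lastE-All : ∀ {P : ℕ × ℕ → Set} p ps → All P (p ∷ ps) → P (lastE p ps)
lastE-All p [] (h ∷ []) = h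
lastE-All p (q ∷ ps) (_ ∷ hs) = lastE-All q ps hs

Chain-row≤ : ∀ p ps → Chain p ps → proj₁ p ≤ proj₁ (lastE p ps)
Chain-row≤ p [] _ = ≤-refl
Chain-row≤ (i , j) ((.(suc i) , .j) ∷ ps) (inj₁ (refl , refl) , c) = ≤-trans (n≤1+n i) (Chain-row≤ _ ps c)
Chain-row≤ (i , j) ((.i , .(suc j)) ∷ ps) (inj₂ (refl , refl) , c) = Chain-row≤ _ ps c

module Cells (E : SegSet) where

  -- L is a parameter because Λ gives T on the type C region and `odd Λℤ` gives its image under `φ`
  -- on the whole triangle.
  cell : (ℕ → ℤ) → Pt ℤ
  cell L i j = L (R E i (j ∸ 1)) ℤ.- L (R E i j)

  cell-col : ∀ L {i j} → i < j → cell L i j ≡ L (C E i j) ℤ.- L (C E (suc i) j)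
  cell-col L {i} {suc j} (s≤s i≤j) with E i (suc j) in e
  ... | true = cong₂ (λ x y → L x ℤ.- L y) (sym (C-in E i≤j e)) (R-in E i≤j e)
  ... | false = trans (trans (cong (λ t → L (R E i j) ℤ.- L t) (R-out E i≤j e)) (ℤₚ.+-inverseʳ (L (R E i j))))
                  (sym (trans (cong (λ t → L t ℤ.- L (C E (suc i) (suc j))) (C-out E i≤j e)) (ℤₚ.+-inverseʳ (L (C E (suc i) (suc j))))))

  cell-out : ∀ L {i j} → i < j → E i j ≡ false → cell L i j ≡ + 0
  cell-out L {i} {suc j} (s≤s i≤j) e = trans (cong (λ t → L (R E i j) ℤ.- L t) (R-out E i≤j e)) (ℤₚ.+-inverseʳ (L (R E i j)))

  row-sum : ∀ L i k → Σℤ (suc i) k (cell L i) ≡ L i ℤ.- L (R E i (i + k))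
  row-sum L i k = trans (Σ-telescope (λ b → L (R E i (b ∸ 1))) (suc i) k (λ {b} _ _ → refl))
    (cong (λ t → L t ℤ.- L (R E i (i + k))) (R-refl E i))

  col-sum : ∀ L a j k → a + k ≤ j → Σℤ a k (λ b → cell L b j) ≡ L (C E a j) ℤ.- L (C E (a + k) j)
  col-sum L a j k le = Σ-telescope (λ b → L (C E b j)) a k (λ {b} _ b< → cell-col L (<-≤-trans b< le))

  -- The row part ends with R i j and the column part begins with C (i+1) j; these agree because the
  -- corner lies in E, so the two telescoping sums join.
  hook-sum : ∀ L {i j} k → i < j → E i j ≡ true → suc i + k ≤ j →
    sumT (cell L) (hook i j k) ≡ L i ℤ.- L (C E (suc i + k) j)
  hook-sum L {i} {j} k i<j e le = begin
    sumT (cell L) (hook i j k)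
      ≡⟨ sumT-rowP (cell L) i (suc i) (j ∸ i) _ ⟩
    Σℤ (suc i) (j ∸ i) (cell L i) ℤ.+ sumT (cell L) (colP (suc i) j k)
      ≡⟨ cong₂ ℤ._+_ (row-sum L i (j ∸ i)) (trans (sumT-colP (cell L) (suc i) j k) (col-sum L (suc i) j k le)) ⟩
    (L i ℤ.- L (R E i (i + (j ∸ i)))) ℤ.+ (L (C E (suc i) j) ℤ.- L (C E (suc i + k) j))
      ≡⟨ cong (λ t → (L i ℤ.- L t) ℤ.+ (L (C E (suc i) j) ℤ.- L (C E (suc i + k) j))) (trans (cong (R E i) (m+[n∸m]≡n (<⇒≤ i<j))) (corner i<j e)) ⟩
    (L i ℤ.- L (C E (suc i) j)) ℤ.+ (L (C E (suc i) j) ℤ.- L (C E (suc i + k) j))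
      ≡⟨ sub-trans (L i) (L (C E (suc i) j)) (L (C E (suc i + k) j)) ⟩
    L i ℤ.- L (C E (suc i + k) j) ∎
    where
    open ≡-Reasoning
    corner : ∀ {j} → i < j → E i j ≡ true → R E i j ≡ C E (suc i) j
    corner {suc j} (s≤s i≤j) e = R-in E i≤j e

hook-end : ∀ {i j} → i < j → suc i + (j ∸ 1 ∸ i) ≡ j
hook-end {i} {suc j} (s≤s i≤j) = cong suc (m+[n∸m]≡n i≤j)

hook-ind : (P : ℕ → ℕ → Set) →
  (∀ {i j} → i < j → (∀ {b} → i < b → b < j → P i b) → (∀ {b} → i < b → b < j → P b j) → P i j) →
  ∀ {i j} → i < j → P i j
hook-ind P step {i} {j} i<j = go j i<j (m≤n+m j i)
  where
  go : ∀ N {i j} → i < j → j ≤ i + N → P i j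
  go zero {i} {j} i<j le = ⊥-elim (<⇒≱ i<j (subst (j ≤_) (+-identityʳ i) le))
  go (suc N) {i} {j} i<j le = step i<j
    (λ {b} i<b b<j → go N i<b (s≤s⁻¹ (≤-trans b<j le′)))
    (λ {b} i<b b<j → go N b<j (≤-trans le′ (+-monoˡ-≤ N i<b)))
    where
    le′ : j ≤ suc (i + N)
    le′ = subst (j ≤_) (+-suc i N) le

-- Uniqueness of x(E) and a criterion for vertices

IsXE-unique : ∀ n a E {x y} → IsXE n a E x → IsXE n a E y → EqA n x y
IsXE-unique n a E {x} {y} hx hy i j v@(_ , i<j , _) = hook-ind P step i<j v
  where
  P : ℕ → ℕ → Set
  P i j = ValidA n (i , j) → x i j ≡ y i j
  byCase : ∀ {i j} (b : Bool) → E i j ≡ b → i < j →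
    (∀ {b} → i < b → b < j → P i b) → (∀ {b} → i < b → b < j → P b j) → P i j
  byCase {i} {j} false e _ _ _ v = trans (proj₁ (hx i j v) e) (sym (proj₁ (hy i j v) e))
  byCase {i} {j} true e i<j row col v@(1≤i , _ , j≤m) = hook-corner {x} {y} {i} {j} {j ∸ 1 ∸ i} i<j
    (λ i<b b<j → row i<b b<j (1≤i , i<b , ≤-trans (<⇒≤ b<j) j≤m))
    (λ {b} i<b b≤ → let b<j = subst (b <_) (hook-end i<j) (s≤s b≤) in col i<b b<j (≤-trans 1≤i (<⇒≤ i<b) , b<j , j≤m))
    (subst (λ d → S x d ≡ S y d) (dij≡hook i j) (trans (proj₂ (hx i j v) e) (sym (proj₂ (hy i j v) e))))
  step : ∀ {i j} → i < j → (∀ {b} → i < b → b < j → P i b) → (∀ {b} → i < b → b < j → P b j) → P i j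
  step {i} {j} = byCase (E i j) refl

-- `arm` counts the steps down column j, and `reach` keeps the lower end within the type C region.
-- `is-hook` links the hook to the separate first entry that `DyckC` expects.
record TightHook (n : ℕ) (a : ℕ → ℕ) (y : Pt ℚ) (i j : ℕ) : Set where
  field
    arm     : ℕ
    short   : suc i + arm ≤ j
    reach   : i + arm + j ≤ 2 * n + 1
    start   : ℕ × ℕ
    rest    : List (ℕ × ℕ)
    is-hook : start ∷ rest ≡ hook i j arm
    dyck    : DyckC n start rest
    tight   : S y (start ∷ rest) ≡ ℕtoℚ (MC n a start rest)

module Extreme (n : ℕ) (a : ℕ → ℕ) (y : Pt ℚ)
  (active : ∀ {i j} → ValidC n (i , j) → y i j ≡ 0ℚ ⊎ TightHook n a y i j)
  (p q : Pt ℚ) (t : ℚ) (inp : InP n a p) (inq : InP n a q) (0<t : 0ℚ ℚ.< t) (t<1 : t ℚ.< 1ℚ)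
  (eq : ∀ i j → ValidC n (i , j) → y i j ≡ t ℚ.* p i j ℚ.+ (1ℚ ℚ.- t) ℚ.* q i j) where

  s : ℚ
  s = 1ℚ ℚ.- t

  s+t : s ℚ.+ t ≡ 1ℚ
  s+t = trans (ℚₚ.+-assoc 1ℚ (ℚ.- t) t) (trans (cong (1ℚ ℚ.+_) (ℚₚ.+-inverseˡ t)) (ℚₚ.+-identityʳ 1ℚ))

  t+s : t ℚ.+ s ≡ 1ℚ
  t+s = trans (ℚₚ.+-comm t s) s+t

  0<s : 0ℚ ℚ.< s
  0<s = subst (ℚ._< s) (ℚₚ.+-inverseʳ t) (ℚₚ.+-monoˡ-< (ℚ.- t) t<1)

  zero-coincide : ∀ {i j} → ValidC n (i , j) → y i j ≡ 0ℚ → p i j ≡ q i j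
  zero-coincide {i} {j} v y≡0 = trans
      (convex-zero (proj₁ inp i j v) (proj₁ inq i j v) 0<t (ℚₚ.<⇒≤ 0<s) t+s zero-eq)
      (sym (convex-zero (proj₁ inq i j v) (proj₁ inp i j v) 0<s (ℚₚ.<⇒≤ 0<t) s+t
        (trans zero-eq (ℚₚ.+-comm (t ℚ.* p i j) (s ℚ.* q i j)))))
    where
    zero-eq : 0ℚ ≡ t ℚ.* p i j ℚ.+ s ℚ.* q i j
    zero-eq = trans (sym y≡0) (eq i j v)

  path-coincide : ∀ {b d} → DyckC n b d → S y (b ∷ d) ≡ ℕtoℚ (MC n a b d) → S p (b ∷ d) ≡ S q (b ∷ d)
  path-coincide {b} {d} dyck tight = trans
      (convex-max (proj₂ inp b d dyck) (proj₂ inq b d dyck) 0<t (ℚₚ.<⇒≤ 0<s) t+s S-eq)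
      (sym (convex-max (proj₂ inq b d dyck) (proj₂ inp b d dyck) 0<s (ℚₚ.<⇒≤ 0<t) s+t
        (trans S-eq (ℚₚ.+-comm (t ℚ.* S p (b ∷ d)) (s ℚ.* S q (b ∷ d))))))
    where
    S-eq : ℕtoℚ (MC n a b d) ≡ t ℚ.* S p (b ∷ d) ℚ.+ s ℚ.* S q (b ∷ d)
    S-eq = trans (sym tight) (S-convex {x = y} {p} {q} {t} {s} eq (proj₁ (proj₂ dyck)))

  -- An inequality that is an equality at y is one at p and q too. A vanishing entry settles itself,
  -- and a tight hook determines its corner from entries with shorter windows.
  coincide : ∀ {i j} → i < j → ValidC n (i , j) → p i j ≡ q i j
  coincide = hook-ind P (λ i<j row col v → byCase i<j row col v (active v))
    where
    P : ℕ → ℕ → Set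
    P i j = ValidC n (i , j) → p i j ≡ q i j
    byCase : ∀ {i j} → i < j → (∀ {b} → i < b → b < j → P i b) → (∀ {b} → i < b → b < j → P b j) →
      ValidC n (i , j) → y i j ≡ 0ℚ ⊎ TightHook n a y i j → p i j ≡ q i j
    byCase _ _ _ v (inj₁ y≡0) = zero-coincide v y≡0
    byCase {i} {j} i<j row col (1≤i , _ , le) (inj₂ h) = hook-corner {p} {q} {i} {j} {arm} i<j
      (λ i<b b<j → row i<b b<j (1≤i , i<b , ≤-trans (+-monoʳ-≤ i (<⇒≤ b<j)) le))
      (λ i<b b≤ → let b<j = ≤-trans (s≤s b≤) short in
        col i<b b<j (≤-trans 1≤i (<⇒≤ i<b) , b<j , ≤-trans (+-monoˡ-≤ j b≤) reach))
      (subst (λ d → S p d ≡ S q d) is-hook (path-coincide dyck tight))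
      where open TightHook h

vertex : ∀ {n a y} → InP n a y → (∀ {i j} → ValidC n (i , j) → y i j ≡ 0ℚ ⊎ TightHook n a y i j) → IsVertex n a y
vertex {n} {a} {y} iny active = iny , λ p q t inp inq 0<t t<1 eq i j v →
  Extreme.coincide n a y active p q t inp inq 0<t t<1 eq (proj₁ (proj₂ v)) v

module Point (n : ℕ) (f₀ : Fin n) (a : ℕ → ℕ) (E : SegSet) (symRp : SymRp n E) where
  open Folding n f₀
  open Sym E symRp
  open Network m E cross using (R<C; R-mono; C-mono)
  open Cells E
  open Weights n f₀ a
  open Odd Λℤ Λℤ-vanish

  m+1≤ : ∀ {k} → k < m + 1 → k ≤ m
  m+1≤ {k} lt = s≤s⁻¹ (subst (k <_) (+-comm m 1) lt)

  below-antidiagonal : ∀ {i j} → 1 ≤ i → i + j ≤ m + 1 → j ≤ m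
  below-antidiagonal {i} {j} 1≤i le = m+1≤ (≤-trans (+-monoˡ-≤ j 1≤i) le)

  -- By symmetry the complement of R i j is C (ι j) (ι i), and before the antidiagonal i < ι j and j
  -- < ι i, so `R<C` applies. A number smaller than its complement is at most n.
  R-low : ∀ {i j} → 1 ≤ i → i ≤ j → i + j < m + 1 → R E i j ≤ n
  R-low {i} {j} 1≤i i≤j lt = ≮⇒≥ λ n<R → <⇒≱ (<-trans n<R small) (ι-low n<R)
    where
    j≤m = below-antidiagonal 1≤i (<⇒≤ lt)
    small : R E i j < ι m (R E i j)
    small = subst (R E i j <_)
      (trans (C-ι (ι-anti {m} i≤j) (ι-pos j≤m) (ι-≤ 1≤i))
             (cong (ι m) (cong₂ (R E) (ι-invol (≤-trans i≤j j≤m)) (ι-invol j≤m))))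
      (R<C 1≤i i≤j (m+n≤o⇒m≤o∸n (suc i) lt) (m+n≤o⇒m≤o∸n (suc j) (subst (λ t → suc t ≤ m + 1) (+-comm i j) lt))
        (ι-anti {m} i≤j) (ι-≤ 1≤i))

  C-high : ∀ {i j} → 1 ≤ i → i ≤ j → j ≤ m → m + 1 < i + j → n < C E i j
  C-high {i} {j} 1≤i i≤j j≤m lt = subst (n <_) (sym (C-ι i≤j 1≤i j≤m))
    (ι-high (R-low (ι-pos j≤m) (ι-anti {m} i≤j)
      (<-≤-trans (+-monoˡ-< (ι m i) ιj<i) (≤-reflexive (ι-sum (≤-trans i≤j j≤m))))))
    where
    ιj<i : ι m j < i
    ιj<i = m<n+o⇒m∸n<o (m + 1) j {{>-nonZero 1≤i}} (subst (m + 1 <_) (+-comm i j) lt)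

  T : Pt ℤ
  T = cell Λℤ

  -- Before the antidiagonal all values are at most n, where `odd Λℤ` is Λ. On it a cell of E
  -- exchanges p and ι p, and the difference Λ p is doubled. After it the reflected row is a column,
  -- and `odd Λℤ` is -Λ of the complement.
  φ-cell : ∀ i j → ValidA n (i , j) → φ n (embed T) i j ≡ ℤtoℚ (cell (odd Λℤ) i j)
  φ-cell i (suc j) (1≤i , s≤s i≤j , j<m) with <-cmp (i + suc j) (m + 1)
  ... | tri< lt _ _ = trans (if-true (<⇒<ᵇ-true lt))
      (cong ℤtoℚ (sym (cong₂ ℤ._-_ (odd-low (R-low 1≤i i≤j (<-trans (+-monoʳ-< i (n<1+n j)) lt)))
                                    (odd-low (R-low 1≤i (m≤n⇒m≤1+n i≤j) lt)))))
  ... | tri≈ _ eq _ = trans (if-false (≥⇒<ᵇ-false (≤-reflexive (sym eq)))) (trans (if-true (trans (cong (_≡ᵇ m + 1) eq) (≡ᵇ-refl (m + 1))))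
      (trans (ℤtoℚ-double (T i (suc j))) (cong ℤtoℚ diagonal)))
    where
    p = R E i j
    p≤n : p ≤ n
    p≤n = R-low 1≤i i≤j (≤-trans (+-monoʳ-< i (n<1+n j)) (≤-reflexive eq))
    q≡ιp : C E (suc i) (suc j) ≡ ι m p
    q≡ιp = trans (C-ι (s≤s i≤j) (s≤s z≤n) j<m) (cong (ι m) (cong₂ (R E) ιj ιi))
      where
      ιj : ι m (suc j) ≡ i
      ιj = trans (cong (_∸ suc j) (sym eq)) (m+n∸n≡m i (suc j))
      ιi : ι m (suc i) ≡ j
      ιi = trans (cong (_∸ suc i) (trans (sym eq) (+-suc i j))) (m+n∸m≡n (suc i) j)
    diagonal : T i (suc j) ℤ.+ T i (suc j) ≡ cell (odd Λℤ) i (suc j)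
    diagonal with E i (suc j) in e
    ... | false = trans (cong₂ ℤ._+_ (cell-out Λℤ (s≤s i≤j) e) (cell-out Λℤ (s≤s i≤j) e)) (sym (cell-out (odd Λℤ) (s≤s i≤j) e))
    ... | true = begin
        T i (suc j) ℤ.+ T i (suc j)       ≡⟨ cong₂ ℤ._+_ single single ⟩
        Λℤ p ℤ.+ Λℤ p                     ≡⟨ sym (cong₂ ℤ._+_ (odd-low p≤n) (trans (cong ℤ.-_ (odd-high (ι-high p≤n)))
                                               (trans (ℤₚ.neg-involutive _) (cong Λℤ (ι-invol (≤-trans p≤n n≤m)))))) ⟩
        odd Λℤ p ℤ.- odd Λℤ (ι m p)       ≡⟨ cong (λ t → odd Λℤ p ℤ.- odd Λℤ t) (sym (trans (R-in E i≤j e) q≡ιp)) ⟩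
        cell (odd Λℤ) i (suc j)           ∎
      where
      open ≡-Reasoning
      single : T i (suc j) ≡ Λℤ p
      single = trans (cong (λ t → Λℤ p ℤ.- t) (trans (cong Λℤ (trans (R-in E i≤j e) q≡ιp)) (Λℤ-vanish (ι-high p≤n)))) (ℤₚ.+-identityʳ _)
  ... | tri> _ _ gt = trans (if-false (≥⇒<ᵇ-false (<⇒≤ gt))) (trans (if-false (≢⇒≡ᵇ (>⇒≢ gt))) (cong ℤtoℚ (begin
      Λℤ (R E (ι m (suc j)) (ι m i ∸ 1)) ℤ.- Λℤ (R E (ι m (suc j)) (ι m i))
        ≡⟨ cong₂ (λ s t → Λℤ s ℤ.- Λℤ t) (trans (cong (λ t → R E (ι m (suc j)) (t ∸ 1)) (sym (ι-suc i≤m))) (reflected (s≤s i≤j) (s≤s z≤n)))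
                                         (reflected (m≤n⇒m≤1+n i≤j) 1≤i) ⟩
      Λℤ (ι m c′) ℤ.- Λℤ (ι m c)          ≡⟨ neg-sub-neg (Λℤ (ι m c)) (Λℤ (ι m c′)) ⟨
      ℤ.- Λℤ (ι m c) ℤ.- ℤ.- Λℤ (ι m c′)
        ≡⟨ sym (cong₂ ℤ._-_ (odd-high (C-high 1≤i (m≤n⇒m≤1+n i≤j) j<m gt))
                            (odd-high (C-high (s≤s z≤n) (s≤s i≤j) j<m (m≤n⇒m≤1+n gt)))) ⟩
      odd Λℤ c ℤ.- odd Λℤ c′              ≡⟨ sym (cell-col (odd Λℤ) (s≤s i≤j)) ⟩
      cell (odd Λℤ) i (suc j)             ∎)))
    where
    open ≡-Reasoning
    c = C E i (suc j)
    c′ = C E (suc i) (suc j)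
    i≤m = ≤-trans i≤j (<⇒≤ j<m)
    reflected : ∀ {k} → k ≤ suc j → 1 ≤ k → R E (ι m (suc j)) (ι m k) ≡ ι m (C E k (suc j))
    reflected k≤ 1≤k = trans (R-ι (ι-anti {m} k≤) (ι-pos j<m) (ι-≤ 1≤k))
      (cong (ι m) (cong₂ (C E) (ι-invol (≤-trans k≤ j<m)) (ι-invol j<m)))

  φT-isXE : IsXE n a E (φ n (embed T))
  φT-isXE i (suc j) v@(1≤i , i<j@(s≤s i≤j) , j<m) = zero-part , sum-part
    where
    k = j ∸ i
    zero-part : E i (suc j) ≡ false → φ n (embed T) i (suc j) ≡ 0ℚ
    zero-part e = trans (φ-cell i (suc j) v) (cong ℤtoℚ (cell-out (odd Λℤ) i<j e))
    valid : All (ValidA n) (hook i (suc j) k)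
    valid = hook-All i<j (λ i<b b≤j → 1≤i , i<b , ≤-trans b≤j j<m)
      (λ {b} i<b b≤ → ≤-trans 1≤i (<⇒≤ i<b) , subst (b <_) (hook-end i<j) (s≤s b≤) , j<m)
    sum-part : E i (suc j) ≡ true → S (φ n (embed T)) (dij i (suc j)) ≡ ℕtoℚ (sumℕ (map (abar n a) (range i j)))
    sum-part e = begin
      S (φ n (embed T)) (dij i (suc j))                      ≡⟨ cong (S (φ n (embed T))) (dij≡hook i (suc j)) ⟩
      S (φ n (embed T)) (hook i (suc j) k)                   ≡⟨ S-cong φ-cell valid ⟩
      S (embed (cell (odd Λℤ))) (hook i (suc j) k)           ≡⟨ S-embed (cell (odd Λℤ)) (hook i (suc j) k) ⟩
      ℤtoℚ (sumT (cell (odd Λℤ)) (hook i (suc j) k))         ≡⟨ cong ℤtoℚ (hook-sum (odd Λℤ) k i<j e (≤-reflexive (hook-end i<j))) ⟩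
      ℤtoℚ (odd Λℤ i ℤ.- odd Λℤ (C E (suc i + k) (suc j)))   ≡⟨ cong (λ t → ℤtoℚ (odd Λℤ i ℤ.- odd Λℤ t)) (trans (cong (λ t → C E t (suc j)) (hook-end i<j)) (C-refl E (suc j))) ⟩
      ℤtoℚ (odd Λℤ i ℤ.- odd Λℤ (suc j))                     ≡⟨ cong ℤtoℚ (abar-sum i≤j j<m) ⟨
      ℕtoℚ (sumℕ (map (abar n a) (range i j)))               ∎
      where open ≡-Reasoning

  T-nonneg : ∀ {i j} → ValidC n (i , j) → + 0 ℤ.≤ T i j
  T-nonneg {i} {suc j} (1≤i , s≤s i≤j , le) =
    ℤₚ.i≤j⇒0≤j-i (ℤ.+≤+ (Λ-anti (R-mono 1≤i i≤j (n≤1+n j) (below-antidiagonal 1≤i le))))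

  StrictlyAfter : ℕ × ℕ → ℕ × ℕ → Set
  StrictlyAfter (i , j) (i′ , j′) = (i < i′ × j ≤ j′) ⊎ (i ≤ i′ × j < j′)

  -- In a common row or column this is monotonicity, in general position `R<C`. Along a path the
  -- nonzero entries of T are thus drops of Λ over successive intervals that do not overlap.
  chain-order : ∀ {i j i′ j′} → 1 ≤ i → i < j → j ≤ m → i′ < j′ → j′ ≤ m → E i j ≡ true → E i′ j′ ≡ true →
    StrictlyAfter (i , j) (i′ , j′) → R E i j ≤ R E i′ (j′ ∸ 1)
  chain-order {i} {suc j} {i′} {suc j′} 1≤i (s≤s i≤j) j<m (s≤s i′≤j′) j′<m e f after with i ≟ i′ | suc j ≟ suc j′
  ... | yes refl | yes refl = ⊥-elim (same after)
    where
    same : ¬ StrictlyAfter (i , suc j) (i , suc j)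
    same (inj₁ (lt , _)) = <-irrefl refl lt
    same (inj₂ (_ , lt)) = <-irrefl refl lt
  ... | yes refl | no j≢ = R-mono 1≤i (m≤n⇒m≤1+n i≤j) (s≤s⁻¹ (≤∧≢⇒< (j≤ after) j≢)) (<⇒≤ j′<m)
    where
    j≤ : StrictlyAfter (i , suc j) (i , suc j′) → suc j ≤ suc j′
    j≤ (inj₁ (_ , le)) = le
    j≤ (inj₂ (_ , lt)) = <⇒≤ lt
  ... | no i≢ | yes refl = begin
      R E i (suc j)          ≡⟨ R-in E i≤j e ⟩
      C E (suc i) (suc j)    ≤⟨ C-mono (s≤s z≤n) (i< after) (m≤n⇒m≤1+n i′≤j′) j<m ⟩
      C E i′ (suc j)         ≡⟨ C-in E i′≤j′ f ⟩
      R E i′ j               ∎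
    where
    open ≤-Reasoning
    i< : StrictlyAfter (i , suc j) (i′ , suc j) → i < i′
    i< (inj₁ (lt , _)) = lt
    i< (inj₂ (_ , lt)) = ⊥-elim (<-irrefl refl lt)
  ... | no i≢ | no j≢ = subst (R E i (suc j) ≤_) (C-in E i′≤j′ f)
      (<⇒≤ (R<C 1≤i (m≤n⇒m≤1+n i≤j) (≤∧≢⇒< (i≤ after) i≢) (≤∧≢⇒< (j≤ after) j≢) (m≤n⇒m≤1+n i′≤j′) j′<m))
    where
    i≤ : StrictlyAfter (i , suc j) (i′ , suc j′) → i ≤ i′
    i≤ (inj₁ (lt , _)) = <⇒≤ lt
    i≤ (inj₂ (le , _)) = le
    j≤ : StrictlyAfter (i , suc j) (i′ , suc j′) → suc j ≤ suc j′
    j≤ (inj₁ (_ , le)) = le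
    j≤ (inj₂ (_ , lt)) = <⇒≤ lt

  EntryBound : ℕ → (ℕ × ℕ → Set) → Set
  EntryBound Q P = ∀ {i j} → P (i , j) → i < j → j ≤ m → E i j ≡ true → Q ≤ R E i (j ∸ 1)

  From : ℕ × ℕ → ℕ × ℕ → Set
  From (i , j) (i′ , j′) = i ≤ i′ × j ≤ j′

  -- Λ Q is what is left to spend. A cell of E spends the drop of Λ from its entering value, which
  -- is at least Q, to R i j, the new threshold; other cells spend nothing. As the threshold never
  -- exceeds j, at least Λ j remains.
  pass-cell : ∀ {i j Q} → ValidC n (i , j) → Q ≤ j → EntryBound Q (From (i , j)) →
    ∃[ Q′ ] (T i j ℤ.+ Λℤ Q′ ℤ.≤ Λℤ Q × Q′ ≤ j × EntryBound Q′ (StrictlyAfter (i , j)))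
  pass-cell {i} {j} {Q} (1≤i , i<j , le) Q≤j bound with E i j in e
  ... | false = Q , ℤₚ.≤-reflexive (trans (cong (ℤ._+ Λℤ Q) (cell-out Λℤ i<j e)) (ℤₚ.+-identityˡ _)) , Q≤j ,
      λ after → bound (weaken after)
    where
    weaken : ∀ {B} → StrictlyAfter (i , j) B → From (i , j) B
    weaken (inj₁ (lt , le)) = <⇒≤ lt , le
    weaken (inj₂ (le , lt)) = le , <⇒≤ lt
  ... | true = R E i j ,
      ℤₚ.≤-trans (ℤₚ.≤-reflexive (sub-add (Λℤ (R E i (j ∸ 1))) (Λℤ (R E i j)))) (ℤ.+≤+ (Λ-anti (bound (≤-refl , ≤-refl) i<j j≤m e))) ,
      R-upper E (<⇒≤ i<j) ,
      λ after i′<j′ j′≤m f → chain-order 1≤i i<j j≤m i′<j′ j′≤m e f after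
    where
    j≤m = below-antidiagonal 1≤i le

  path-bound : ∀ {Q} p ps → All (ValidC n) (p ∷ ps) → Chain p ps → Q ≤ proj₂ p → EntryBound Q (From p) →
    sumT T (p ∷ ps) ℤ.+ Λℤ (proj₂ (lastE p ps)) ℤ.≤ Λℤ Q
  path-bound {Q} (i , j) [] (v ∷ []) _ Q≤j bound with pass-cell v Q≤j bound
  ... | Q′ , le , Q′≤j , _ = ℤₚ.≤-trans
      (ℤₚ.+-mono-≤ (ℤₚ.≤-reflexive (ℤₚ.+-identityʳ (T i j))) (ℤ.+≤+ (Λ-anti Q′≤j))) le
  path-bound {Q} (i , j) (q ∷ ps) (v ∷ vs) (step , c) Q≤j bound with pass-cell v Q≤j bound
  ... | Q′ , le , Q′≤j , bound′ = ℤₚ.≤-trans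
      (ℤₚ.≤-trans (ℤₚ.≤-reflexive (ℤₚ.+-assoc (T i j) (sumT T (q ∷ ps)) _))
        (ℤₚ.+-monoʳ-≤ (T i j) (path-bound q ps vs c (≤-trans Q′≤j (proj₁ (advance step))) (λ from → bound′ (proj₂ (advance step) from))))) le
    where
    advance : ∀ {q} → Step (i , j) q → j ≤ proj₂ q × (∀ {B} → From q B → StrictlyAfter (i , j) B)
    advance (inj₁ (refl , refl)) = ≤-refl , λ (a , b) → inj₁ (a , b)
    advance (inj₂ (refl , refl)) = n≤1+n j , λ (a , b) → inj₂ (a , b)

  -- A path ending on the diagonal omits the tail of the a_k from its last column on; one ending on
  -- the antidiagonal has its last column beyond n, where Λ is 0. This merges the two cases of
  -- M(λ,d).
  MC-Λ : ∀ p ps → proj₁ p ≤ proj₁ (lastE p ps) → ValidC n (lastE p ps) →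
    ((proj₂ (lastE p ps) ≡ suc (proj₁ (lastE p ps))) ⊎ (proj₁ (lastE p ps) + proj₂ (lastE p ps) ≡ m + 1)) →
    MC n a p ps + Λ (proj₂ (lastE p ps)) ≡ Λ (proj₁ p)
  MC-Λ p ps p≤ v end with lastE p ps
  ... | (i , j) with j ≡ᵇ suc i in e | v
  ...   | true | (1≤i , i<j , le) with ≡ᵇ⇒≡ j (suc i) (subst True (sym e) tt)
  ...     | refl = Λ-range (suc i ∸ proj₁ p) (m∸n+n≡m (m≤n⇒m≤1+n p≤)) (half le)
    where
    half : ∀ {i} → i + suc i ≤ m + 1 → i ≤ n
    half {i} le = ≮⇒≥ λ n<i → <⇒≱ (subst (_< i + suc i) suc-n (+-mono-< n<i (s≤s n<i))) le
  MC-Λ p ps p≤ v (inj₁ refl) | (i , .(suc i)) | false | _ = contradiction (trans (sym (≡ᵇ-refl i)) e) λ ()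
  MC-Λ p ps p≤ v (inj₂ eq) | (i , j) | false | (1≤i , i<j , le) =
    trans (cong (λ t → Λ (proj₁ p) + t) (Λ-high n<j)) (+-identityʳ _)
    where
    n<j : n < j
    n<j = ≰⇒> λ j≤n → <⇒≱ (+-mono-<-≤ (<-≤-trans i<j j≤n) j≤n) (≤-trans (≤-trans (n≤1+n _) (≤-reflexive (trans (sym (+-suc n n)) suc-n))) (≤-reflexive (sym eq)))

  Dyck-Λ : ∀ {p ps} → DyckC n p ps → Λℤ (proj₁ p) ℤ.- Λℤ (proj₂ (lastE p ps)) ≡ + MC n a p ps
  Dyck-Λ {p} {ps} (_ , valid , chain , end) =
    trans (cong (ℤ._- Λℤ l) (trans (cong +_ (sym (MC-Λ p ps (Chain-row≤ p ps chain) (lastE-All p ps valid) end))) (ℤₚ.pos-+ (MC n a p ps) (Λ l))))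
      (add-sub (+ MC n a p ps) (Λℤ l))
    where l = proj₂ (lastE p ps)

  T-path : ∀ {p ps} → DyckC n p ps → sumT T (p ∷ ps) ℤ.≤ + MC n a p ps
  T-path {i , j} {ps} dyck@(refl , valid , chain , _) = begin
    sumT T d                       ≡⟨ add-sub (sumT T d) l ⟨
    sumT T d ℤ.+ l ℤ.- l           ≤⟨ ℤₚ.+-monoˡ-≤ (ℤ.- l) (path-bound (i , j) ps valid chain (n≤1+n i) entry) ⟩
    Λℤ i ℤ.- l                     ≡⟨ Dyck-Λ {i , j} {ps} dyck ⟩
    + MC n a (i , j) ps            ∎
    where
    open ℤₚ.≤-Reasoning
    d = (i , j) ∷ ps
    l = Λℤ (proj₂ (lastE (i , j) ps))
    -- The initial threshold is i: a value on a row from i on is at least the number of that row.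
    entry : EntryBound i (From (i , j))
    entry (i≤i′ , _) i′<j′ _ _ = ≤-trans i≤i′ (R-lower E (<⇒≤pred i′<j′))

  inP : InP n a (embed T)
  inP = (λ i j v → ℤtoℚ-mono (T-nonneg v)) ,
    λ p ps dyck → subst (ℚ._≤ ℕtoℚ (MC n a p ps)) (sym (S-embed T (p ∷ ps))) (ℤtoℚ-mono (T-path {p} {ps} dyck))

  -- e is the last row of the path. The hook sum is Λ i - Λ (C (e+1) j) and the bound of the path is
  -- Λ i - Λ j, so the last hypothesis is tightness.
  dyckHook : ∀ {i j} → ValidC n (i , j) → E i j ≡ true → ∀ e → i ≤ e → e < j → e + j ≤ m + 1 →
    (j ≡ suc e ⊎ e + j ≡ m + 1) → Λ (C E (suc e) j) ≡ Λ j → TightHook n a (embed T) i j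
  dyckHook {i} {j} (1≤i , i<j , le) inE e i≤e e<j e+j end Λ-end = record
    { arm = k ; short = subst (_≤ j) (sym end-k) e<j
    ; reach = subst (λ t → t + j ≤ m + 1) (sym (m+[n∸m]≡n i≤e)) e+j ; start = i , suc i ; rest = ps ; is-hook = is-hook
    ; dyck = dyck ; tight = trans (S-embed T ((i , suc i) ∷ ps)) (cong ℤtoℚ tight) }
    where
    k = e ∸ i
    end-k : suc i + k ≡ suc e
    end-k = cong suc (m+[n∸m]≡n i≤e)
    ps = rowP i (suc (suc i)) (j ∸ suc i) (colP (suc i) j k)
    is-hook : (i , suc i) ∷ ps ≡ hook i j k
    is-hook = cong (λ l → rowP i (suc i) l (colP (suc i) j k)) (sym (+-∸-assoc 1 i<j))
    last : lastE (i , suc i) ps ≡ (e , j)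
    last = trans (lastE-rowP i (suc i) (j ∸ suc i) _) (trans (cong (λ t → lastE (i , t) (colP (suc i) j k)) (m∸n+n≡m i<j))
      (trans (lastE-colP i j k) (cong (_, j) (m∸n+n≡m i≤e))))
    valid : All (ValidC n) ((i , suc i) ∷ ps)
    valid = subst (All (ValidC n)) (sym is-hook) (hook-All i<j
      (λ i<b b≤j → 1≤i , i<b , ≤-trans (+-monoʳ-≤ i b≤j) le)
      (λ {b} i<b b≤ → let b≤e = ≤-trans b≤ (≤-reflexive (m+[n∸m]≡n i≤e)) in
        ≤-trans 1≤i (<⇒≤ i<b) , ≤-<-trans b≤e e<j , ≤-trans (+-monoˡ-≤ j b≤e) e+j))
    chain : Chain (i , suc i) ps
    chain = Chain-rowP i (suc i) (j ∸ suc i) (subst (λ t → Chain (i , t) (colP (suc i) j k)) (sym (m∸n+n≡m i<j)) (Chain-colP i j k))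
    dyck : DyckC n (i , suc i) ps
    dyck = refl , valid , chain ,
      subst (λ (e , j) → (j ≡ suc e) ⊎ (e + j ≡ m + 1)) (sym last) end
    tight : sumT T ((i , suc i) ∷ ps) ≡ + MC n a (i , suc i) ps
    tight = begin
      sumT T ((i , suc i) ∷ ps)               ≡⟨ cong (sumT T) is-hook ⟩
      sumT T (hook i j k)                     ≡⟨ hook-sum Λℤ k i<j inE (subst (_≤ j) (sym end-k) e<j) ⟩
      Λℤ i ℤ.- Λℤ (C E (suc i + k) j)         ≡⟨ cong (λ t → Λℤ i ℤ.- + t)
                                                  (trans (cong (λ t → Λ (C E t j)) end-k) (trans Λ-end (cong Λ (sym (cong proj₂ last))))) ⟩
      Λℤ i ℤ.- Λℤ (proj₂ (lastE (i , suc i) ps)) ≡⟨ Dyck-Λ {i , suc i} {ps} dyck ⟩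
      + MC n a (i , suc i) ps                 ∎
      where open ≡-Reasoning

  -- Inside the type C region the hook of (i,j) stops at the antidiagonal, or at (j-1,j) if that comes first.
  tightHook : ∀ {i j} → ValidC n (i , j) → E i j ≡ true → TightHook n a (embed T) i j
  tightHook {i} {suc j} v@(1≤i , s≤s i≤j , le) e with suc j ≤? n
  ... | yes j<n = dyckHook v e j i≤j ≤-refl
      (≤-trans (+-mono-≤ (<⇒≤ j<n) (m≤n⇒m≤1+n j<n)) (≤-reflexive suc-n)) (inj₁ refl) (cong Λ (C-refl E (suc j)))
  ... | no j≮n = dyckHook v e (ι m (suc j)) (m+n≤o⇒m≤o∸n i le) below (≤-reflexive sum) (inj₂ sum)
      (trans (Λ-high (C-high (s≤s z≤n) below j<m (s≤s (≤-reflexive (sym sum))))) (sym (Λ-high n<j)))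
    where
    n<j = ≰⇒> j≮n
    j<m = below-antidiagonal 1≤i le
    below : ι m (suc j) < suc j
    below = ≤-<-trans (ι-low n<j) n<j
    sum : ι m (suc j) + suc j ≡ m + 1
    sum = m∸n+n≡m (≤-trans j<m (m≤m+n m 1))

  active : ∀ {i j} → ValidC n (i , j) → embed T i j ≡ 0ℚ ⊎ TightHook n a (embed T) i j
  active {i} {j} v@(_ , i<j , _) with E i j in e
  ... | false = inj₁ (cong ℤtoℚ (cell-out Λℤ i<j e))
  ... | true = inj₂ (tightHook v e)

-- The weight of T

module WeightOf (n : ℕ) (f₀ : Fin n) (a : ℕ → ℕ) (E : SegSet) (symRp : SymRp n E) where
  open Folding n f₀
  open Sym E symRp
  open Cells E
  open Weights n f₀ a
  open Odd Λℤ Λℤ-vanish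
  open Point n f₀ a E symRp using (T; C-high)

  -- Beyond the antidiagonal all values met along a row exceed n, where Λ vanishes.
  ΛR-beyond : ∀ {r} → 1 ≤ r → r ≤ n → Λℤ (R E r (ι m r)) ≡ Λℤ (R E r m)
  ΛR-beyond {r} 1≤r r≤n = trans (sym (go (m ∸ ι m r) (≤-reflexive reach))) (cong (λ t → Λℤ (R E r t)) reach)
    where
    reach : m ∸ ι m r + ι m r ≡ m
    reach = m∸n+n≡m (ι-≤ 1≤r)
    go : ∀ d → d + ι m r ≤ m → Λℤ (R E r (d + ι m r)) ≡ Λℤ (R E r (ι m r))
    go zero _ = refl
    go (suc d) le = trans (sym (ℤₚ.i-j≡0⇒i≡j (Λℤ (R E r (d + ι m r))) (Λℤ (R E r (suc d + ι m r))) flat)) (go d (<⇒≤ le))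
      where
      r<j : r < suc d + ι m r
      r<j = s≤s (≤-trans (≤-trans r≤n (<⇒≤ (ι-high r≤n))) (m≤n+m (ι m r) d))
      beyond : m + 1 < r + (suc d + ι m r)
      beyond = subst (_< r + (suc d + ι m r)) (ι-sum (≤-trans r≤n n≤m)) (+-monoʳ-< r (s≤s (m≤n+m (ι m r) d)))
      flat : Λℤ (R E r (d + ι m r)) ℤ.- Λℤ (R E r (suc d + ι m r)) ≡ + 0
      flat = trans (cell-col Λℤ r<j) (cong₂ ℤ._-_ (Λℤ-vanish (C-high 1≤r (<⇒≤ r<j) le beyond))
        (Λℤ-vanish (C-high (s≤s z≤n) r<j le (m≤n⇒m≤1+n beyond))))

  rowLength : ∀ {i} → i ≤ n → i + (ι m i ∸ i) ≡ ι m i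
  rowLength i≤n = m+[n∸m]≡n (≤-trans i≤n (<⇒≤ (ι-high i≤n)))

  module At {r : ℕ} (1≤r : 1 ≤ r) (r≤n : r ≤ n) where
    open Roots r≤n

    r≤m = ≤-trans r≤n n≤m

    rowTotal : ℕ → ℤ
    rowTotal i = Σℤ (suc i) (ι m i ∸ i) (T i)

    -- Summed over i, this is the total of the part of column c that lies in the type C region.
    hits : ℕ → ℕ → ℤ
    hits c i = Σℤ (suc i) (ι m i ∸ i) (λ j → T i j ℤ.* ind c j)

    inner : ∀ {i} → 1 ≤ i → i ≤ n →
      Σℤ (suc i) (ι m i ∸ i) (λ j → T i j ℤ.* αij n i j r) ≡ rowTotal i ℤ.* ind r i ℤ.+ (ℤ.- hits r i ℤ.+ hits (ι m r) i)
    inner {i} 1≤i i≤n = begin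
      Σℤ (suc i) k (λ j → T i j ℤ.* αij n i j r)
        ≡⟨ Σ-cong (suc i) k (λ {j} i<j j< → trans (cong (λ t → T i j ℤ.* t) (αij-ind i≤n i<j (j≤m j<)))
             (*-distrib-root (T i j) (ind r i) (ind r j) (ind (ι m r) j))) ⟩
      Σℤ (suc i) k (λ j → T i j ℤ.* ind r i ℤ.+ (ℤ.- (T i j ℤ.* ind r j) ℤ.+ T i j ℤ.* ind (ι m r) j))
        ≡⟨ Σ-+ (suc i) k (λ j → T i j ℤ.* ind r i) (λ j → ℤ.- (T i j ℤ.* ind r j) ℤ.+ T i j ℤ.* ind (ι m r) j) ⟩
      Σℤ (suc i) k (λ j → T i j ℤ.* ind r i) ℤ.+ Σℤ (suc i) k (λ j → ℤ.- (T i j ℤ.* ind r j) ℤ.+ T i j ℤ.* ind (ι m r) j)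
        ≡⟨ cong₂ ℤ._+_ (Σ-*ʳ (suc i) k (T i) (ind r i))
             (trans (Σ-+ (suc i) k (λ j → ℤ.- (T i j ℤ.* ind r j)) (λ j → T i j ℤ.* ind (ι m r) j))
                    (cong (ℤ._+ hits (ι m r) i) (Σ-neg (suc i) k (λ j → T i j ℤ.* ind r j)))) ⟩
      rowTotal i ℤ.* ind r i ℤ.+ (ℤ.- hits r i ℤ.+ hits (ι m r) i) ∎
      where
      open ≡-Reasoning
      k = ι m i ∸ i
      j≤m : ∀ {j} → j < suc i + k → j ≤ m
      j≤m j< = ≤-trans (s≤s⁻¹ j<) (≤-trans (≤-reflexive (rowLength i≤n)) (ι-≤ 1≤i))

    rows-total : Σℤ 1 n (λ i → rowTotal i ℤ.* ind r i) ≡ Λℤ r ℤ.- Λℤ (R E r m)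
    rows-total = trans (Σ-ind-in 1 n rowTotal 1≤r (s≤s r≤n)) (trans (row-sum Λℤ r (ι m r ∸ r))
      (cong (λ t → Λℤ r ℤ.- t) (trans (cong (λ t → Λℤ (R E r t)) (rowLength r≤n)) (ΛR-beyond 1≤r r≤n))))

    low-total : Σℤ 1 n (hits r) ≡ Λℤ (C E 1 r) ℤ.- Λℤ r
    low-total = trans (Σ-truncate 1 (≤-trans (m∸n≤m r 1) r≤n)
        (λ {i} 1≤i i< → let i<r = subst (i <_) (m+[n∸m]≡n 1≤r) i<; i≤n = ≤-trans (<⇒≤ i<r) r≤n in
          Σ-ind-in (suc i) (ι m i ∸ i) (T i) i<r (s≤s (≤-trans (≤-trans r≤n (<⇒≤ (ι-high i≤n))) (≤-reflexive (sym (rowLength i≤n))))))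
        (λ {i} le _ → Σ-ind-out (suc i) (ι m i ∸ i) (T i) (inj₁ (s≤s (subst (_≤ i) (m+[n∸m]≡n 1≤r) le)))))
      (trans (col-sum Λℤ 1 r (r ∸ 1) (≤-reflexive (m+[n∸m]≡n 1≤r)))
        (cong (λ t → Λℤ (C E 1 r) ℤ.- Λℤ t) (trans (cong (λ t → C E t r) (m+[n∸m]≡n 1≤r)) (C-refl E r))))

    -- Column ι r stays in the region down to row r; the next value below exceeds n, so its Λ is 0,
    -- and the value at the top is by symmetry the complement of R r m.
    high-total : Σℤ 1 n (hits (ι m r)) ≡ Λℤ (ι m (R E r m))
    high-total = trans (Σ-truncate 1 r≤n
        (λ {i} 1≤i i< → let i≤r = s≤s⁻¹ i<; i≤n = ≤-trans i≤r r≤n in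
          Σ-ind-in (suc i) (ι m i ∸ i) (T i) (≤-<-trans i≤n (ι-high r≤n)) (s≤s (≤-trans (ι-anti {m} i≤r) (≤-reflexive (sym (rowLength i≤n))))))
        (λ {i} r<i i< → let i≤n = s≤s⁻¹ i< in
          Σ-ind-out (suc i) (ι m i ∸ i) (T i) (inj₂ (≤-trans (s≤s (≤-reflexive (rowLength i≤n))) (ι-anti< r<i (≤-trans i≤n n≤m))))))
      (trans (col-sum Λℤ 1 (ι m r) r (≤-<-trans r≤n (ι-high r≤n)))
        (trans (cong₂ (λ s t → Λℤ s ℤ.- t) (C-boundary 1≤r r≤m)
                 (Λℤ-vanish (C-high (s≤s z≤n) (≤-<-trans r≤n (ι-high r≤n)) (ι-≤ 1≤r) (s≤s (≤-reflexive (sym (ι-sum r≤m)))))))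
          (ℤₚ.+-identityʳ _)))

    weight-sum : Σℤ 1 n (λ i → Σℤ (suc i) (ι m i ∸ i) (λ j → T i j ℤ.* αij n i j r)) ≡
      (Λℤ r ℤ.- Λℤ (R E r m)) ℤ.+ (ℤ.- (Λℤ (C E 1 r) ℤ.- Λℤ r) ℤ.+ Λℤ (ι m (R E r m)))
    weight-sum = begin
      Σℤ 1 n (λ i → Σℤ (suc i) (ι m i ∸ i) (λ j → T i j ℤ.* αij n i j r))
        ≡⟨ Σ-cong 1 n (λ 1≤i i< → inner 1≤i (s≤s⁻¹ i<)) ⟩
      Σℤ 1 n (λ i → rowTotal i ℤ.* ind r i ℤ.+ (ℤ.- hits r i ℤ.+ hits (ι m r) i))
        ≡⟨ Σ-+ 1 n (λ i → rowTotal i ℤ.* ind r i) (λ i → ℤ.- hits r i ℤ.+ hits (ι m r) i) ⟩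
      Σℤ 1 n (λ i → rowTotal i ℤ.* ind r i) ℤ.+ Σℤ 1 n (λ i → ℤ.- hits r i ℤ.+ hits (ι m r) i)
        ≡⟨ cong₂ ℤ._+_ rows-total (trans (Σ-+ 1 n (λ i → ℤ.- hits r i) (hits (ι m r)))
             (cong₂ ℤ._+_ (trans (Σ-neg 1 n (hits r)) (cong ℤ.-_ low-total)) high-total)) ⟩
      (Λℤ r ℤ.- Λℤ (R E r m)) ℤ.+ (ℤ.- (Λℤ (C E 1 r) ℤ.- Λℤ r) ℤ.+ Λℤ (ι m (R E r m))) ∎
      where open ≡-Reasoning

    -- The terms with R r m and its complement combine to `odd Λℤ`. Whichever side is unmoved
    -- contributes Λ r, which cancels, and the other side is the wire.
    weight-wire : Λℤ r ℤ.- ((Λℤ r ℤ.- Λℤ (R E r m)) ℤ.+ (ℤ.- (Λℤ (C E 1 r) ℤ.- Λℤ r) ℤ.+ Λℤ (ι m (R E r m))))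
      ≡ odd Λℤ (wire m E r)
    weight-wire = trans (weight-regroup (Λℤ r) (Λℤ (R E r m)) (Λℤ (C E 1 r)) (Λℤ (ι m (R E r m)))) (by-side (Network.unmoved m E cross 1≤r r≤m))
      where
      by-side : R E r m ≡ r ⊎ C E 1 r ≡ r → odd Λℤ (R E r m) ℤ.+ (Λℤ (C E 1 r) ℤ.- Λℤ r) ≡ odd Λℤ (wire m E r)
      by-side (inj₁ eq) = begin
        odd Λℤ (R E r m) ℤ.+ (Λℤ (C E 1 r) ℤ.- Λℤ r)  ≡⟨ cong (λ t → odd Λℤ t ℤ.+ (Λℤ (C E 1 r) ℤ.- Λℤ r)) eq ⟩
        odd Λℤ r ℤ.+ (Λℤ (C E 1 r) ℤ.- Λℤ r)          ≡⟨ cong (ℤ._+ (Λℤ (C E 1 r) ℤ.- Λℤ r)) (odd-low r≤n) ⟩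
        Λℤ r ℤ.+ (Λℤ (C E 1 r) ℤ.- Λℤ r)              ≡⟨ add-sub-cancel (Λℤ r) (Λℤ (C E 1 r)) ⟩
        Λℤ (C E 1 r)                                  ≡⟨ sym (odd-low (≤-trans (C-upper E 1≤r) r≤n)) ⟩
        odd Λℤ (C E 1 r)                              ≡⟨ cong (odd Λℤ) (sym (wire-C {m} {E} eq)) ⟩
        odd Λℤ (wire m E r)                           ∎
        where open ≡-Reasoning
      by-side (inj₂ eq) = begin
        odd Λℤ (R E r m) ℤ.+ (Λℤ (C E 1 r) ℤ.- Λℤ r)  ≡⟨ cong (λ t → odd Λℤ (R E r m) ℤ.+ (Λℤ t ℤ.- Λℤ r)) eq ⟩
        odd Λℤ (R E r m) ℤ.+ (Λℤ r ℤ.- Λℤ r)          ≡⟨ cong (λ t → odd Λℤ (R E r m) ℤ.+ t) (ℤₚ.+-inverseʳ (Λℤ r)) ⟩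
        odd Λℤ (R E r m) ℤ.+ + 0                      ≡⟨ ℤₚ.+-identityʳ _ ⟩
        odd Λℤ (R E r m)                              ≡⟨ cong (odd Λℤ) (sym (wire-R {m} {E} eq)) ⟩
        odd Λℤ (wire m E r)                           ∎
        where open ≡-Reasoning

  weight : ∀ f → μ n a T f ≡ act n (Ξ E) (lam n a) f
  weight f = begin
    μ n a T f                                   ≡⟨ cong (λ t → Λℤ r ℤ.- t) (trans (sum-coordsC n _) (At.weight-sum (Fin-pos f) (toℕ<n f))) ⟩
    Λℤ r ℤ.- ((Λℤ r ℤ.- Λℤ (R E r m)) ℤ.+ (ℤ.- (Λℤ (C E 1 r) ℤ.- Λℤ r) ℤ.+ Λℤ (ι m (R E r m))))
                                                ≡⟨ At.weight-wire (Fin-pos f) (toℕ<n f) ⟩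
    odd Λℤ w                                    ≡⟨ cong (odd Λℤ) (sym (enc-fold (wire-pos cross (Fin-pos f) (Fin-≤ f)) (wire-≤ cross (Fin-pos f) (Fin-≤ f)))) ⟩
    odd Λℤ (enc (neg w) (fold w))               ≡⟨ sym (signed-Λ (neg w) (fold w)) ⟩
    applySign (neg w) (Λℤ (suc (toℕ (fold w)))) ≡⟨ cong₂ (λ b x → applySign b (Λℤ (suc (toℕ x)))) (sym (Ξ-sign f)) (sym (Ξ-perm f)) ⟩
    act n (Ξ E) (lam n a) f                     ∎
    where
    open ≡-Reasoning
    r = suc (toℕ f)
    w = wire m E r

theorem5p2 : (n : ℕ) → 1 ≤ n → (a : ℕ → ℕ) →
  Σ (SegSet → W n) λ Ξ →
    -- Ξ is a well-defined map on symmetric elements of R_p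
    (∀ E E' → SymRp n E → SymRp n E' → SameSeg n E E' → EqW n (Ξ E) (Ξ E')) ×
    -- injective
    (∀ E E' → SymRp n E → SymRp n E' → EqW n (Ξ E) (Ξ E') → SameSeg n E E') ×
    -- onto W
    (∀ w → Σ SegSet λ E → SymRp n E × EqW n (Ξ E) w) ×
    -- x(E) = φ(T) with T ∈ Π_λ ⊂ P_λ a vertex of P_λ and T = T_{Ξ(E)}
    (∀ E → SymRp n E → ∀ (x : Pt ℚ) → IsXE n a E x →
      Σ (Pt ℤ) λ T →
        EqA n (φ n (embed T)) x × IsVertex n a (embed T) × IsTw n a (Ξ E) T)
-- x is any solution of the equations of x(E); uniqueness identifies it with the image of T.
theorem5p2 n 1≤n a = Ξ , Ξ-cong , Ξ-injective , Ξ-surjective , λ E symRp x isXE →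
    let open Point n f₀ a E symRp in
    T , IsXE-unique n a E φT-isXE isXE , vertex inP active , inP , WeightOf.weight n f₀ a E symRp
  where
  f₀ : Fin n
  f₀ = fromℕ< 1≤n
  open Folding n f₀
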